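{- Let $K$ be a field of characteristic $\neq 2$. There exists a family $(X_n)$ of finite weighted posets such that the family of polynomials $(\mathrm{IPP}(X_n))$ is $\mathrm{VNP}$-complete.
   Context: Ideal polynomial. A weighted poset is a finite poset $(X,\le)$ with a weight $w(x)$ attached to each element $x$, each weight being an indeterminate or a constant of $K$. An ideal of $(X,\le)$ is a subset $I\subseteq X$ such that $x\in I$ and $y\le x$ imply $y\in I$. The ideal polynomial is $\mathrm{IPP}(X)=\sum_{I}\prod_{x\in I}w(x)$, the sum running over all ideals $I$ of $(X,\le)$. Valiant's model over $K$. A $p$-family of polynomials is a sequence $(f_n)$ of multivariate polynomials over $K$ whose number of variables and degree are polynomially bounded in $n$. $\mathrm{VP}$ is the class of $p$-families $(f_n)$ such that the minimum number of nodes of an arithmetic circuit (operations $+,\times$; inputs variables or constants of $K$) computing $f_n$ is polynomially bounded. $\mathrm{VNP}$ is the class of $p$-families $(f_n)$ for which there is $(g_n)\in\mathrm{VP}$ with $f_n(X_1,\dots,X_{p(n)})=\sum_{\varepsilon\in\{0,1\}^{q(n)}}g_n(X_1,\dots,X_{p(n)},\varepsilon_1,\dots,\varepsilon_{q(n)})$. A polynomial $f$ is a projection of $g$ ($f\le g$) if $f=g(a_1,\dots,a_u)$ where each $a_i$ is a variable of $f$ or a constant of $K$. A $p$-family $(f_n)$ is a $p$-projection of $(g_m)$ if there is a polynomially bounded $t:\mathbb{N}\to\mathbb{N}$ such that $f_n\le g_{t(n)}$ for all sufficiently large $n$. A $p$-family $g\in\mathrm{VNP}$ is $\mathrm{VNP}$-complete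 if every $f\in\mathrm{VNP}$ is a $p$-projection of $g$. -}

module Defs where

open import Algebra.Apartness.Bundles using (HeytingField)
open import Algebra.Bundles using (RawSemiring)
import Algebra.Definitions.RawSemiring as SemiringDefinitions
open import Data.Bool.Base using (Bool; true; false; if_then_else_)
open import Data.Fin.Base using (Fin; zero; suc; splitAt)
open import Data.Fin.Properties using (all?)
open import Data.Fin.Subset using (Subset; _∈_)
open import Data.Fin.Subset.Properties using (_∈?_)
open import Data.List.Base using (List; []; _∷_; _++_; map; foldr; filter; allFin; cartesianProductWith)
open import Data.Nat.Base using (ℕ; zero; suc; _≤_; _<_; _≥_)
import Data.Nat.Base as ℕ
import Data.Nat.Properties as ℕₚ
open import Data.Product.Base using (Σ-syntax; ∃-syntax; _×_; _,_)
open import Data.Sum.Base using (_⊎_; inj₁; inj₂; [_,_]′)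
open import Data.Vec.Base as Vec using (Vec; []; _∷_; lookup; replicate; zipWith; _[_]≔_)
open import Data.Vec.Properties using (≡-dec)
open import Function.Base using (_∘_)
open import Level using (_⊔_; 0ℓ) renaming (suc to lsuc)
open import Relation.Binary.Core using (Rel)
open import Relation.Binary.PropositionalEquality.Core using (_≡_)
open import Relation.Binary.Structures using (IsDecPartialOrder)
open import Relation.Nullary.Decidable using (Dec; does; _→-dec_)

PolynomiallyBounded : (ℕ → ℕ) → Set
PolynomiallyBounded t = ∃[ c ] ∃[ k ] (∀ n → t n ≤ c ℕ.* n ℕ.^ k ℕ.+ c)

allBoolVecs : ∀ n → List (Vec Bool n)
allBoolVecs zero    = [] ∷ []
allBoolVecs (suc n) = map (false ∷_) (allBoolVecs n) ++ map (true ∷_) (allBoolVecs n)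

module _ {c ℓ₁ ℓ₂} (K : HeytingField c ℓ₁ ℓ₂) where

  private
    module K = HeytingField K

  -- Inequality in a Heyting field is apartness; classically, by tightness,
  -- this is 1 + 1 ≉ 0.
  CharacteristicNotTwo : Set ℓ₂
  CharacteristicNotTwo = (K.1# K.+ K.1#) K.# K.0#

  Monomial : ℕ → Set
  Monomial v = Vec ℕ v

  -- A polynomial is presented by a finite list of terms, in any order and
  -- possibly with repeated monomials or zero coefficients; _≈ᴾ_ below is the
  -- intended equality.
  Poly : ℕ → Set c
  Poly v = List (K.Carrier × Monomial v)

  module _ {v : ℕ} where

    coeff : Poly v → Monomial v → K.Carrier
    coeff []            m = K.0#
    coeff ((a , e) ∷ p) m = (if does (≡-dec ℕₚ._≟_ e m) then a else K.0#) K.+ coeff p m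

    infix 4 _≈ᴾ_
    _≈ᴾ_ : Rel (Poly v) ℓ₁
    p ≈ᴾ q = ∀ m → coeff p m K.≈ coeff q m

    DegreeAtMost : Poly v → ℕ → Set ℓ₁
    DegreeAtMost p d = ∀ m → d < Vec.sum m → coeff p m K.≈ K.0#

    const : K.Carrier → Poly v
    const a = (a , replicate v 0) ∷ []

    var : Fin v → Poly v
    var i = (K.1# , replicate v 0 [ i ]≔ 1) ∷ []

    mulTerm : K.Carrier × Monomial v → K.Carrier × Monomial v → K.Carrier × Monomial v
    mulTerm (a , e) (b , e′) = a K.* b , zipWith ℕ._+_ e e′

  polyRawSemiring : ℕ → RawSemiring c ℓ₁
  polyRawSemiring v = record
    { Carrier = Poly v
    ; _≈_     = _≈ᴾ_
    ; _+_     = _++_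
    ; _*_     = cartesianProductWith mulTerm
    ; 0#      = []
    ; 1#      = const K.1#
    }

  module _ {v : ℕ} where

    open RawSemiring (polyRawSemiring v) using (_+_; _*_; 0#; 1#)
    open SemiringDefinitions (polyRawSemiring v) using (product; _^_)

    sumOver : ∀ {a} {A : Set a} → List A → (A → Poly v) → Poly v
    sumOver xs f = foldr (λ x p → f x + p) 0# xs

    productOver : ∀ {a} {A : Set a} → List A → (A → Poly v) → Poly v
    productOver xs f = foldr (λ x p → f x * p) 1# xs

    substitute : ∀ {u} → Poly u → (Fin u → Poly v) → Poly v
    substitute p a = sumOver p λ (b , e) → const b * product (λ i → a i ^ lookup e i)

  Atom : ℕ → Set c
  Atom v = Fin v ⊎ K.Carrier

  atom : ∀ {v} → Atom v → Poly v
  atom = [ var , const ]′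

  record WeightedPoset (v : ℕ) : Set (lsuc 0ℓ ⊔ c) where
    infix 4 _≼_
    field
      size              : ℕ
      _≼_               : Rel (Fin size) 0ℓ
      isDecPartialOrder : IsDecPartialOrder _≡_ _≼_
      weight            : Fin size → Atom v

    open IsDecPartialOrder isDecPartialOrder public using () renaming (_≤?_ to _≼?_)

    IsIdeal : Subset size → Set
    IsIdeal I = ∀ x → x ∈ I → ∀ y → y ≼ x → y ∈ I

    isIdeal? : ∀ I → Dec (IsIdeal I)
    isIdeal? I = all? λ x → (x ∈? I) →-dec all? λ y → (y ≼? x) →-dec (y ∈? I)

  IPP : ∀ {v} → WeightedPoset v → Poly v
  IPP X = sumOver (filter isIdeal? (allBoolVecs size)) λ I →
          productOver (filter (_∈? I) (allFin size)) λ x → atom (weight x)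
    where open WeightedPoset X

  data Gate (v k : ℕ) : Set c where
    input : Atom v → Gate v k
    plus  : Fin k → Fin k → Gate v k
    times : Fin k → Fin k → Gate v k

  -- Circuit v s has s nodes, listed in a topological order. Node zero is the
  -- most recent one, and a gate refers to the nodes preceding it.
  data Circuit (v : ℕ) : ℕ → Set c where
    []  : Circuit v 0
    _▷_ : ∀ {k} → Circuit v k → Gate v k → Circuit v (suc k)

  module _ {v : ℕ} where

    open RawSemiring (polyRawSemiring v) using (_+_; _*_)

    value     : ∀ {k} → Circuit v k → Fin k → Poly v
    gateValue : ∀ {k} → Circuit v k → Gate v k → Poly v

    value (C ▷ g) zero    = gateValue C g
    value (C ▷ g) (suc i) = value C i

    gateValue C (input a)   = atom a
    gateValue C (plus i j)  = value C i + value C j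
    gateValue C (times i j) = value C i * value C j

    CircuitSizeAtMost : Poly v → ℕ → Set (c ⊔ ℓ₁)
    CircuitSizeAtMost p b =
      ∃[ s ] s ≤ b × Σ[ C ∈ Circuit v s ] Σ[ out ∈ Fin s ] p ≈ᴾ value C out

  record Family : Set c where
    constructor family
    field
      vars : ℕ → ℕ
      poly : ∀ n → Poly (vars n)

  open Family

  IsPFamily : Family → Set ℓ₁
  IsPFamily f =
    PolynomiallyBounded (vars f) ×
    (∃[ d ] PolynomiallyBounded d × (∀ n → DegreeAtMost (poly f n) (d n)))

  VP : Family → Set (c ⊔ ℓ₁)
  VP f =
    IsPFamily f ×
    (∃[ s ] PolynomiallyBounded s × (∀ n → CircuitSizeAtMost (poly f n) (s n)))

  boolConst : ∀ {v} → Bool → Poly v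
  boolConst b = const (if b then K.1# else K.0#)

  booleanSum : ∀ p {q} → Poly (p ℕ.+ q) → Poly p
  booleanSum p {q} g = sumOver (allBoolVecs q) λ ε →
    substitute g ([ var , boolConst ∘ lookup ε ]′ ∘ splitAt p)

  VNP : Family → Set (c ⊔ ℓ₁)
  VNP f =
    IsPFamily f ×
    (Σ[ q ∈ (ℕ → ℕ) ] Σ[ g ∈ (∀ n → Poly (vars f n ℕ.+ q n)) ]
      VP (family (λ n → vars f n ℕ.+ q n) g) ×
      (∀ n → poly f n ≈ᴾ booleanSum (vars f n) (g n)))

  IsProjectionOf : ∀ {v u} → Poly v → Poly u → Set (c ⊔ ℓ₁)
  IsProjectionOf {v} {u} f g =
    Σ[ a ∈ (Fin u → Atom v) ] f ≈ᴾ substitute g (atom ∘ a)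

  IsPProjectionOf : Family → Family → Set (c ⊔ ℓ₁)
  IsPProjectionOf f g =
    Σ[ t ∈ (ℕ → ℕ) ] PolynomiallyBounded t ×
    (∃[ n₀ ] (∀ n → n ≥ n₀ → IsProjectionOf (poly f n) (poly g (t n))))

  VNPComplete : Family → Set (c ⊔ ℓ₁)
  VNPComplete g = VNP g × (∀ f → VNP f → IsPProjectionOf f g)

{-# OPTIONS --safe #-}
-- Let X_N have N minimal elements and, for each (i , j), one element above the
-- i-th and the j-th of them, all weights y_i and z_ij being distinct variables.
-- Then IPP(X_N) = Σ_S Π_{i ∈ S} y_i Π_{i,j ∈ S} (1 + z_ij), and projecting each
-- z_ij to −1 or 0 leaves the sum over the independent sets of an arbitrary graph
-- with weights y_i. A vertex of weight −1 joined to x₁, …, x_k contributes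
-- 1 − [no x_i is chosen], so clauses, and hence negation, can be expressed.
--
-- It remains to write Σ_ε g(x, ε), for a circuit computing g of degree at most d,
-- as such a sum. The part of degree n + 1 of a gate is demanded on an interval of
-- n + 1 out of d slots. A sum gate passes its demand on to one of its arguments; a
-- product gate splits the interval between its arguments. Demanded intervals
-- therefore stay disjoint, no gate is demanded twice on an interval, and a demand is
-- recorded by a disjunction of Boolean variables although a gate has many parents.
-- Processing the gates from the output to the inputs yields the product of the
-- demanded values.
module Submission where

open import Algebra.Apartness.Bundles using (HeytingField; HeytingCommutativeRing)
open import Algebra.Bundles using (CommutativeSemiring; CommutativeRing; RawSemiring)
import Algebra.Definitions.RawSemiring as SemiringDefinitions
open import Data.Bool.Base using (Bool; true; false; if_then_else_; _∧_; _∨_; not)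
open import Data.Bool.ListAction using (any; all)
open import Data.Bool.Properties using (∧-identityʳ; ∧-zeroʳ; ∨-identityʳ; ∨-zeroʳ; not-involutive)
open import Data.Empty using (⊥)
open import Data.Fin.Base using (Fin; zero; suc; splitAt; _↑ˡ_; _↑ʳ_; remQuot; combine)
import Data.Fin.Properties as Fin
open import Data.Fin.Subset using (Subset) renaming (_∈_ to _∈ˢ_)
open import Data.Fin.Subset.Properties using () renaming (_∈?_ to _∈ˢ?_)
open import Data.List.Base using (List; []; _∷_; _++_; map; foldr; filter; length; allFin; upTo; deduplicate; cartesianProduct; cartesianProductWith)
import Data.List.Membership.DecPropositional as DecMembership
open import Data.List.Membership.Propositional using (_∈_; _∉_)
open import Data.List.Membership.Propositional.Properties using (∈-∃++; ∈-++⁺ˡ; ∈-++⁺ʳ; ∈-++⁻; ∈-map⁺; ∈-map⁻; ∈-allFin; ∈-upTo⁺; ∈-upTo⁻; ∈-cartesianProduct⁺; ∈-cartesianProduct⁻; ∈-deduplicate⁺)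
open import Data.List.Properties using (filter-++; map-upTo; map-tabulate; length-++; length-map; length-upTo; length-filter; length-tabulate)
open import Data.List.Relation.Unary.All as All using (All; []; _∷_)
import Data.List.Relation.Unary.All.Properties as All
open import Data.List.Relation.Unary.AllPairs as AllPairs using (AllPairs; []; _∷_)
import Data.List.Relation.Unary.AllPairs.Properties as AllPairs
open import Data.List.Relation.Unary.Any using (here; there)
import Data.List.Relation.Unary.Unique.DecPropositional.Properties as UniqueDec
open import Data.List.Relation.Unary.Unique.Propositional using (Unique)
import Data.List.Relation.Unary.Unique.Propositional.Properties as Unique
open import Data.Nat.Base using (ℕ; zero; suc; _≡ᵇ_; _≤_; _<_; z≤n; s≤s)
import Data.Nat.Base as ℕ
import Data.Nat.Properties as ℕₚ
open import Data.Nat.Tactic.RingSolver using (solve-∀)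
open import Data.Product.Base using (Σ-syntax; ∃-syntax; _×_; _,_; proj₁; proj₂; map₁)
import Data.Product.Properties as Product
open import Data.Sum.Base as Sum using (_⊎_; inj₁; inj₂; [_,_]′)
open import Data.Vec.Base as Vec using (Vec; []; _∷_; lookup; replicate; zipWith; _[_]≔_)
import Data.Vec.Functional as Vector
open import Data.Vec.Properties using (≡-dec; lookup⇒[]=; []=⇒lookup; lookup-++ˡ; lookup-++ʳ; lookup-map; zipWith-assoc; zipWith-comm; zipWith-identityˡ)
open import Function.Base using (_∘_; _on_; id)
open import Function.Bundles using (mk⇔)
open import Level using (Level; _⊔_; 0ℓ)
open import Relation.Binary.Core using (Rel)
open import Relation.Binary.Definitions using (DecidableEquality; Symmetric)
open import Relation.Binary.PropositionalEquality.Core as ≡ using (_≡_; _≢_)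
import Relation.Binary.PropositionalEquality.Properties as ≡
open import Relation.Binary.Structures using (IsDecPartialOrder)
open import Relation.Nullary.Decidable using (Dec; does; yes; no; dec-true; dec-false; does-⇔; _⊎-dec_)
open import Relation.Nullary.Negation using (¬_; contradiction)
open import Relation.Unary using (Pred; Decidable)
open import Defs

-- The obstacle is sharing. Unfolding a circuit into a formula can be exponential, while one Boolean
-- flag per gate cannot tell a single use from two, as the square of a gate requires. A pair of a
-- gate and an interval is used at most once, and a circuit with `k` gates has at most `k * d * d`
-- relevant pairs. For this the intervals must be nonempty, since two empty ones could coincide;
-- that is why factors of degree 0 are never demanded and enter as field constants. Intermediate
-- gates may have degree far above `d`, through terms that cancel later; only their parts of degree
-- at most `d` are ever demanded, and the degree bound on the output makes these suffice. The
-- Boolean variables of the given sum and the choices made inside the circuit are bound variables of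
-- one and the same program, so a single sum over independent sets covers both. The number of its
-- vertices is fixed by bounds on `q`, `d` and the circuit size alone: vertices to spare receive
-- weight 0.

module BigOperators {c ℓ} (R : CommutativeSemiring c ℓ) where

  open CommutativeSemiring R hiding (zero)
  open import Algebra.Properties.CommutativeSemigroup +-commutativeSemigroup using (interchange)
  open import Relation.Binary.Reasoning.Setoid setoid

  private
    variable
      a b d p : Level
      A : Set a
      B : Set b
      D : Set d

  -- Finite sums and products in a commutative semiring

  ∑ : List A → (A → Carrier) → Carrier
  ∑ xs f = foldr (λ x s → f x + s) 0# xs

  ∏ : List A → (A → Carrier) → Carrier
  ∏ xs f = foldr (λ x s → f x * s) 1# xs

  ∑-cong : ∀ (xs : List A) {f g : A → Carrier} → (∀ x → f x ≈ g x) → ∑ xs f ≈ ∑ xs g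
  ∑-cong []       f≈g = refl
  ∑-cong (x ∷ xs) f≈g = +-cong (f≈g x) (∑-cong xs f≈g)

  ∏-cong : ∀ (xs : List A) {f g : A → Carrier} → (∀ x → f x ≈ g x) → ∏ xs f ≈ ∏ xs g
  ∏-cong []       f≈g = refl
  ∏-cong (x ∷ xs) f≈g = *-cong (f≈g x) (∏-cong xs f≈g)

  ∑-++ : ∀ (xs ys : List A) {f : A → Carrier} → ∑ (xs ++ ys) f ≈ ∑ xs f + ∑ ys f
  ∑-++ []       ys = sym (+-identityˡ _)
  ∑-++ (x ∷ xs) ys = trans (+-congˡ (∑-++ xs ys)) (sym (+-assoc _ _ _))

  ∏-++ : ∀ (xs ys : List A) {f : A → Carrier} → ∏ (xs ++ ys) f ≈ ∏ xs f * ∏ ys f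
  ∏-++ []       ys = sym (*-identityˡ _)
  ∏-++ (x ∷ xs) ys = trans (*-congˡ (∏-++ xs ys)) (sym (*-assoc _ _ _))

  ∑-map : ∀ (h : A → B) (xs : List A) {f : B → Carrier} → ∑ (map h xs) f ≈ ∑ xs (λ x → f (h x))
  ∑-map h []       = refl
  ∑-map h (x ∷ xs) = +-congˡ (∑-map h xs)

  ∏-map : ∀ (h : A → B) (xs : List A) {f : B → Carrier} → ∏ (map h xs) f ≈ ∏ xs (λ x → f (h x))
  ∏-map h []       = refl
  ∏-map h (x ∷ xs) = *-congˡ (∏-map h xs)

  ∑-zero : ∀ (xs : List A) → ∑ xs (λ _ → 0#) ≈ 0#
  ∑-zero []       = refl
  ∑-zero (x ∷ xs) = trans (+-identityˡ _) (∑-zero xs)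

  ∏-one : ∀ (xs : List A) → ∏ xs (λ _ → 1#) ≈ 1#
  ∏-one []       = refl
  ∏-one (x ∷ xs) = trans (*-identityˡ _) (∏-one xs)

  ∑-distrib-+ : ∀ (xs : List A) {f g : A → Carrier} → ∑ xs (λ x → f x + g x) ≈ ∑ xs f + ∑ xs g
  ∑-distrib-+ []       = sym (+-identityˡ _)
  ∑-distrib-+ (x ∷ xs) = trans (+-congˡ (∑-distrib-+ xs)) (interchange _ _ _ _)

  *-distribˡ-∑ : ∀ y (xs : List A) {f : A → Carrier} → y * ∑ xs f ≈ ∑ xs (λ x → y * f x)
  *-distribˡ-∑ y []       = zeroʳ y
  *-distribˡ-∑ y (x ∷ xs) = trans (distribˡ _ _ _) (+-congˡ (*-distribˡ-∑ y xs))

  *-distribʳ-∑ : ∀ y (xs : List A) {f : A → Carrier} → ∑ xs f * y ≈ ∑ xs (λ x → f x * y)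
  *-distribʳ-∑ y []       = zeroˡ y
  *-distribʳ-∑ y (x ∷ xs) = trans (distribʳ _ _ _) (+-congˡ (*-distribʳ-∑ y xs))

  ∑-swap : ∀ (xs : List A) (ys : List B) {f : A → B → Carrier} →
           ∑ xs (λ x → ∑ ys (f x)) ≈ ∑ ys (λ y → ∑ xs (λ x → f x y))
  ∑-swap []       ys = sym (∑-zero ys)
  ∑-swap (x ∷ xs) ys = trans (+-congˡ (∑-swap xs ys)) (sym (∑-distrib-+ ys))

  ∑-cartesianProductWith : ∀ (h : A → B → D) xs ys {f : D → Carrier} →
    ∑ (cartesianProductWith h xs ys) f ≈ ∑ xs (λ x → ∑ ys (λ y → f (h x y)))
  ∑-cartesianProductWith h []       ys = refl
  ∑-cartesianProductWith h (x ∷ xs) ys =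
    trans (∑-++ (map (h x) ys) _) (+-cong (∑-map (h x) ys) (∑-cartesianProductWith h xs ys))

  ∑-filter : ∀ {P : Pred A p} (P? : Decidable P) xs {f : A → Carrier} →
             ∑ (filter P? xs) f ≈ ∑ xs (λ x → if does (P? x) then f x else 0#)
  ∑-filter P? [] = refl
  ∑-filter P? (x ∷ xs) with does (P? x)
  ... | true  = +-congˡ (∑-filter P? xs)
  ... | false = trans (∑-filter P? xs) (sym (+-identityˡ _))

  ∏-filter : ∀ {P : Pred A p} (P? : Decidable P) xs {f : A → Carrier} →
             ∏ (filter P? xs) f ≈ ∏ xs (λ x → if does (P? x) then f x else 1#)
  ∏-filter P? [] = refl
  ∏-filter P? (x ∷ xs) with does (P? x)
  ... | true  = *-congˡ (∏-filter P? xs)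
  ... | false = trans (∏-filter P? xs) (sym (*-identityˡ _))

  if-cong : ∀ b {x y u w : Carrier} → x ≈ y → u ≈ w → (if b then x else u) ≈ (if b then y else w)
  if-cong true  x≈y u≈w = x≈y
  if-cong false x≈y u≈w = u≈w

  ∑-cong-∈ : ∀ (xs : List A) {f g : A → Carrier} → (∀ {x} → x ∈ xs → f x ≈ g x) → ∑ xs f ≈ ∑ xs g
  ∑-cong-∈ []       f≈g = refl
  ∑-cong-∈ (x ∷ xs) f≈g = +-cong (f≈g (here ≡.refl)) (∑-cong-∈ xs λ x∈xs → f≈g (there x∈xs))

  ∑-vanishing : ∀ (xs : List A) {f : A → Carrier} → (∀ {x} → x ∈ xs → f x ≈ 0#) → ∑ xs f ≈ 0#
  ∑-vanishing []       f≈0 = refl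
  ∑-vanishing (x ∷ xs) f≈0 =
    trans (+-cong (f≈0 (here ≡.refl)) (∑-vanishing xs λ x∈xs → f≈0 (there x∈xs))) (+-identityˡ _)

  ∑-single : ∀ {xs : List A} {x} {f : A → Carrier} → Unique xs → x ∈ xs →
             (∀ {y} → y ≢ x → f y ≈ 0#) → ∑ xs f ≈ f x
  ∑-single {xs = _ ∷ xs} (x∉xs ∷ _) (here ≡.refl) f≈0 =
    trans (+-congˡ (∑-vanishing xs λ y∈xs → f≈0 λ { ≡.refl → All.lookup x∉xs y∈xs ≡.refl })) (+-identityʳ _)
  ∑-single (y∉xs ∷ !xs) (there x∈xs) f≈0 =
    trans (+-cong (f≈0 λ { ≡.refl → All.lookup y∉xs x∈xs ≡.refl }) (∑-single !xs x∈xs f≈0)) (+-identityˡ _)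

  -- Complementing every coordinate permutes the cube. The compiled program binds variables that
  -- stand for `1 − ε j`, and this turns its sum into one over `ε`.
  ∑-allBoolVecs-not : ∀ n (f : Vec Bool n → Carrier) →
    ∑ (allBoolVecs n) (λ ε → f (Vec.map not ε)) ≈ ∑ (allBoolVecs n) f
  ∑-allBoolVecs-not zero    f = refl
  ∑-allBoolVecs-not (suc n) f = begin
    ∑ (allBoolVecs (suc n)) (λ ε → f (Vec.map not ε))
      ≈⟨ ∑-++ (map (false ∷_) (allBoolVecs n)) _ ⟩
    ∑ (map (false ∷_) (allBoolVecs n)) (λ ε → f (Vec.map not ε))
      + ∑ (map (true ∷_) (allBoolVecs n)) (λ ε → f (Vec.map not ε))
      ≈⟨ +-cong (∑-map (false ∷_) (allBoolVecs n)) (∑-map (true ∷_) (allBoolVecs n)) ⟩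
    ∑ (allBoolVecs n) (λ ε → f (true ∷ Vec.map not ε)) + ∑ (allBoolVecs n) (λ ε → f (false ∷ Vec.map not ε))
      ≈⟨ +-cong (∑-allBoolVecs-not n (f ∘ (true ∷_))) (∑-allBoolVecs-not n (f ∘ (false ∷_))) ⟩
    ∑ (allBoolVecs n) (f ∘ (true ∷_)) + ∑ (allBoolVecs n) (f ∘ (false ∷_))
      ≈⟨ +-comm _ _ ⟩
    ∑ (allBoolVecs n) (f ∘ (false ∷_)) + ∑ (allBoolVecs n) (f ∘ (true ∷_))
      ≈⟨ +-cong (∑-map (false ∷_) (allBoolVecs n)) (∑-map (true ∷_) (allBoolVecs n)) ⟨
    ∑ (map (false ∷_) (allBoolVecs n)) f + ∑ (map (true ∷_) (allBoolVecs n)) f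
      ≈⟨ ∑-++ (map (false ∷_) (allBoolVecs n)) _ ⟨
    ∑ (allBoolVecs (suc n)) f ∎

  ∏-allFin-suc : ∀ n (f : Fin (suc n) → Carrier) → ∏ (allFin (suc n)) f ≈ f zero * ∏ (allFin n) (f ∘ suc)
  ∏-allFin-suc n f = *-congˡ (trans
    (reflexive (≡.cong (λ xs → ∏ xs f) (≡.sym (map-tabulate {n = n} (λ i → i) suc)))) (∏-map suc (allFin n)))

  ∏-allFin-+ : ∀ m n (f : Fin (m ℕ.+ n) → Carrier) →
    ∏ (allFin (m ℕ.+ n)) f ≈ ∏ (allFin m) (λ i → f (i ↑ˡ n)) * ∏ (allFin n) (λ j → f (m ↑ʳ j))
  ∏-allFin-+ zero    n f = sym (*-identityˡ _)
  ∏-allFin-+ (suc m) n f = begin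
    ∏ (allFin (suc m ℕ.+ n)) f
      ≈⟨ ∏-allFin-suc (m ℕ.+ n) f ⟩
    f zero * ∏ (allFin (m ℕ.+ n)) (f ∘ suc)
      ≈⟨ *-congˡ (∏-allFin-+ m n (f ∘ suc)) ⟩
    f zero * (∏ (allFin m) (λ i → f (suc i ↑ˡ n)) * ∏ (allFin n) (λ j → f (suc m ↑ʳ j)))
      ≈⟨ *-assoc _ _ _ ⟨
    f zero * ∏ (allFin m) (λ i → f (suc i ↑ˡ n)) * ∏ (allFin n) (λ j → f (suc m ↑ʳ j))
      ≈⟨ *-congʳ (∏-allFin-suc m (λ i → f (i ↑ˡ n))) ⟨
    ∏ (allFin (suc m)) (λ i → f (i ↑ˡ n)) * ∏ (allFin n) (λ j → f (suc m ↑ʳ j)) ∎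

  ∑-allBoolVecs-suc : ∀ n (f : Vec Bool (suc n) → Carrier) →
    ∑ (allBoolVecs (suc n)) f ≈ ∑ (allBoolVecs n) (f ∘ (false ∷_)) + ∑ (allBoolVecs n) (f ∘ (true ∷_))
  ∑-allBoolVecs-suc n f = trans (∑-++ (map (false ∷_) (allBoolVecs n)) _)
    (+-cong (∑-map (false ∷_) (allBoolVecs n)) (∑-map (true ∷_) (allBoolVecs n)))

  ∑-allBoolVecs-+ : ∀ m n (f : Vec Bool (m ℕ.+ n) → Carrier) →
    ∑ (allBoolVecs (m ℕ.+ n)) f ≈ ∑ (allBoolVecs m) (λ ε → ∑ (allBoolVecs n) (λ ε′ → f (ε Vec.++ ε′)))
  ∑-allBoolVecs-+ zero    n f = sym (+-identityʳ _)
  ∑-allBoolVecs-+ (suc m) n f = trans (∑-allBoolVecs-suc (m ℕ.+ n) f) (trans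
    (+-cong (∑-allBoolVecs-+ m n (f ∘ (false ∷_))) (∑-allBoolVecs-+ m n (f ∘ (true ∷_))))
    (sym (∑-allBoolVecs-suc m (λ ε → ∑ (allBoolVecs n) (λ ε′ → f (ε Vec.++ ε′))))))

  -- The distributive law: a Boolean vector records which summand is taken from each factor. It
  -- serves to sum out the upper elements of the poset, and to show that padding variables of weight
  -- 0 contribute 1.
  ∑-allBoolVecs-∏ : ∀ n (f g : Fin n → Carrier) →
    ∑ (allBoolVecs n) (λ ε → ∏ (allFin n) (λ i → if lookup ε i then f i else g i)) ≈ ∏ (allFin n) (λ i → g i + f i)
  ∑-allBoolVecs-∏ zero    f g = +-identityʳ _
  ∑-allBoolVecs-∏ (suc n) f g = begin
    ∑ (allBoolVecs (suc n)) (λ ε → ∏ (allFin (suc n)) (term ε))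
      ≈⟨ ∑-allBoolVecs-suc n (λ ε → ∏ (allFin (suc n)) (term ε)) ⟩
    ∑ εs (λ ε → ∏ (allFin (suc n)) (term (false ∷ ε))) + ∑ εs (λ ε → ∏ (allFin (suc n)) (term (true ∷ ε)))
      ≈⟨ +-cong (∑-cong εs λ ε → ∏-allFin-suc n (term (false ∷ ε))) (∑-cong εs λ ε → ∏-allFin-suc n (term (true ∷ ε))) ⟩
    ∑ εs (λ ε → g zero * rest ε) + ∑ εs (λ ε → f zero * rest ε)
      ≈⟨ +-cong (*-distribˡ-∑ (g zero) εs) (*-distribˡ-∑ (f zero) εs) ⟨
    g zero * ∑ εs rest + f zero * ∑ εs rest
      ≈⟨ distribʳ _ _ _ ⟨
    (g zero + f zero) * ∑ εs rest
      ≈⟨ *-congˡ (∑-allBoolVecs-∏ n (f ∘ suc) (g ∘ suc)) ⟩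
    (g zero + f zero) * ∏ (allFin n) (λ i → g (suc i) + f (suc i))
      ≈⟨ ∏-allFin-suc n (λ i → g i + f i) ⟨
    ∏ (allFin (suc n)) (λ i → g i + f i) ∎
    where
    εs = allBoolVecs n
    term : Vec Bool (suc n) → Fin (suc n) → Carrier
    term ε i = if lookup ε i then f i else g i
    rest : Vec Bool n → Carrier
    rest ε = ∏ (allFin n) (λ i → if lookup ε i then f (suc i) else g (suc i))

  -- One false condition annihilates the product. This trades local conditions for a single global
  -- one, both for ideals and for independent sets.
  ∏-if : ∀ (xs : List A) (b : A → Bool) {f : A → Carrier} →
    ∏ xs (λ x → if b x then f x else 0#) ≈ (if all b xs then ∏ xs f else 0#)
  ∏-if []       b = refl
  ∏-if (x ∷ xs) b with b x
  ... | false = zeroˡ _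
  ... | true  = trans (*-congˡ (∏-if xs b)) (push (all b xs))
    where
    push : ∀ b {y z} → y * (if b then z else 0#) ≈ (if b then y * z else 0#)
    push true  = refl
    push false = zeroʳ _

-- The commutative semiring of polynomials

module Polynomials {c ℓ₁ ℓ₂} (K : HeytingField c ℓ₁ ℓ₂) where

  coefficientRing : CommutativeRing c ℓ₁
  coefficientRing = HeytingCommutativeRing.commutativeRing (HeytingField.heytingCommutativeRing K)

  coefficients : CommutativeSemiring c ℓ₁
  coefficients = CommutativeRing.commutativeSemiring coefficientRing

  private
    module K where
      open CommutativeRing coefficientRing public
      open BigOperators coefficients public
  open import Relation.Binary.Reasoning.Setoid K.setoid

  infixl 6 _⊕_
  _⊕_ : ∀ {v} → Monomial K v → Monomial K v → Monomial K v
  _⊕_ = zipWith ℕ._+_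

  -- These functionals detect ≈ᴾ and turn products of polynomials into iterated sums.
  linear : ∀ {v} → (Monomial K v → K.Carrier) → Poly K v → K.Carrier
  linear Φ p = K.∑ p λ (a , e) → a K.* Φ e

  -- Finite sums commute. The exchange underlies commutativity of the product and, later,
  -- multiplicativity of substitution.
  linear-swap : ∀ {u v} (Φ : Monomial K u → Monomial K v → K.Carrier) p q →
                linear (λ e → linear (Φ e) q) p K.≈ linear (λ e′ → linear (λ e → Φ e e′) p) q
  linear-swap Φ p q = begin
    K.∑ p (λ (a , e) → a K.* K.∑ q λ (b , e′) → b K.* Φ e e′)
      ≈⟨ K.∑-cong p (λ (a , e) → K.*-distribˡ-∑ a q) ⟩
    K.∑ p (λ (a , e) → K.∑ q λ (b , e′) → a K.* (b K.* Φ e e′))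
      ≈⟨ K.∑-swap p q ⟩
    K.∑ q (λ (b , e′) → K.∑ p λ (a , e) → a K.* (b K.* Φ e e′))
      ≈⟨ K.∑-cong q (λ (b , e′) → K.∑-cong p λ (a , e) → x∙yz≈y∙xz a b _) ⟩
    K.∑ q (λ (b , e′) → K.∑ p λ (a , e) → b K.* (a K.* Φ e e′))
      ≈⟨ K.∑-cong q (λ (b , e′) → K.*-distribˡ-∑ b p) ⟨
    K.∑ q (λ (b , e′) → b K.* K.∑ p λ (a , e) → a K.* Φ e e′) ∎
    where open import Algebra.Properties.CommutativeSemigroup K.*-commutativeSemigroup using (x∙yz≈y∙xz)

  module _ {v : ℕ} where

    private
      _≟_ = ≡-dec {n = v} ℕₚ._≟_
      module P = RawSemiring (polyRawSemiring K v)

    -- A record, because p and q cannot be recovered from the unfolding of ≈ᴾ.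
    infix 4 _≋_
    record _≋_ (p q : Poly K v) : Set ℓ₁ where
      constructor coefficientwise
      field coeff-≈ : p P.≈ q

    open _≋_ public

    linear-cong : ∀ {Φ Ψ} (p : Poly K v) → (∀ e → Φ e K.≈ Ψ e) → linear Φ p K.≈ linear Ψ p
    linear-cong p Φ≈Ψ = K.∑-cong p λ (a , e) → K.*-congˡ (Φ≈Ψ e)

    indicator : Monomial K v → Monomial K v → K.Carrier
    indicator m e = if does (e ≟ m) then K.1# else K.0#

    coeff≈linear : ∀ p m → coeff K p m K.≈ linear (indicator m) p
    coeff≈linear []            m = K.refl
    coeff≈linear ((a , e) ∷ p) m = K.+-cong (head (does (e ≟ m))) (coeff≈linear p m)
      where
      head : ∀ b → (if b then a else K.0#) K.≈ a K.* (if b then K.1# else K.0#)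
      head true  = K.sym (K.*-identityʳ a)
      head false = K.sym (K.zeroʳ a)

    private
      ∑-member : ∀ (Φ : Monomial K v → K.Carrier) a e S → Unique S → e ∈ S →
        K.∑ S (λ e′ → (if does (e ≟ e′) then a else K.0#) K.* Φ e′) K.≈ a K.* Φ e
      ∑-member Φ a e S !S e∈S = K.trans (K.∑-single !S e∈S off) on
        where
        on : (if does (e ≟ e) then a else K.0#) K.* Φ e K.≈ a K.* Φ e
        on rewrite dec-true (e ≟ e) ≡.refl = K.refl
        off : ∀ {e′} → e′ ≢ e → (if does (e ≟ e′) then a else K.0#) K.* Φ e′ K.≈ K.0#
        off {e′} e′≢e rewrite dec-false (e ≟ e′) (λ e≡e′ → e′≢e (≡.sym e≡e′)) = K.zeroˡ _

      -- Collecting equal monomials expresses the functional through coefficients, the only data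
      -- that `≈ᴾ` sees. `S` must be free of repetitions, or a monomial would be counted once per
      -- occurrence.
      linear-support : ∀ Φ S → Unique S → ∀ p → (∀ {t} → t ∈ p → proj₂ t ∈ S) →
                       linear Φ p K.≈ K.∑ S (λ e → coeff K p e K.* Φ e)
      linear-support Φ S !S [] p⊆S =
        K.sym (K.trans (K.∑-cong S λ e → K.zeroˡ (Φ e)) (K.∑-zero S))
      linear-support Φ S !S ((a , e) ∷ p) p⊆S = begin
        a K.* Φ e K.+ linear Φ p
          ≈⟨ K.+-cong (∑-member Φ a e S !S (p⊆S (here ≡.refl)))
                      (K.sym (linear-support Φ S !S p (λ t∈p → p⊆S (there t∈p)))) ⟨
        K.∑ S (λ e′ → (if does (e ≟ e′) then a else K.0#) K.* Φ e′) K.+ K.∑ S (λ e → coeff K p e K.* Φ e)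
          ≈⟨ K.∑-distrib-+ S ⟨
        K.∑ S (λ e′ → (if does (e ≟ e′) then a else K.0#) K.* Φ e′ K.+ coeff K p e′ K.* Φ e′)
          ≈⟨ K.∑-cong S (λ e′ → K.distribʳ (Φ e′) _ _) ⟨
        K.∑ S (λ e′ → coeff K ((a , e) ∷ p) e′ K.* Φ e′) ∎

    -- Both sides are summed over one common support, the exponents occurring in either list; there
    -- only the coefficients matter.
    linear-resp-≈ : ∀ Φ {p q : Poly K v} → p ≋ q → linear Φ p K.≈ linear Φ q
    linear-resp-≈ Φ {p} {q} p≈q = begin
      linear Φ p                         ≈⟨ linear-support Φ S !S p (λ t∈p → ∈-deduplicate⁺ _≟_ (∈-++⁺ˡ (∈-map⁺ proj₂ t∈p))) ⟩
      K.∑ S (λ e → coeff K p e K.* Φ e)  ≈⟨ K.∑-cong S (λ e → K.*-congʳ (coeff-≈ p≈q e)) ⟩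
      K.∑ S (λ e → coeff K q e K.* Φ e)  ≈⟨ linear-support Φ S !S q (λ t∈q → ∈-deduplicate⁺ _≟_ (∈-++⁺ʳ (map proj₂ p) (∈-map⁺ proj₂ t∈q))) ⟨
      linear Φ q                         ∎
      where
      S  = deduplicate _≟_ (map proj₂ p ++ map proj₂ q)
      !S = UniqueDec.deduplicate-! _≟_ (map proj₂ p ++ map proj₂ q)

    -- A coefficient is itself the value of a functional, that of the indicator of its monomial.
    linear⇒≈ : ∀ {p q : Poly K v} → (∀ Φ → linear Φ p K.≈ linear Φ q) → p ≋ q
    linear⇒≈ {p} {q} p≈q = coefficientwise λ m → begin
      coeff K p m            ≈⟨ coeff≈linear p m ⟩
      linear (indicator m) p ≈⟨ p≈q (indicator m) ⟩
      linear (indicator m) q ≈⟨ coeff≈linear q m ⟨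
      coeff K q m            ∎

    linear-+ : ∀ Φ (p q : Poly K v) → linear Φ (p P.+ q) K.≈ linear Φ p K.+ linear Φ q
    linear-+ Φ p q = K.∑-++ p q

    linear-* : ∀ Φ (p q : Poly K v) →
               linear Φ (p P.* q) K.≈ linear (λ e → linear (λ e′ → Φ (e ⊕ e′)) q) p
    linear-* Φ p q = begin
      linear Φ (p P.* q)
        ≈⟨ K.∑-cartesianProductWith (mulTerm K) p q ⟩
      K.∑ p (λ (a , e) → K.∑ q λ (b , e′) → a K.* b K.* Φ (e ⊕ e′))
        ≈⟨ K.∑-cong p (λ (a , e) → K.∑-cong q λ (b , e′) → K.*-assoc a b _) ⟩
      K.∑ p (λ (a , e) → K.∑ q λ (b , e′) → a K.* (b K.* Φ (e ⊕ e′)))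
        ≈⟨ K.∑-cong p (λ (a , e) → K.*-distribˡ-∑ a q) ⟨
      linear (λ e → linear (λ e′ → Φ (e ⊕ e′)) q) p ∎

    linear-const : ∀ Φ a → linear Φ (const K a) K.≈ a K.* Φ (replicate v 0)
    linear-const Φ a = K.+-identityʳ _

    private
      +-cong : ∀ {p q r s : Poly K v} → p ≋ q → r ≋ s → p P.+ r ≋ q P.+ s
      +-cong {p} {q} {r} {s} p≈q r≈s = linear⇒≈ λ Φ → begin
        linear Φ (p P.+ r)           ≈⟨ linear-+ Φ p r ⟩
        linear Φ p K.+ linear Φ r    ≈⟨ K.+-cong (linear-resp-≈ Φ p≈q) (linear-resp-≈ Φ r≈s) ⟩
        linear Φ q K.+ linear Φ s    ≈⟨ linear-+ Φ q s ⟨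
        linear Φ (q P.+ s)           ∎

      +-comm : ∀ (p q : Poly K v) → p P.+ q ≋ q P.+ p
      +-comm p q = linear⇒≈ λ Φ → begin
        linear Φ (p P.+ q)         ≈⟨ linear-+ Φ p q ⟩
        linear Φ p K.+ linear Φ q  ≈⟨ K.+-comm _ _ ⟩
        linear Φ q K.+ linear Φ p  ≈⟨ linear-+ Φ q p ⟨
        linear Φ (q P.+ p)         ∎

      +-assoc : ∀ (p q r : Poly K v) → (p P.+ q) P.+ r ≋ p P.+ (q P.+ r)
      +-assoc p q r = linear⇒≈ λ Φ → begin
        linear Φ ((p P.+ q) P.+ r)                 ≈⟨ linear-+ Φ (p P.+ q) r ⟩
        linear Φ (p P.+ q) K.+ linear Φ r          ≈⟨ K.+-congʳ (linear-+ Φ p q) ⟩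
        (linear Φ p K.+ linear Φ q) K.+ linear Φ r ≈⟨ K.+-assoc _ _ _ ⟩
        linear Φ p K.+ (linear Φ q K.+ linear Φ r) ≈⟨ K.+-congˡ (linear-+ Φ q r) ⟨
        linear Φ p K.+ linear Φ (q P.+ r)          ≈⟨ linear-+ Φ p (q P.+ r) ⟨
        linear Φ (p P.+ (q P.+ r))                 ∎

      *-cong : ∀ {p q r s : Poly K v} → p ≋ q → r ≋ s → p P.* r ≋ q P.* s
      *-cong {p} {q} {r} {s} p≈q r≈s = linear⇒≈ λ Φ → begin
        linear Φ (p P.* r)                             ≈⟨ linear-* Φ p r ⟩
        linear (λ e → linear (λ e′ → Φ (e ⊕ e′)) r) p  ≈⟨ linear-cong p (λ e → linear-resp-≈ _ r≈s) ⟩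
        linear (λ e → linear (λ e′ → Φ (e ⊕ e′)) s) p  ≈⟨ linear-resp-≈ _ p≈q ⟩
        linear (λ e → linear (λ e′ → Φ (e ⊕ e′)) s) q  ≈⟨ linear-* Φ q s ⟨
        linear Φ (q P.* s)                             ∎

      *-comm : ∀ (p q : Poly K v) → p P.* q ≋ q P.* p
      *-comm p q = linear⇒≈ λ Φ → begin
        linear Φ (p P.* q)                              ≈⟨ linear-* Φ p q ⟩
        linear (λ e → linear (λ e′ → Φ (e ⊕ e′)) q) p   ≈⟨ linear-swap (λ e e′ → Φ (e ⊕ e′)) p q ⟩
        linear (λ e′ → linear (λ e → Φ (e ⊕ e′)) p) q   ≈⟨ linear-cong q (λ e′ → linear-cong p λ e → K.reflexive (≡.cong Φ (zipWith-comm ℕₚ.+-comm e e′))) ⟩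
        linear (λ e′ → linear (λ e → Φ (e′ ⊕ e)) p) q   ≈⟨ linear-* Φ q p ⟨
        linear Φ (q P.* p)                              ∎

      *-assoc : ∀ (p q r : Poly K v) → (p P.* q) P.* r ≋ p P.* (q P.* r)
      *-assoc p q r = linear⇒≈ λ Φ → begin
        linear Φ ((p P.* q) P.* r)
          ≈⟨ linear-* Φ (p P.* q) r ⟩
        linear (λ e → linear (λ e″ → Φ (e ⊕ e″)) r) (p P.* q)
          ≈⟨ linear-* _ p q ⟩
        linear (λ e → linear (λ e′ → linear (λ e″ → Φ (e ⊕ e′ ⊕ e″)) r) q) p
          ≈⟨ linear-cong p (λ e → linear-cong q λ e′ → linear-cong r λ e″ →
               K.reflexive (≡.cong Φ (zipWith-assoc ℕₚ.+-assoc e e′ e″))) ⟩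
        linear (λ e → linear (λ e′ → linear (λ e″ → Φ (e ⊕ (e′ ⊕ e″))) r) q) p
          ≈⟨ linear-cong p (λ e → linear-* (λ e′ → Φ (e ⊕ e′)) q r) ⟨
        linear (λ e → linear (λ e′ → Φ (e ⊕ e′)) (q P.* r)) p
          ≈⟨ linear-* Φ p (q P.* r) ⟨
        linear Φ (p P.* (q P.* r)) ∎

      *-identityˡ : ∀ (p : Poly K v) → P.1# P.* p ≋ p
      *-identityˡ p = linear⇒≈ λ Φ → begin
        linear Φ (P.1# P.* p)                               ≈⟨ linear-* Φ P.1# p ⟩
        linear (λ e → linear (λ e′ → Φ (e ⊕ e′)) p) P.1#    ≈⟨ linear-const (λ e → linear (λ e′ → Φ (e ⊕ e′)) p) K.1# ⟩
        K.1# K.* linear (λ e′ → Φ (replicate v 0 ⊕ e′)) p   ≈⟨ K.*-identityˡ _ ⟩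
        linear (λ e′ → Φ (replicate v 0 ⊕ e′)) p            ≈⟨ linear-cong p (λ e → K.reflexive (≡.cong Φ (zipWith-identityˡ ℕₚ.+-identityˡ e))) ⟩
        linear Φ p                                          ∎

      *-distribʳ-+ : ∀ (p q r : Poly K v) → (q P.+ r) P.* p ≋ q P.* p P.+ r P.* p
      *-distribʳ-+ p q r = linear⇒≈ λ Φ → begin
        linear Φ ((q P.+ r) P.* p)                      ≈⟨ linear-* Φ (q P.+ r) p ⟩
        linear (λ e → linear (λ e′ → Φ (e ⊕ e′)) p) (q P.+ r) ≈⟨ linear-+ _ q r ⟩
        _                                               ≈⟨ K.+-cong (linear-* Φ q p) (linear-* Φ r p) ⟨
        linear Φ (q P.* p) K.+ linear Φ (r P.* p)       ≈⟨ linear-+ Φ (q P.* p) (r P.* p) ⟨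
        linear Φ (q P.* p P.+ r P.* p)                  ∎

      ≋-refl : ∀ {p : Poly K v} → p ≋ p
      ≋-refl = coefficientwise λ m → K.refl

      ≋-sym : ∀ {p q : Poly K v} → p ≋ q → q ≋ p
      ≋-sym p≈q = coefficientwise λ m → K.sym (coeff-≈ p≈q m)

      ≋-trans : ∀ {p q r : Poly K v} → p ≋ q → q ≋ r → p ≋ r
      ≋-trans p≈q q≈r = coefficientwise λ m → K.trans (coeff-≈ p≈q m) (coeff-≈ q≈r m)

    polynomials : CommutativeSemiring c ℓ₁
    polynomials = record
      { Carrier = Poly K v
      ; _≈_ = _≋_
      ; _+_ = P._+_
      ; _*_ = P._*_
      ; 0#  = P.0#
      ; 1#  = P.1#
      ; isCommutativeSemiring = record
        { isSemiring = record
          { isSemiringWithoutAnnihilatingZero = record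
            { +-isCommutativeMonoid = record
              { isMonoid = record
                { isSemigroup = record
                  { isMagma = record
                    { isEquivalence = record { refl = ≋-refl ; sym = ≋-sym ; trans = ≋-trans }
                    ; ∙-cong = +-cong
                    }
                  ; assoc = +-assoc
                  }
                ; identity = (λ p → ≋-refl) , λ p → ≋-trans (+-comm p []) ≋-refl
                }
              ; comm = +-comm
              }
            ; *-cong = *-cong
            ; *-assoc = *-assoc
            ; *-identity = *-identityˡ , λ p → ≋-trans (*-comm p P.1#) (*-identityˡ p)
            ; distrib = (λ p q r → ≋-trans (*-comm p (q P.+ r))
                          (≋-trans (*-distribʳ-+ p q r) (+-cong (*-comm q p) (*-comm r p))))
                      , *-distribʳ-+
            }
          ; zero = (λ p → ≋-refl) , λ p → *-comm p []
          }
        ; *-comm = *-comm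
        }
      }

-- The pairs with `i + j + 1 = n`. Shifted by one, they are the ways to write the degree `n + 1` as
-- a sum of two positive degrees `i + 1` and `j + 1`.
splits : ℕ → List (ℕ × ℕ)
splits zero    = []
splits (suc n) = (0 , n) ∷ map (map₁ suc) (splits n)

sum-⊕ : ∀ {v} (e e′ : Vec ℕ v) → Vec.sum (zipWith ℕ._+_ e e′) ≡ Vec.sum e ℕ.+ Vec.sum e′
sum-⊕ []      []        = ≡.refl
sum-⊕ (x ∷ e) (y ∷ e′) rewrite sum-⊕ e e′ = interchange x y (Vec.sum e) (Vec.sum e′)
  where open import Algebra.Properties.CommutativeSemigroup ℕₚ.+-commutativeSemigroup using (interchange)

sum-replicate-0 : ∀ v → Vec.sum (replicate v 0) ≡ 0
sum-replicate-0 zero    = ≡.refl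
sum-replicate-0 (suc v) = sum-replicate-0 v

sum-unit : ∀ {v} (i : Fin v) → Vec.sum (replicate v 0 [ i ]≔ 1) ≡ 1
sum-unit {suc v} zero    = ≡.cong suc (sum-replicate-0 v)
sum-unit {suc v} (suc i) = sum-unit i

sum≡0⇒replicate : ∀ {v} (e : Vec ℕ v) → Vec.sum e ≡ 0 → e ≡ replicate v 0
sum≡0⇒replicate []         _   = ≡.refl
sum≡0⇒replicate (zero ∷ e) s≡0 = ≡.cong (0 ∷_) (sum≡0⇒replicate e s≡0)

-- Substitution and homogeneous parts

module Substitution {c ℓ₁ ℓ₂} (K : HeytingField c ℓ₁ ℓ₂) where

  open Polynomials K public
  private
    module K where
      open CommutativeRing coefficientRing public
      open BigOperators coefficients public
    module P {v : ℕ} where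
      open CommutativeSemiring (polynomials {v}) public
      open BigOperators (polynomials {v}) public
      open SemiringDefinitions (polyRawSemiring K v) public using (product; _^_)

  module _ {v : ℕ} where

    open import Relation.Binary.Reasoning.Setoid K.setoid

    linear-∑ : ∀ Φ {a} {A : Set a} (xs : List A) (f : A → Poly K v) →
               linear Φ (P.∑ xs f) K.≈ K.∑ xs (λ x → linear Φ (f x))
    linear-∑ Φ []       f = K.refl
    linear-∑ Φ (x ∷ xs) f = K.trans (linear-+ Φ (f x) _) (K.+-congˡ (linear-∑ Φ xs f))

    linear-const-* : ∀ Φ a (p : Poly K v) → linear Φ (const K a P.* p) K.≈ a K.* linear Φ p
    linear-const-* Φ a p = begin
      linear Φ (const K a P.* p)
        ≈⟨ linear-* Φ (const K a) p ⟩
      linear (λ e → linear (λ e′ → Φ (e ⊕ e′)) p) (const K a)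
        ≈⟨ linear-const (λ e → linear (λ e′ → Φ (e ⊕ e′)) p) a ⟩
      a K.* linear (λ e′ → Φ (replicate v 0 ⊕ e′)) p
        ≈⟨ K.*-congˡ (linear-cong p λ e → K.reflexive (≡.cong Φ (zipWith-identityˡ ℕₚ.+-identityˡ e))) ⟩
      a K.* linear Φ p ∎

    const-cong : ∀ {a b} → a K.≈ b → const K {v} a P.≈ const K b
    const-cong a≈b = linear⇒≈ λ Φ → K.+-congʳ (K.*-congʳ a≈b)

    const-+ : ∀ a b → const K {v} (a K.+ b) P.≈ const K a P.+ const K b
    const-+ a b = linear⇒≈ λ Φ → begin
      linear Φ (const K (a K.+ b))                  ≈⟨ linear-const Φ _ ⟩
      (a K.+ b) K.* Φ _                             ≈⟨ K.distribʳ _ a b ⟩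
      a K.* Φ _ K.+ b K.* Φ _                       ≈⟨ K.+-cong (linear-const Φ a) (linear-const Φ b) ⟨
      linear Φ (const K a) K.+ linear Φ (const K b) ≈⟨ linear-+ Φ (const K a) (const K b) ⟨
      linear Φ (const K a P.+ const K b)            ∎

    const-0 : const K {v} K.0# P.≈ P.0#
    const-0 = linear⇒≈ λ Φ → K.trans (linear-const Φ _) (K.zeroˡ _)

    1+const-1≈0 : P.1# P.+ const K {v} (K.- K.1#) P.≈ P.0#
    1+const-1≈0 = P.trans (P.sym (const-+ K.1# (K.- K.1#))) (P.trans (const-cong (K.-‿inverseʳ K.1#)) const-0)

  module _ {u v : ℕ} (a : Fin u → Poly K v) where

    open import Relation.Binary.Reasoning.Setoid K.setoid

    substituteMonomial : Monomial K u → Poly K v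
    substituteMonomial e = P.product (λ i → a i P.^ lookup e i)

    -- A functional of the result is a functional of the original polynomial. Hence substitution,
    -- although defined on lists of terms, respects `≋`.
    linear-substitute : ∀ Φ p → linear Φ (substitute K p a) K.≈ linear (λ e → linear Φ (substituteMonomial e)) p
    linear-substitute Φ p = K.trans (linear-∑ Φ p _)
      (K.∑-cong p λ (b , e) → linear-const-* Φ b (substituteMonomial e))

    substitute-cong : ∀ {p q} → p P.≈ q → substitute K p a P.≈ substitute K q a
    substitute-cong {p} {q} p≈q = linear⇒≈ λ Φ → begin
      linear Φ (substitute K p a)                       ≈⟨ linear-substitute Φ p ⟩
      linear (λ e → linear Φ (substituteMonomial e)) p  ≈⟨ linear-resp-≈ _ p≈q ⟩
      linear (λ e → linear Φ (substituteMonomial e)) q  ≈⟨ linear-substitute Φ q ⟨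
      linear Φ (substitute K q a)                       ∎

    substitute-+ : ∀ p q → substitute K (p P.+ q) a P.≈ substitute K p a P.+ substitute K q a
    substitute-+ p q = P.∑-++ p q

  private
    ^-+ : ∀ {v} (x : Poly K v) m n → x P.^ (m ℕ.+ n) P.≈ x P.^ m P.* x P.^ n
    ^-+ x zero    n = P.sym (P.*-identityˡ _)
    ^-+ x (suc m) n = P.trans (P.*-congˡ {x = x} (^-+ x m n)) (P.sym (P.*-assoc x _ _))

    substituteMonomial-⊕ : ∀ {u v} (a : Fin u → Poly K v) e e′ →
      substituteMonomial a (e ⊕ e′) P.≈ substituteMonomial a e P.* substituteMonomial a e′
    substituteMonomial-⊕ a [] [] = P.sym (P.*-identityˡ _)
    substituteMonomial-⊕ a (x ∷ e) (y ∷ e′) = P.trans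
      (P.*-cong (^-+ (a zero) x y) (substituteMonomial-⊕ (a ∘ suc) e e′)) (interchange (a zero P.^ x) _ _ _)
      where open import Algebra.Properties.CommutativeSemigroup P.*-commutativeSemigroup using (interchange)

    substituteMonomial-0 : ∀ {u v} (a : Fin u → Poly K v) → substituteMonomial a (replicate u 0) P.≈ P.1#
    substituteMonomial-0 {zero}  a = P.refl
    substituteMonomial-0 {suc u} a = P.trans (P.*-identityˡ _) (substituteMonomial-0 (a ∘ suc))

    substituteMonomial-unit : ∀ {u v} (a : Fin u → Poly K v) i →
      substituteMonomial a (replicate u 0 [ i ]≔ 1) P.≈ a i
    substituteMonomial-unit {suc u} a zero = P.trans
      (P.*-cong (P.*-identityʳ (a zero)) (substituteMonomial-0 (a ∘ suc))) (P.*-identityʳ (a zero))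
    substituteMonomial-unit {suc u} a (suc i) =
      P.trans (P.*-identityˡ _) (substituteMonomial-unit (a ∘ suc) i)

  module _ {u v : ℕ} (a : Fin u → Poly K v) where

    private
      sub : Poly K u → Poly K v
      sub p = substitute K p a

    -- On monomials this is the exponent law `substituteMonomial-⊕`. In general both sides are
    -- iterated sums over the terms of `p`, of `q` and of the two substituted monomials, and differ
    -- only in the order of summation.
    substitute-* : ∀ p q → sub (p P.* q) P.≈ sub p P.* sub q
    substitute-* p q = linear⇒≈ λ Φ → begin
      linear Φ (sub (p P.* q))
        ≈⟨ linear-substitute a Φ (p P.* q) ⟩
      linear (λ e → linear Φ (mono e)) (p P.* q)
        ≈⟨ linear-* _ p q ⟩
      linear (λ e → linear (λ e′ → linear Φ (mono (e ⊕ e′))) q) p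
        ≈⟨ linear-cong p (λ e → linear-cong q λ e′ → K.trans
             (linear-resp-≈ Φ (substituteMonomial-⊕ a e e′)) (linear-* Φ (mono e) (mono e′))) ⟩
      linear (λ e → linear (λ e′ → linear (λ m → linear (λ m′ → Φ (m ⊕ m′)) (mono e′)) (mono e)) q) p
        ≈⟨ linear-cong p (λ e → linear-swap (λ m e′ → linear (λ m′ → Φ (m ⊕ m′)) (mono e′)) (mono e) q) ⟨
      linear (λ e → linear (λ m → linear (λ e′ → linear (λ m′ → Φ (m ⊕ m′)) (mono e′)) q) (mono e)) p
        ≈⟨ linear-cong p (λ e → linear-cong (mono e) λ m → linear-substitute a (λ m′ → Φ (m ⊕ m′)) q) ⟨
      linear (λ e → linear (λ m → linear (λ m′ → Φ (m ⊕ m′)) (sub q)) (mono e)) p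
        ≈⟨ linear-substitute a _ p ⟨
      linear (λ m → linear (λ m′ → Φ (m ⊕ m′)) (sub q)) (sub p)
        ≈⟨ linear-* Φ (sub p) (sub q) ⟨
      linear Φ (sub p P.* sub q) ∎
      where
      open import Relation.Binary.Reasoning.Setoid K.setoid
      mono = substituteMonomial a

    substitute-const : ∀ b → sub (const K b) P.≈ const K b
    substitute-const b = P.trans (P.+-identityʳ (const K b P.* _))
      (P.trans (P.*-congˡ {x = const K b} (substituteMonomial-0 a)) (P.*-identityʳ (const K b)))

    substitute-var : ∀ i → sub (var K i) P.≈ a i
    substitute-var i = P.trans (P.+-identityʳ (P.1# P.* _))
      (P.trans (P.*-identityˡ _) (substituteMonomial-unit a i))

    substitute-∑ : ∀ {a} {A : Set a} (xs : List A) (f : A → Poly K u) →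
                   sub (P.∑ xs f) P.≈ P.∑ xs (λ x → sub (f x))
    substitute-∑ []       f = P.refl
    substitute-∑ (x ∷ xs) f = P.trans (substitute-+ a (f x) _) (P.+-congˡ {x = sub (f x)} (substitute-∑ xs f))

    substitute-∏ : ∀ {a} {A : Set a} (xs : List A) (f : A → Poly K u) →
                   sub (P.∏ xs f) P.≈ P.∏ xs (λ x → sub (f x))
    substitute-∏ []       f = substitute-const K.1#
    substitute-∏ (x ∷ xs) f = P.trans (substitute-* (f x) _) (P.*-congˡ {x = sub (f x)} (substitute-∏ xs f))

  module _ {v : ℕ} where

    open import Relation.Binary.Reasoning.Setoid K.setoid

    -- The filter acts on the list of terms, cancelling ones included; `coeff-part` shows that up to
    -- `≈ᴾ` the result is the homogeneous component.
    part : ℕ → Poly K v → Poly K v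
    part l = filter λ (_ , e) → Vec.sum e ℕₚ.≟ l

    private
      [_]_ : Bool → K.Carrier → K.Carrier
      [ b ] x = if b then x else K.0#

      *-[] : ∀ b {a x} → [ b ] (a K.* x) K.≈ a K.* [ b ] x
      *-[] true  = K.refl
      *-[] false = K.sym (K.zeroʳ _)

      []-∧ : ∀ b d {x} → [ b ] [ d ] x ≡ [ b ∧ d ] x
      []-∧ true  d = ≡.refl
      []-∧ false d = ≡.refl

    linear-part : ∀ Φ l p → linear Φ (part l p) K.≈ linear (λ e → [ Vec.sum e ≡ᵇ l ] Φ e) p
    linear-part Φ l p = K.trans (K.∑-filter (λ (_ , e) → Vec.sum e ℕₚ.≟ l) p)
      (K.∑-cong p λ (a , e) → *-[] (Vec.sum e ≡ᵇ l))

    linear-[] : ∀ b Φ (p : Poly K v) → [ b ] linear Φ p K.≈ linear (λ e → [ b ] Φ e) p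
    linear-[] true  Φ p = K.refl
    linear-[] false Φ p = K.sym (K.trans (K.∑-cong p λ (a , _) → K.zeroʳ a) (K.∑-zero p))

    linear-part-* : ∀ Φ i j p q → linear Φ (part i p P.* part j q) K.≈
      linear (λ e → linear (λ e′ → [ (Vec.sum e ≡ᵇ i) ∧ (Vec.sum e′ ≡ᵇ j) ] Φ (e ⊕ e′)) q) p
    linear-part-* Φ i j p q = begin
      linear Φ (part i p P.* part j q)
        ≈⟨ linear-* Φ (part i p) (part j q) ⟩
      linear (λ e → linear (λ e′ → Φ (e ⊕ e′)) (part j q)) (part i p)
        ≈⟨ linear-part _ i p ⟩
      linear (λ e → [ Vec.sum e ≡ᵇ i ] linear (λ e′ → Φ (e ⊕ e′)) (part j q)) p
        ≈⟨ linear-cong p (λ e → K.trans (K.if-cong (Vec.sum e ≡ᵇ i) (linear-part _ j q) K.refl)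
             (K.trans (linear-[] (Vec.sum e ≡ᵇ i) _ q)
               (linear-cong q λ e′ → K.reflexive ([]-∧ (Vec.sum e ≡ᵇ i) (Vec.sum e′ ≡ᵇ j))))) ⟩
      linear (λ e → linear (λ e′ → [ (Vec.sum e ≡ᵇ i) ∧ (Vec.sum e′ ≡ᵇ j) ] Φ (e ⊕ e′)) q) p ∎

    linear-distrib-+ : ∀ Φ Ψ (p : Poly K v) → linear (λ e → Φ e K.+ Ψ e) p K.≈ linear Φ p K.+ linear Ψ p
    linear-distrib-+ Φ Ψ p = K.trans (K.∑-cong p λ (a , e) → K.distribˡ a _ _) (K.∑-distrib-+ p)

    linear-∑-functional : ∀ {a} {A : Set a} (xs : List A) (Φ : A → Monomial K v → K.Carrier) p →
      linear (λ e → K.∑ xs (λ x → Φ x e)) p K.≈ K.∑ xs (λ x → linear (Φ x) p)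
    linear-∑-functional xs Φ p = K.trans (K.∑-cong p λ (a , e) → K.*-distribˡ-∑ a xs) (K.∑-swap p xs)

    private
      splits-indicator : ∀ n s t x → [ s ℕ.+ suc t ≡ᵇ n ] x K.≈
        K.∑ (splits n) (λ (i , j) → [ (s ≡ᵇ i) ∧ (t ≡ᵇ j) ] x)
      splits-indicator zero s t x rewrite ℕₚ.+-suc s t = K.refl
      splits-indicator (suc n) zero t x = K.sym (K.trans
        (K.+-congˡ (K.trans (K.∑-map (map₁ suc) (splits n)) (K.∑-zero (splits n)))) (K.+-identityʳ _))
      splits-indicator (suc n) (suc s) t x = K.sym (K.trans
        (K.+-identityˡ _) (K.trans (K.∑-map (map₁ suc) (splits n)) (K.sym (splits-indicator n s t x))))

      -- If `s + t` is positive, then exactly one of three cases holds: `s` is 0, or `t` is 0, or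
      -- both are positive and exactly one split matches them.
      convolution : ∀ n s t x → [ s ℕ.+ t ≡ᵇ suc n ] x K.≈
        [ (s ≡ᵇ 0) ∧ (t ≡ᵇ suc n) ] x K.+ ([ (s ≡ᵇ suc n) ∧ (t ≡ᵇ 0) ] x K.+
        K.∑ (splits n) (λ (i , j) → [ (s ≡ᵇ suc i) ∧ (t ≡ᵇ suc j) ] x))
      convolution n zero t x = K.sym (K.trans
        (K.+-congˡ (K.trans (K.+-identityˡ _) (K.∑-zero (splits n)))) (K.+-identityʳ _))
      convolution n (suc s) zero x rewrite ℕₚ.+-identityʳ s with s ≡ᵇ n
      ... | true  = K.sym (K.trans (K.+-identityˡ _) (K.trans (K.+-congˡ vanish) (K.+-identityʳ _)))
        where vanish = K.∑-vanishing (splits n) λ {(i , j)} _ → K.reflexive (≡.cong ([_] x) (∧-zeroʳ (s ≡ᵇ i)))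
      ... | false = K.sym (K.trans (K.+-identityˡ _) (K.trans (K.+-congˡ vanish) (K.+-identityʳ _)))
        where vanish = K.∑-vanishing (splits n) λ {(i , j)} _ → K.reflexive (≡.cong ([_] x) (∧-zeroʳ (s ≡ᵇ i)))
      convolution n (suc s) (suc t) x = K.sym (K.trans (K.+-identityˡ _)
        (K.trans (K.+-cong (K.reflexive (≡.cong ([_] x) (∧-zeroʳ (s ≡ᵇ n)))) (K.sym (splits-indicator n s t x))) (K.+-identityˡ _)))

    part-+ : ∀ l (p q : Poly K v) → part l (p P.+ q) ≡ part l p P.+ part l q
    part-+ l = filter-++ _

    -- The usual convolution, with the two terms having a factor of degree 0 kept apart: these
    -- become weights, whereas the positive degrees become subintervals.
    part-* : ∀ n (p q : Poly K v) → part (suc n) (p P.* q) P.≈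
      part 0 p P.* part (suc n) q P.+ (part (suc n) p P.* part 0 q P.+
      P.∑ (splits n) (λ (i , j) → part (suc i) p P.* part (suc j) q))
    part-* n p q = linear⇒≈ λ Φ → begin
      linear Φ (part (suc n) (p P.* q))
        ≈⟨ linear-part Φ (suc n) (p P.* q) ⟩
      linear (λ e → [ Vec.sum e ≡ᵇ suc n ] Φ e) (p P.* q)
        ≈⟨ linear-* _ p q ⟩
      linear (λ e → linear (λ e′ → [ Vec.sum (e ⊕ e′) ≡ᵇ suc n ] Φ (e ⊕ e′)) q) p
        ≈⟨ linear-cong p (λ e → linear-cong q λ e′ → K.trans
             (K.reflexive (≡.cong (λ s → [ s ≡ᵇ suc n ] Φ (e ⊕ e′)) (sum-⊕ e e′)))
             (convolution n (Vec.sum e) (Vec.sum e′) (Φ (e ⊕ e′)))) ⟩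
      linear (λ e → linear (λ e′ → C Φ 0 (suc n) e e′ K.+ (C Φ (suc n) 0 e e′ K.+
        K.∑ (splits n) (λ (i , j) → C Φ (suc i) (suc j) e e′))) q) p
        ≈⟨ linear-cong p (λ e → K.trans (linear-distrib-+ _ _ q) (K.+-congˡ (K.trans (linear-distrib-+ _ _ q)
             (K.+-congˡ (linear-∑-functional (splits n) _ q))))) ⟩
      linear (λ e → linear (C Φ 0 (suc n) e) q K.+ (linear (C Φ (suc n) 0 e) q K.+
        K.∑ (splits n) (λ (i , j) → linear (C Φ (suc i) (suc j) e) q))) p
        ≈⟨ K.trans (linear-distrib-+ _ _ p) (K.+-congˡ (K.trans (linear-distrib-+ _ _ p)
             (K.+-congˡ (linear-∑-functional (splits n) _ p)))) ⟩
      linear (λ e → linear (C Φ 0 (suc n) e) q) p K.+ (linear (λ e → linear (C Φ (suc n) 0 e) q) p K.+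
        K.∑ (splits n) (λ (i , j) → linear (λ e → linear (C Φ (suc i) (suc j) e) q) p))
        ≈⟨ K.+-cong (linear-part-* Φ 0 (suc n) p q) (K.+-cong (linear-part-* Φ (suc n) 0 p q)
             (K.∑-cong (splits n) λ (i , j) → linear-part-* Φ (suc i) (suc j) p q)) ⟨
      linear Φ (part 0 p P.* part (suc n) q) K.+ (linear Φ (part (suc n) p P.* part 0 q) K.+
        K.∑ (splits n) (λ (i , j) → linear Φ (part (suc i) p P.* part (suc j) q)))
        ≈⟨ K.+-congˡ (K.trans (linear-+ Φ (part (suc n) p P.* part 0 q) _)
             (K.+-congˡ (linear-∑ Φ (splits n) (λ (i , j) → part (suc i) p P.* part (suc j) q)))) ⟨
      linear Φ (part 0 p P.* part (suc n) q) K.+ linear Φ (part (suc n) p P.* part 0 q P.+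
        P.∑ (splits n) (λ (i , j) → part (suc i) p P.* part (suc j) q))
        ≈⟨ linear-+ Φ (part 0 p P.* part (suc n) q) _ ⟨
      linear Φ (part 0 p P.* part (suc n) q P.+ (part (suc n) p P.* part 0 q P.+
        P.∑ (splits n) (λ (i , j) → part (suc i) p P.* part (suc j) q))) ∎
      where
      C : (Monomial K v → K.Carrier) → ℕ → ℕ → Monomial K v → Monomial K v → K.Carrier
      C Φ i j e e′ = [ (Vec.sum e ≡ᵇ i) ∧ (Vec.sum e′ ≡ᵇ j) ] Φ (e ⊕ e′)

    coeff-part : ∀ l p m → coeff K (part l p) m K.≈ [ Vec.sum m ≡ᵇ l ] coeff K p m
    coeff-part l p m = begin
      coeff K (part l p) m                                     ≈⟨ coeff≈linear (part l p) m ⟩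
      linear (indicator m) (part l p)                          ≈⟨ linear-part (indicator m) l p ⟩
      linear (λ e → [ Vec.sum e ≡ᵇ l ] indicator m e) p        ≈⟨ linear-cong p only-m ⟩
      linear (λ e → [ Vec.sum m ≡ᵇ l ] indicator m e) p        ≈⟨ linear-[] (Vec.sum m ≡ᵇ l) (indicator m) p ⟨
      [ Vec.sum m ≡ᵇ l ] linear (indicator m) p                ≈⟨ K.if-cong (Vec.sum m ≡ᵇ l) (coeff≈linear p m) K.refl ⟨
      [ Vec.sum m ≡ᵇ l ] coeff K p m                           ∎
      where
      only-m : ∀ e → [ Vec.sum e ≡ᵇ l ] indicator m e K.≈ [ Vec.sum m ≡ᵇ l ] indicator m e
      only-m e with ≡-dec ℕₚ._≟_ e m
      ... | yes ≡.refl = K.refl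
      ... | no  _ with Vec.sum e ≡ᵇ l | Vec.sum m ≡ᵇ l
      ...   | true  | true  = K.refl
      ...   | true  | false = K.refl
      ...   | false | true  = K.refl
      ...   | false | false = K.refl

    -- The zero vector is the only exponent vector of sum 0. So a factor of degree 0 is a field
    -- constant and may serve as a weight.
    part-0 : ∀ p → part 0 p P.≈ const K (coeff K p (replicate v 0))
    part-0 p = coefficientwise λ m → K.trans (coeff-part 0 p m) (K.sym (K.trans (K.+-identityʳ _) (go m)))
      where
      go : ∀ m → (if does (≡-dec ℕₚ._≟_ (replicate v 0) m) then coeff K p (replicate v 0) else K.0#)
                 K.≈ [ Vec.sum m ≡ᵇ 0 ] coeff K p m
      go m with ≡-dec ℕₚ._≟_ (replicate v 0) m
      ... | yes ≡.refl rewrite sum-replicate-0 v = K.refl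
      ... | no  0≢m with Vec.sum m in s≡
      ...   | zero  = contradiction (≡.sym (sum≡0⇒replicate m s≡)) 0≢m
      ...   | suc _ = K.refl

    part-suc-const : ∀ n a → part (suc n) (const K {v} a) ≡ []
    part-suc-const n a rewrite sum-replicate-0 v = ≡.refl

    part-1-var : ∀ (i : Fin v) → part 1 (var K i) ≡ var K i
    part-1-var i rewrite sum-unit i = ≡.refl

    part-2+-var : ∀ n (i : Fin v) → part (suc (suc n)) (var K i) ≡ []
    part-2+-var n i rewrite sum-unit i = ≡.refl

    -- The list may contain terms of degree above `d` that cancel, so the comparison is made
    -- coefficientwise: exactly one part contributes to a monomial of degree at most `d`, and none
    -- to the others.
    ∑-parts : ∀ d p → DegreeAtMost K p d → p P.≈ part 0 p P.+ P.∑ (upTo d) (λ n → part (suc n) p)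
    ∑-parts d p deg≤d = P.trans (coefficientwise λ m → K.sym (coeff-parts m))
      (P.+-congˡ {x = part 0 p} (P.trans (P.reflexive (≡.cong (λ ls → P.∑ ls (λ l → part l p)) (≡.sym (map-upTo suc d))))
        (P.∑-map suc (upTo d))))
      where
      parts : Poly K v
      parts = P.∑ (upTo (suc d)) (λ l → part l p)

      coeff-∑ : ∀ ls m → coeff K (P.∑ ls (λ l → part l p)) m K.≈ K.∑ ls (λ l → [ Vec.sum m ≡ᵇ l ] coeff K p m)
      coeff-∑ ls m = K.trans (coeff≈linear (P.∑ ls (λ l → part l p)) m) (K.trans (linear-∑ (indicator m) ls (λ l → part l p))
        (K.∑-cong ls λ l → K.trans (K.sym (coeff≈linear (part l p) m)) (coeff-part l p m)))

      on : ∀ m → [ Vec.sum m ≡ᵇ Vec.sum m ] coeff K p m K.≈ coeff K p m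
      on m rewrite dec-true (Vec.sum m ℕₚ.≟ Vec.sum m) ≡.refl = K.refl

      off : ∀ m {l} → l ≢ Vec.sum m → [ Vec.sum m ≡ᵇ l ] coeff K p m K.≈ K.0#
      off m {l} l≢ rewrite dec-false (Vec.sum m ℕₚ.≟ l) (λ eq → l≢ (≡.sym eq)) = K.refl

      coeff-parts : ∀ m → coeff K parts m K.≈ coeff K p m
      coeff-parts m with Vec.sum m ℕₚ.<? suc d
      ... | yes s≤d = K.trans (coeff-∑ (upTo (suc d)) m)
              (K.trans (K.∑-single (Unique.upTo⁺ (suc d)) (∈-upTo⁺ s≤d) (off m)) (on m))
      ... | no  s≰d = K.trans (coeff-∑ (upTo (suc d)) m) (K.trans
              (K.∑-vanishing (upTo (suc d)) λ l∈ → off m λ { ≡.refl → s≰d (∈-upTo⁻ l∈) })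
              (K.sym (deg≤d m (ℕₚ.≮⇒≥ s≰d))))

any-map : ∀ {a b} {A : Set a} {B : Set b} (f : B → Bool) (h : A → B) xs → any f (map h xs) ≡ any (f ∘ h) xs
any-map f h []       = ≡.refl
any-map f h (x ∷ xs) = ≡.cong (f (h x) ∨_) (any-map f h xs)

any-++ : ∀ {a} {A : Set a} (f : A → Bool) xs ys → any f (xs ++ ys) ≡ any f xs ∨ any f ys
any-++ f []       ys = ≡.refl
any-++ f (x ∷ xs) ys with f x
... | true  = ≡.refl
... | false = any-++ f xs ys

all-map : ∀ {a b} {A : Set a} {B : Set b} (f : B → Bool) (h : A → B) xs → all f (map h xs) ≡ all (f ∘ h) xs
all-map f h []       = ≡.refl
all-map f h (x ∷ xs) = ≡.cong (f (h x) ∧_) (all-map f h xs)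

all-cong : ∀ {a} {A : Set a} {f g : A → Bool} → (∀ x → f x ≡ g x) → ∀ xs → all f xs ≡ all g xs
all-cong f≗g []       = ≡.refl
all-cong f≗g (x ∷ xs) = ≡.cong₂ _∧_ (f≗g x) (all-cong f≗g xs)

-- Weighted sums over independent sets, written as programs

module Programs {c ℓ} (R : CommutativeSemiring c ℓ) where

  open CommutativeSemiring R hiding (zero)
  open BigOperators R
  open import Relation.Binary.Reasoning.Setoid setoid

  module Weighted {w} (W : Set w) (⟪_⟫ : W → Carrier)
    (one : W) (one≈1 : ⟪ one ⟫ ≈ 1#) (minusOne : W) (1+minusOne≈0 : 1# + ⟪ minusOne ⟫ ≈ 0#)
    where

    -- A program denotes the sum, over all truth values of its bound variables
    -- that satisfy every conflict ¬ (i ∧ j), of the product of the weights of the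
    -- true variables.
    data Program (m : ℕ) : Set w where
      done     : Program m
      bind     : W → Program (suc m) → Program m
      conflict : Fin m → Fin m → Program m → Program m

    ⟦_⟧ : ∀ {m} → Program m → Vec Bool m → Carrier
    ⟦ done           ⟧ ρ = 1#
    ⟦ bind a E       ⟧ ρ = ⟦ E ⟧ (false ∷ ρ) + ⟪ a ⟫ * ⟦ E ⟧ (true ∷ ρ)
    ⟦ conflict i j E ⟧ ρ = if lookup ρ i ∧ lookup ρ j then 0# else ⟦ E ⟧ ρ

    size : ∀ {m} → Program m → ℕ
    size done             = 0
    size (bind _ E)       = suc (size E)
    size (conflict _ _ E) = size E

    conflicts : ∀ {m} → Fin m → List (Fin m) → Program m → Program m
    conflicts z xs E = foldr (conflict z) E xs

    ⟦conflicts⟧ : ∀ {m} z xs (E : Program m) ρ →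
      ⟦ conflicts z xs E ⟧ ρ ≡ (if lookup ρ z ∧ any (lookup ρ) xs then 0# else ⟦ E ⟧ ρ)
    ⟦conflicts⟧ z [] E ρ with lookup ρ z
    ... | true  = ≡.refl
    ... | false = ≡.refl
    ⟦conflicts⟧ z (x ∷ xs) E ρ rewrite ⟦conflicts⟧ z xs E ρ with lookup ρ z | lookup ρ x
    ... | true  | true  = ≡.refl
    ... | true  | false = ≡.refl
    ... | false | _     = ≡.refl

    size-conflicts : ∀ {m} z xs (E : Program m) → size (conflicts z xs E) ≡ size E
    size-conflicts z []       E = ≡.refl
    size-conflicts z (x ∷ xs) E = size-conflicts z xs E

    atLeastOne : ∀ {m} → List (Fin m) → Program (suc m) → Program m
    atLeastOne xs E = bind minusOne (conflicts zero (map suc xs) E)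

    -- The bound variable has weight −1 and conflicts with xs, so that the sum is
    -- 1 − [no variable of xs is true].
    ⟦atLeastOne⟧ : ∀ {m} xs (E : Program (suc m)) ρ {x} → (∀ b → ⟦ E ⟧ (b ∷ ρ) ≈ x) →
      ⟦ atLeastOne xs E ⟧ ρ ≈ (if any (lookup ρ) xs then x else 0#)
    ⟦atLeastOne⟧ xs E ρ {x} E≈x
      rewrite ⟦conflicts⟧ zero (map suc xs) E (false ∷ ρ)
            | ⟦conflicts⟧ zero (map suc xs) E (true ∷ ρ)
            | any-map (lookup (true ∷ ρ)) suc xs with any (lookup ρ) xs
    ... | true  = trans (+-cong (E≈x false) (zeroʳ _)) (+-identityʳ _)
    ... | false = begin
      ⟦ E ⟧ (false ∷ ρ) + ⟪ minusOne ⟫ * ⟦ E ⟧ (true ∷ ρ) ≈⟨ +-cong (E≈x false) (*-congˡ (E≈x true)) ⟩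
      x + ⟪ minusOne ⟫ * x                                ≈⟨ +-congʳ (*-identityˡ x) ⟨
      1# * x + ⟪ minusOne ⟫ * x                           ≈⟨ distribʳ x _ _ ⟨
      (1# + ⟪ minusOne ⟫) * x                             ≈⟨ *-congʳ 1+minusOne≈0 ⟩
      0# * x                                              ≈⟨ zeroˡ x ⟩
      0#                                                  ∎

    -- Variable 1 of the body is the negated disjunction of xs; variable 0 is auxiliary.
    nor : ∀ {m} → List (Fin m) → Program (suc (suc m)) → Program m
    nor xs E = bind one (conflicts zero (map suc xs) (atLeastOne (zero ∷ map suc xs) E))

    -- The conflicts forbid the new variable to be true beside a true member of `xs`, and the clause
    -- forbids all of them to be false, so exactly one value survives. The body must not depend on
    -- the auxiliary variable, whose two values are meant to cancel when the clause fails.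
    ⟦nor⟧ : ∀ {m} xs (E : Program (suc (suc m))) ρ (f : Bool → Carrier) →
      (∀ b b′ → ⟦ E ⟧ (b ∷ b′ ∷ ρ) ≈ f b′) → ⟦ nor xs E ⟧ ρ ≈ f (not (any (lookup ρ) xs))
    ⟦nor⟧ xs E ρ f E≈f
      rewrite ⟦conflicts⟧ zero (map suc xs) (atLeastOne (zero ∷ map suc xs) E) (false ∷ ρ)
            | ⟦conflicts⟧ zero (map suc xs) (atLeastOne (zero ∷ map suc xs) E) (true ∷ ρ)
            | any-map (lookup (true ∷ ρ)) suc xs with any (lookup ρ) xs in eq
    ... | true  = trans (+-cong (when-false true eq) (zeroʳ _)) (+-identityʳ _)
      where
      when-false : ∀ b → any (lookup ρ) xs ≡ b →
        ⟦ atLeastOne (zero ∷ map suc xs) E ⟧ (false ∷ ρ) ≈ (if b then f false else 0#)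
      when-false b eq = trans (⟦atLeastOne⟧ (zero ∷ map suc xs) E (false ∷ ρ) (λ b → E≈f b false))
        (reflexive (≡.cong (λ b → if b then f false else 0#) (≡.trans (any-map (lookup (false ∷ ρ)) suc xs) eq)))
    ... | false = begin
      ⟦ atLeastOne (zero ∷ map suc xs) E ⟧ (false ∷ ρ) + ⟪ one ⟫ * ⟦ atLeastOne (zero ∷ map suc xs) E ⟧ (true ∷ ρ)
        ≈⟨ +-cong when-false (*-congˡ (⟦atLeastOne⟧ (zero ∷ map suc xs) E (true ∷ ρ) (λ b → E≈f b true))) ⟩
      0# + ⟪ one ⟫ * f true  ≈⟨ +-identityˡ _ ⟩
      ⟪ one ⟫ * f true       ≈⟨ *-congʳ one≈1 ⟩
      1# * f true            ≈⟨ *-identityˡ _ ⟩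
      f true                 ∎
      where
      when-false : ⟦ atLeastOne (zero ∷ map suc xs) E ⟧ (false ∷ ρ) ≈ 0#
      when-false = trans (⟦atLeastOne⟧ (zero ∷ map suc xs) E (false ∷ ρ) (λ b → E≈f b false))
        (reflexive (≡.cong (λ b → if b then f false else 0#) (≡.trans (any-map (lookup (false ∷ ρ)) suc xs) eq)))

    size-atLeastOne : ∀ {m} xs (E : Program (suc m)) → size (atLeastOne xs E) ≡ suc (size E)
    size-atLeastOne xs E = ≡.cong suc (size-conflicts zero (map suc xs) E)

    size-nor : ∀ {m} xs (E : Program (suc (suc m))) → size (nor xs E) ≡ 2 ℕ.+ size E
    size-nor xs E = ≡.cong suc (≡.trans
      (size-conflicts zero (map suc xs) (atLeastOne (zero ∷ map suc xs) E)) (size-atLeastOne (zero ∷ map suc xs) E))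

    bindMany : ∀ n {m} → Program (n ℕ.+ m) → Program m
    bindMany zero    E = E
    bindMany (suc n) E = bindMany n (bind one E)

    ⟦bindMany⟧ : ∀ n {m} (E : Program (n ℕ.+ m)) ρ →
      ⟦ bindMany n E ⟧ ρ ≈ ∑ (allBoolVecs n) (λ δ → ⟦ E ⟧ (δ Vec.++ ρ))
    ⟦bindMany⟧ zero    E ρ = sym (+-identityʳ _)
    ⟦bindMany⟧ (suc n) E ρ = begin
      ⟦ bindMany n (bind one E) ⟧ ρ
        ≈⟨ ⟦bindMany⟧ n (bind one E) ρ ⟩
      ∑ δs (λ δ → ⟦ E ⟧ (false ∷ δ Vec.++ ρ) + ⟪ one ⟫ * ⟦ E ⟧ (true ∷ δ Vec.++ ρ))
        ≈⟨ ∑-cong δs (λ δ → +-congˡ (trans (*-congʳ one≈1) (*-identityˡ _))) ⟩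
      ∑ δs (λ δ → ⟦ E ⟧ (false ∷ δ Vec.++ ρ) + ⟦ E ⟧ (true ∷ δ Vec.++ ρ))
        ≈⟨ ∑-distrib-+ δs ⟩
      ∑ δs (λ δ → ⟦ E ⟧ (false ∷ δ Vec.++ ρ)) + ∑ δs (λ δ → ⟦ E ⟧ (true ∷ δ Vec.++ ρ))
        ≈⟨ +-cong (∑-map (false ∷_) δs) (∑-map (true ∷_) δs) ⟨
      ∑ (map (false ∷_) δs) (λ δ → ⟦ E ⟧ (δ Vec.++ ρ)) + ∑ (map (true ∷_) δs) (λ δ → ⟦ E ⟧ (δ Vec.++ ρ))
        ≈⟨ ∑-++ (map (false ∷_) δs) (map (true ∷_) δs) ⟨
      ∑ (allBoolVecs (suc n)) (λ δ → ⟦ E ⟧ (δ Vec.++ ρ)) ∎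
      where δs = allBoolVecs n

    size-bindMany : ∀ n {m} (E : Program (n ℕ.+ m)) → size (bindMany n E) ≡ n ℕ.+ size E
    size-bindMany zero    E = ≡.refl
    size-bindMany (suc n) E = ≡.trans (size-bindMany n (bind one E)) (ℕₚ.+-suc n (size E))

    -- Recording demands and choosing among options

    module Demands {k} {Key : Set k} (_≟_ : DecidableEquality Key) (q : ℕ) where

      -- A key is demanded if one of the variables listed for it is true; negated j
      -- is the variable 1 − ε j, so that a demand for ε j is a conflict with it.
      record State (m : ℕ) : Set k where
        field
          demand  : Key → List (Fin m)
          negated : Fin q → Fin m

      open State public

      -- Generic in `m`, because the rest of the program is emitted beneath however many variables
      -- have been bound before it.
      Continuation : Set (k ⊔ w)
      Continuation = ∀ {m} → State m → Program m

      -- One way to supply a demanded key: the weight to be paid and the keys demanded in its place.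
      Option : Set (k ⊔ w)
      Option = W × List Key

      weaken : ∀ {m} → State m → State (suc m)
      weaken σ .demand x  = map suc (demand σ x)
      weaken σ .negated j = suc (negated σ j)

      among : List Key → Key → Bool
      among xs x = any (λ y → does (y ≟ x)) xs

      require : ∀ {m} → Fin m → List Key → State m → State m
      require y xs σ .demand x = if among xs x then y ∷ demand σ x else demand σ x
      require y xs σ .negated  = negated σ

      discharge : ∀ {m} → Key → State m → State m
      discharge x σ .demand x′ = if does (x ≟ x′) then [] else demand σ x′
      discharge x σ .negated   = negated σ

      infixl 6 _∪_ _∖_
      _∪_ : (Key → Bool) → List Key → Key → Bool
      (D ∪ xs) x = among xs x ∨ D x

      _∖_ : (Key → Bool) → Key → Key → Bool
      (D ∖ x) x′ = if does (x ≟ x′) then false else D x′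

      -- The flag `x̄` says that nothing is left to choose, since there was no demand or an earlier
      -- option has been taken. A conflict bars a second choice, and the final clause rejects having
      -- made none. The flag for the remaining options is the disjunction of the new choice and
      -- `x̄`, obtained as a negated `nor`.
      branch : ∀ {m} → Fin m → List Option → State m → Continuation → Program m
      branch x̄ []              σ κ = atLeastOne (x̄ ∷ []) (κ (weaken σ))
      branch x̄ ((a , xs) ∷ os) σ κ =
        bind a (conflict zero (suc x̄)
          (nor (zero ∷ suc x̄ ∷ [])
            (nor (suc zero ∷ [])
              (branch (suc zero) os
                (weaken (weaken (weaken (weaken (require zero xs (weaken σ)))))) κ))))

      -- The `nor` of the demand is the initial flag of `branch`: a key that nobody demands counts
      -- as settled and contributes the factor 1.
      process : ∀ {m} → Key → List Option → State m → Continuation → Program m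
      process x os σ κ = nor (demand σ x) (branch (suc zero) os (discharge x (weaken (weaken σ))) κ)

      processNegated : ∀ {m} → Key → Fin q → State m → Continuation → Program m
      processNegated x j σ κ = conflicts (negated σ j) (demand σ x) (κ (discharge x σ))

      module _ (δ : Fin q → Bool) where

        record Agrees {m} (σ : State m) (ρ : Vec Bool m) (D : Key → Bool) : Set k where
          field
            agrees-demand  : ∀ x → any (lookup ρ) (demand σ x) ≡ D x
            agrees-negated : ∀ j → lookup ρ (negated σ j) ≡ δ j

        open Agrees public

        -- The environment matters only through the set `D` of demanded keys and the fixed bits `δ`.
        -- Everything after this can therefore be argued about functions of `D`, without variables.
        Denotes : Continuation → ((Key → Bool) → Carrier) → Set (k ⊔ ℓ)
        Denotes κ F = ∀ {m} (σ : State m) ρ D → Agrees σ ρ D → ⟦ κ σ ⟧ ρ ≈ F D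

        agrees-weaken : ∀ {m} {σ : State m} {ρ D} b → Agrees σ ρ D → Agrees (weaken σ) (b ∷ ρ) D
        agrees-weaken {σ = σ} {ρ} b A .agrees-demand x =
          ≡.trans (any-map (lookup (b ∷ ρ)) suc (demand σ x)) (agrees-demand A x)
        agrees-weaken b A .agrees-negated = agrees-negated A

        agrees-discharge : ∀ {m} {σ : State m} {ρ D} x → Agrees σ ρ D → Agrees (discharge x σ) ρ (D ∖ x)
        agrees-discharge x A .agrees-demand x′ with does (x ≟ x′)
        ... | true  = ≡.refl
        ... | false = agrees-demand A x′
        agrees-discharge x A .agrees-negated = agrees-negated A

        agrees-require-true : ∀ {m} {σ : State m} {ρ D} y xs → lookup ρ y ≡ true →
          Agrees σ ρ D → Agrees (require y xs σ) ρ (D ∪ xs)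
        agrees-require-true y xs y≡true A .agrees-demand x with among xs x
        ... | true  rewrite y≡true = ≡.refl
        ... | false = agrees-demand A x
        agrees-require-true y xs y≡true A .agrees-negated = agrees-negated A

        agrees-require-false : ∀ {m} {σ : State m} {ρ D} y xs → lookup ρ y ≡ false →
          Agrees σ ρ D → Agrees (require y xs σ) ρ D
        agrees-require-false y xs y≡false A .agrees-demand x with among xs x
        ... | true  rewrite y≡false = agrees-demand A x
        ... | false = agrees-demand A x
        agrees-require-false y xs y≡false A .agrees-negated = agrees-negated A

        choose : ((Key → Bool) → Carrier) → List Option → (Key → Bool) → Carrier
        choose F os D = ∑ os λ (a , xs) → ⟪ a ⟫ * F (D ∪ xs)

        -- Declining the first option leaves the flag as it was, and the others are summed by
        -- induction. Taking it, possible only under a false flag, makes the flag true, so that the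
        -- others reduce to the bare continuation.
        ⟦branch⟧ : ∀ {m} (x̄ : Fin m) os {σ : State m} (κ : Continuation) {F ρ D} → Denotes κ F → Agrees σ ρ D →
          ⟦ branch x̄ os σ κ ⟧ ρ ≈ (if lookup ρ x̄ then F D else choose F os D)
        ⟦branch⟧ x̄ [] {σ} κ {F} {ρ} {D} κ-F A = trans
          (⟦atLeastOne⟧ (x̄ ∷ []) (κ (weaken σ)) ρ λ b → κ-F (weaken σ) (b ∷ ρ) D (agrees-weaken b A))
          (reflexive (≡.cong (λ b → if b then F D else 0#) (∨-identityʳ (lookup ρ x̄))))
        ⟦branch⟧ x̄ ((a , xs) ∷ os) {σ} κ {F} {ρ} {D} κ-F A = begin
          ⟦ body ⟧ (false ∷ ρ) + ⟪ a ⟫ * (if lookup ρ x̄ then 0# else ⟦ body ⟧ (true ∷ ρ))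
            ≈⟨ +-cong (⟦body⟧ false D (agrees-require-false zero xs ≡.refl (agrees-weaken false A)))
                 (*-congˡ (if-cong (lookup ρ x̄) refl
                   (⟦body⟧ true (D ∪ xs) (agrees-require-true zero xs ≡.refl (agrees-weaken true A))))) ⟩
          (if not (not (lookup ρ x̄ ∨ false) ∨ false) then F D else choose F os D)
            + ⟪ a ⟫ * (if lookup ρ x̄ then 0# else F (D ∪ xs))
            ≈⟨ cases (lookup ρ x̄) ⟩
          (if lookup ρ x̄ then F D else choose F ((a , xs) ∷ os) D) ∎
          where
          inner = branch (suc zero) os (weaken (weaken (weaken (weaken (require zero xs (weaken σ)))))) κ
          body  = nor (zero ∷ suc x̄ ∷ []) (nor (suc zero ∷ []) inner)

          ⟦body⟧ : ∀ y D′ → Agrees (require zero xs (weaken σ)) (y ∷ ρ) D′ →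
            ⟦ body ⟧ (y ∷ ρ) ≈
              (if not (not (y ∨ lookup ρ x̄ ∨ false) ∨ false) then F D′ else choose F os D′)
          ⟦body⟧ y D′ A′ =
            ⟦nor⟧ (zero ∷ suc x̄ ∷ []) (nor (suc zero ∷ []) inner) (y ∷ ρ)
              (λ u → if not (u ∨ false) then F D′ else choose F os D′) λ b u →
            ⟦nor⟧ (suc zero ∷ []) inner (b ∷ u ∷ y ∷ ρ)
              (λ r̄ → if r̄ then F D′ else choose F os D′) λ b′ r̄ →
            ⟦branch⟧ (suc zero) os κ κ-F
              (agrees-weaken b′ (agrees-weaken r̄ (agrees-weaken b (agrees-weaken u A′))))

          cases : ∀ b → (if not (not (b ∨ false) ∨ false) then F D else choose F os D)
            + ⟪ a ⟫ * (if b then 0# else F (D ∪ xs)) ≈ (if b then F D else choose F ((a , xs) ∷ os) D)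
          cases true  = trans (+-congˡ (zeroʳ _)) (+-identityʳ _)
          cases false = +-comm _ _

        ⟦process⟧ : ∀ {m} x os {σ : State m} (κ : Continuation) {F ρ D} → Denotes κ F → Agrees σ ρ D →
          ⟦ process x os σ κ ⟧ ρ ≈ (if D x then choose F os (D ∖ x) else F (D ∖ x))
        ⟦process⟧ x os {σ} κ {F} {ρ} {D} κ-F A = trans
          (⟦nor⟧ (demand σ x) (branch (suc zero) os (discharge x (weaken (weaken σ))) κ) ρ
            (λ x̄ → if x̄ then F (D ∖ x) else choose F os (D ∖ x)) λ b x̄ →
            ⟦branch⟧ (suc zero) os κ κ-F (agrees-discharge x (agrees-weaken b (agrees-weaken x̄ A))))
          (reflexive (≡.trans (≡.cong (λ b → if not b then F (D ∖ x) else choose F os (D ∖ x)) (agrees-demand A x)) (if-not (D x))))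
          where
          if-not : ∀ b {y z : Carrier} → (if not b then y else z) ≡ (if b then z else y)
          if-not true  = ≡.refl
          if-not false = ≡.refl

        ⟦processNegated⟧ : ∀ {m} x j {σ : State m} (κ : Continuation) {F ρ D} → Denotes κ F → Agrees σ ρ D →
          ⟦ processNegated x j σ κ ⟧ ρ ≈ (if δ j ∧ D x then 0# else F (D ∖ x))
        ⟦processNegated⟧ x j {σ} κ {F} {ρ} {D} κ-F A
          rewrite ⟦conflicts⟧ (negated σ j) (demand σ x) (κ (discharge x σ)) ρ
                | agrees-negated A j | agrees-demand A x =
          if-cong (δ j ∧ D x) refl (κ-F (discharge x σ) ρ (D ∖ x) (agrees-discharge x A))

      SizeAtMost : ℕ → Continuation → Set k
      SizeAtMost b κ = ∀ {m} (σ : State m) → size (κ σ) ≤ b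

      -- An option costs five variables, one for the choice and two for each `nor`; the closing
      -- clause costs one.
      size-branch : ∀ {m} (x̄ : Fin m) os {σ : State m} (κ : Continuation) {b} → SizeAtMost b κ →
        size (branch x̄ os σ κ) ≤ length os ℕ.* 5 ℕ.+ suc b
      size-branch x̄ [] {σ} κ κ≤b = ℕₚ.≤-trans
        (ℕₚ.≤-reflexive (size-atLeastOne (x̄ ∷ []) (κ (weaken σ)))) (s≤s (κ≤b (weaken σ)))
      size-branch x̄ ((a , xs) ∷ os) {σ} κ κ≤b = s≤s (ℕₚ.≤-trans
        (ℕₚ.≤-reflexive (≡.trans (size-nor (zero ∷ suc x̄ ∷ []) (nor (suc zero ∷ []) inner))
          (≡.cong (2 ℕ.+_) (size-nor (suc zero ∷ []) inner))))
        (ℕₚ.+-monoʳ-≤ 4 (size-branch (suc zero) os κ κ≤b)))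
        where inner = branch (suc zero) os (weaken (weaken (weaken (weaken (require zero xs (weaken σ)))))) κ

      size-process : ∀ x os (κ : Continuation) {b} → SizeAtMost b κ →
        SizeAtMost (2 ℕ.+ (length os ℕ.* 5 ℕ.+ suc b)) (λ σ → process x os σ κ)
      size-process x os κ κ≤b σ = ℕₚ.≤-trans
        (ℕₚ.≤-reflexive (size-nor (demand σ x) (branch (suc zero) os (discharge x (weaken (weaken σ))) κ)))
        (ℕₚ.+-monoʳ-≤ 2 (size-branch (suc zero) os κ κ≤b))

      size-processNegated : ∀ x j (κ : Continuation) {b} → SizeAtMost b κ → SizeAtMost b (λ σ → processNegated x j σ κ)
      size-processNegated x j κ κ≤b σ = ℕₚ.≤-trans
        (ℕₚ.≤-reflexive (size-conflicts (negated σ j) (demand σ x) (κ (discharge x σ)))) (κ≤b (discharge x σ))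

    -- Prenex form: one weighted graph for a whole program

    module PrenexForm (nil : W) (nil≈0 : ⟪ nil ⟫ ≈ 0#) where

      Variable : ℕ → ℕ → Set
      Variable m n = Fin m ⊎ Fin n

      truth : ∀ {m n} → Vec Bool m → Vec Bool n → Variable m n → Bool
      truth ρ ε = [ lookup ρ , lookup ε ]′

      compatible : ∀ {m n} → Vec Bool m → Vec Bool n → Variable m n × Variable m n → Bool
      compatible ρ ε (x , y) = not (truth ρ ε x ∧ truth ρ ε y)

      capture : ∀ {m n} → Variable (suc m) n → Variable m (suc n)
      capture (inj₁ zero)    = inj₂ zero
      capture (inj₁ (suc i)) = inj₁ i
      capture (inj₂ j)       = inj₂ (suc j)

      truth-capture : ∀ {m n} b (ρ : Vec Bool m) (ε : Vec Bool n) x → truth ρ (b ∷ ε) (capture x) ≡ truth (b ∷ ρ) ε x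
      truth-capture b ρ ε (inj₁ zero)    = ≡.refl
      truth-capture b ρ ε (inj₁ (suc i)) = ≡.refl
      truth-capture b ρ ε (inj₂ j)       = ≡.refl

      record Prenex (m n : ℕ) : Set w where
        field
          weights : Fin n → W
          pairs   : List (Variable m n × Variable m n)

      open Prenex public

      term : ∀ {n} → (Fin n → W) → Vec Bool n → Carrier
      term {n} ws ε = ∏ (allFin n) (λ i → if lookup ε i then ⟪ ws i ⟫ else 1#)

      ⟦_⟧ᵖ : ∀ {m n} → Prenex m n → Vec Bool m → Carrier
      ⟦_⟧ᵖ {n = n} P ρ = ∑ (allBoolVecs n) (λ ε → if all (compatible ρ ε) (pairs P) then term (weights P) ε else 0#)

      -- A conflict mentions only variables bound further out, so it may be moved inward past all
      -- later binders. The length `n` of the prefix is prescribed instead of computed, which lets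
      -- one poset serve every program of size at most `n`.
      prenex : ∀ {m n} (E : Program m) → size E ≤ n → Prenex m n
      -- Positions left over get weight 0, so that summing each of them out gives the factor
      -- `1 + 0`.
      prenex done             _          = record { weights = λ _ → nil ; pairs = [] }
      prenex (bind a E)       (s≤s |E|≤n) = record
        { weights = a Vector.∷ weights (prenex E |E|≤n)
        ; pairs   = map (λ (x , y) → capture x , capture y) (pairs (prenex E |E|≤n))
        }
      prenex (conflict i j E) |E|≤n      = record
        { weights = weights (prenex E |E|≤n)
        ; pairs   = (inj₁ i , inj₁ j) ∷ pairs (prenex E |E|≤n)
        }

      ⟦prenex⟧ : ∀ {m n} (E : Program m) (|E|≤n : size E ≤ n) ρ → ⟦ prenex E |E|≤n ⟧ᵖ ρ ≈ ⟦ E ⟧ ρ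
      ⟦prenex⟧ {n = n} done |E|≤n ρ = begin
        ∑ (allBoolVecs n) (term (λ _ → nil))     ≈⟨ ∑-allBoolVecs-∏ n (λ _ → ⟪ nil ⟫) (λ _ → 1#) ⟩
        ∏ (allFin n) (λ _ → 1# + ⟪ nil ⟫)        ≈⟨ ∏-cong (allFin n) (λ _ → trans (+-congˡ nil≈0) (+-identityʳ 1#)) ⟩
        ∏ (allFin n) (λ _ → 1#)                  ≈⟨ ∏-one (allFin n) ⟩
        1#                                       ∎
      ⟦prenex⟧ {n = suc n} (bind a E) (s≤s |E|≤n) ρ = begin
        ⟦ prenex (bind a E) (s≤s |E|≤n) ⟧ᵖ ρ
          ≈⟨ ∑-allBoolVecs-suc n summand ⟩
        ∑ εs (λ ε → summand (false ∷ ε)) + ∑ εs (λ ε → summand (true ∷ ε))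
          ≈⟨ +-cong (∑-cong εs λ ε → trans (split false ε) (if-cong (all (compatible (false ∷ ρ) ε) (pairs P)) (*-identityˡ _) refl))
               (trans (∑-cong εs λ ε → trans (split true ε) (pull (all (compatible (true ∷ ρ) ε) (pairs P)))) (sym (*-distribˡ-∑ ⟪ a ⟫ εs))) ⟩
        ⟦ P ⟧ᵖ (false ∷ ρ) + ⟪ a ⟫ * ⟦ P ⟧ᵖ (true ∷ ρ)
          ≈⟨ +-cong (⟦prenex⟧ E |E|≤n (false ∷ ρ)) (*-congˡ (⟦prenex⟧ E |E|≤n (true ∷ ρ))) ⟩
        ⟦ E ⟧ (false ∷ ρ) + ⟪ a ⟫ * ⟦ E ⟧ (true ∷ ρ) ∎
        where
        P  = prenex E |E|≤n
        P′ = prenex (bind a E) (s≤s |E|≤n)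
        εs = allBoolVecs n
        summand : Vec Bool (suc n) → Carrier
        summand ε = if all (compatible ρ ε) (pairs P′) then term (weights P′) ε else 0#

        split : ∀ b ε → summand (b ∷ ε) ≈
          (if all (compatible (b ∷ ρ) ε) (pairs P) then (if b then ⟪ a ⟫ else 1#) * term (weights P) ε else 0#)
        split b ε = trans
          (reflexive (≡.cong (λ t → if t then term (weights P′) (b ∷ ε) else 0#) (≡.trans
            (all-map (compatible ρ (b ∷ ε)) _ (pairs P))
            (all-cong (λ (x , y) → ≡.cong₂ (λ s t → not (s ∧ t)) (truth-capture b ρ ε x) (truth-capture b ρ ε y)) (pairs P)))))
          (if-cong (all (compatible (b ∷ ρ) ε) (pairs P))
            (∏-allFin-suc n (λ i → if lookup (b ∷ ε) i then ⟪ weights P′ i ⟫ else 1#)) refl)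

        pull : ∀ b {x} → (if b then ⟪ a ⟫ * x else 0#) ≈ ⟪ a ⟫ * (if b then x else 0#)
        pull true  = refl
        pull false = sym (zeroʳ _)
      ⟦prenex⟧ {n = n} (conflict i j E) |E|≤n ρ with lookup ρ i ∧ lookup ρ j
      ... | true  = ∑-zero (allBoolVecs n)
      ... | false = ⟦prenex⟧ E |E|≤n ρ

-- Disjointness of intervals

-- (o , n) stands for the n + 1 slots o, …, o + n, so no interval is empty.
Interval : Set
Interval = ℕ × ℕ

end : Interval → ℕ
end (o , n) = o ℕ.+ suc n

infix 4 _⟂_ _⊑_
_⟂_ : Rel Interval _
J ⟂ J′ = end J ≤ proj₁ J′ ⊎ end J′ ≤ proj₁ J

_⊑_ : Rel Interval _
J ⊑ J′ = proj₁ J′ ≤ proj₁ J × end J ≤ end J′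

⟂-sym : Symmetric _⟂_
⟂-sym (inj₁ e≤o) = inj₂ e≤o
⟂-sym (inj₂ e≤o) = inj₁ e≤o

-- This is where nonemptiness enters: an empty interval would be disjoint from itself. It makes
-- pairwise disjoint demands pairwise distinct.
⟂-irrefl : ∀ {J} → ¬ J ⟂ J
⟂-irrefl {o , n} (inj₁ e≤o) = ℕₚ.m+1+n≰m o e≤o
⟂-irrefl {o , n} (inj₂ e≤o) = ℕₚ.m+1+n≰m o e≤o

⟂-⊑ : ∀ {J J′ J″} → J′ ⟂ J″ → J ⊑ J′ → J ⟂ J″
⟂-⊑ (inj₁ e≤o) (_ , e≤e) = inj₁ (ℕₚ.≤-trans e≤e e≤o)
⟂-⊑ (inj₂ e≤o) (o≤o , _) = inj₂ (ℕₚ.≤-trans e≤o o≤o)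

⊑-refl : ∀ {J} → J ⊑ J
⊑-refl = ℕₚ.≤-refl , ℕₚ.≤-refl

-- A superset of the intervals that fit into `d` slots, with the simple count `d * d`. Those that
-- stick out are never demanded and contribute the factor 1.
intervals : ℕ → List Interval
intervals d = cartesianProduct (upTo d) (upTo d)

length-cartesianProduct : ∀ {a b} {A : Set a} {B : Set b} (xs : List A) (ys : List B) →
  length (cartesianProduct xs ys) ≡ length xs ℕ.* length ys
length-cartesianProduct []       ys = ≡.refl
length-cartesianProduct (x ∷ xs) ys = ≡.trans (length-++ (map (x ,_) ys))
  (≡.cong₂ ℕ._+_ (length-map (x ,_) ys) (length-cartesianProduct xs ys))

splits-sum : ∀ n → All (λ (i , j) → suc i ℕ.+ j ≡ n) (splits n)
splits-sum zero    = []
splits-sum (suc n) = ≡.refl ∷ All.map⁺ (All.map (≡.cong suc) (splits-sum n))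

length-splits : ∀ n → length (splits n) ≡ n
length-splits zero    = ≡.refl
length-splits (suc n) = ≡.cong suc (≡.trans (length-map _ (splits n)) (length-splits n))

module _ {a r} {A : Set a} {R : Rel A r} (R-sym : Symmetric R) where

  AllPairs-extract : ∀ xs {x ys} → AllPairs R (xs ++ x ∷ ys) → All (R x) (xs ++ ys) × AllPairs R (xs ++ ys)
  AllPairs-extract []       (x∷ys ∷ ys) = x∷ys , ys
  AllPairs-extract (z ∷ xs) (z∷ ∷ rest) with AllPairs-extract xs rest | All.++⁻ xs z∷
  ... | x∷ , pairs | z∷xs , z∷x ∷ z∷ys = R-sym z∷x ∷ x∷ , All.++⁺ z∷xs z∷ys ∷ pairs

-- Compiling a circuit into a program

module Compilation {c ℓ₁ ℓ₂} (K : HeytingField c ℓ₁ ℓ₂) (p q d : ℕ) where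

  open Substitution K
  private module K = CommutativeRing coefficientRing
  open CommutativeSemiring (polynomials {p}) hiding (zero)
  open BigOperators (polynomials {p})
  open Programs (polynomials {p})
  open Weighted (Atom K p) (atom K) (inj₂ K.1#) refl (inj₂ (K.- K.1#)) 1+const-1≈0 public
  open import Relation.Binary.Reasoning.Setoid setoid

  Key : ℕ → Set
  Key k = Fin k × Interval

  infix 4 _≟_
  _≟_ : ∀ {k} → DecidableEquality (Key k)
  _≟_ = Product.≡-dec Fin._≟_ (Product.≡-dec ℕₚ._≟_ ℕₚ._≟_)

  module _ {k : ℕ} where
    open Demands (_≟_ {k}) q public
    open DecMembership (_≟_ {k}) public using (_∈?_)

  -- When the newest gate is left behind, no true demand on it remains, so forgetting its keys loses
  -- nothing; `lower` is the counterpart for lists of keys.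
  restrict : ∀ {k m} → State {suc k} m → State {k} m
  restrict σ .demand (v , J) = demand σ (suc v , J)
  restrict σ .negated        = negated σ

  constantTerm : ∀ {u} → Poly K u → K.Carrier
  constantTerm f = coeff K f (replicate _ 0)

  -- A factor of degree 0 is a constant: it goes into the weight and takes no slots.
  options : ∀ {k} → Circuit K (p ℕ.+ q) k → Gate K (p ℕ.+ q) k → Interval → List (Option {suc k})
  options C (input _)   J       = []
  options C (plus i j)  J       = (inj₂ K.1# , (suc i , J) ∷ []) ∷ (inj₂ K.1# , (suc j , J) ∷ []) ∷ []
  options C (times i j) (o , n) =
    (inj₂ (constantTerm (value K C i)) , (suc j , (o , n)) ∷ []) ∷
    (inj₂ (constantTerm (value K C j)) , (suc i , (o , n)) ∷ []) ∷
    map (λ (a , b) → inj₂ K.1# , (suc i , (o , a)) ∷ (suc j , (o ℕ.+ suc a , b)) ∷ []) (splits n)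

  -- A free variable becomes a weight, a summation variable a conflict. Neither has a part of degree
  -- 2 or more: with an empty list of options, a demand for such a part makes the sum vanish.
  leaf : ∀ {k m} → Fin p ⊎ Fin q → Interval → State {suc k} m → Continuation {suc k} → Program m
  leaf (inj₁ x) (o , zero)  σ κ = process (zero , o , zero) ((inj₁ x , []) ∷ []) σ κ
  leaf (inj₂ j) (o , zero)  σ κ = processNegated (zero , o , zero) j σ κ
  leaf _        (o , suc n) σ κ = process (zero , o , suc n) [] σ κ

  step : ∀ {k m} → Circuit K (p ℕ.+ q) k → Gate K (p ℕ.+ q) k → Interval →
         State {suc k} m → Continuation {suc k} → Program m
  step C (input (inj₁ i)) J σ κ = leaf (splitAt p i) J σ κ
  step C g                J σ κ = process (zero , J) (options C g J) σ κ

  steps : ∀ {k m} → Circuit K (p ℕ.+ q) k → Gate K (p ℕ.+ q) k → List Interval →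
          Continuation {suc k} → State {suc k} m → Program m
  steps C g []       κ σ = κ σ
  steps C g (J ∷ Js) κ σ = step C g J σ (steps C g Js κ)

  compile : ∀ {k m} → Circuit K (p ℕ.+ q) k → State {k} m → Program m
  compile []      σ = done
  compile (C ▷ g) σ = steps C g (intervals d) (λ σ → compile C (restrict σ)) σ

  module Semantics (ε : Vec Bool q) where

    δ : Fin q → Bool
    δ j = not (lookup ε j)

    point : Fin (p ℕ.+ q) → Poly K p
    point = [ var K , boolConst K ∘ lookup ε ]′ ∘ splitAt p

    private
      ev : Poly K (p ℕ.+ q) → Poly K p
      ev f = substitute K f point

    -- This and the next definitions repeat the compiler with programs replaced by functions of the
    -- demanded set. The product formula is proved for them, and `denotes-compile` carries it back.
    processValue : ∀ {k} → Key k → List (Option {k}) → ((Key k → Bool) → Carrier) → (Key k → Bool) → Carrier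
    processValue x os F D = if D x then choose δ F os (D ∖ x) else F (D ∖ x)

    leafValue : ∀ {k} → Fin p ⊎ Fin q → Interval → ((Key (suc k) → Bool) → Carrier) → (Key (suc k) → Bool) → Carrier
    leafValue (inj₁ x) (o , zero)  F   = processValue (zero , o , zero) ((inj₁ x , []) ∷ []) F
    leafValue (inj₂ j) (o , zero)  F D = if δ j ∧ D (zero , o , zero) then 0# else F (D ∖ (zero , o , zero))
    leafValue _        (o , suc n) F   = processValue (zero , o , suc n) [] F

    stepValue : ∀ {k} → Circuit K (p ℕ.+ q) k → Gate K (p ℕ.+ q) k → Interval →
                ((Key (suc k) → Bool) → Carrier) → (Key (suc k) → Bool) → Carrier
    stepValue C (input (inj₁ i)) J F = leafValue (splitAt p i) J F
    stepValue C g                J F = processValue (zero , J) (options C g J) F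

    stepsValue : ∀ {k} → Circuit K (p ℕ.+ q) k → Gate K (p ℕ.+ q) k → List Interval →
                 ((Key (suc k) → Bool) → Carrier) → (Key (suc k) → Bool) → Carrier
    stepsValue C g []       F = F
    stepsValue C g (J ∷ Js) F = stepValue C g J (stepsValue C g Js F)

    compileValue : ∀ {k} → Circuit K (p ℕ.+ q) k → (Key k → Bool) → Carrier
    compileValue []      D = 1#
    compileValue (C ▷ g) D = stepsValue C g (intervals d) (λ D → compileValue C (D ∘ map₁ suc)) D

    denotes-leaf : ∀ {k} s J (κ : Continuation {suc k}) {F} → Denotes δ κ F →
                   Denotes δ (λ σ → leaf s J σ κ) (leafValue s J F)
    denotes-leaf (inj₁ x) (o , zero)  κ κ-F σ ρ D A = ⟦process⟧ δ (zero , o , zero) ((inj₁ x , []) ∷ []) κ κ-F A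
    denotes-leaf (inj₂ j) (o , zero)  κ κ-F σ ρ D A = ⟦processNegated⟧ δ (zero , o , zero) j κ κ-F A
    denotes-leaf (inj₁ x) (o , suc n) κ κ-F σ ρ D A = ⟦process⟧ δ (zero , o , suc n) [] κ κ-F A
    denotes-leaf (inj₂ j) (o , suc n) κ κ-F σ ρ D A = ⟦process⟧ δ (zero , o , suc n) [] κ κ-F A

    denotes-step : ∀ {k} C g J (κ : Continuation {suc k}) {F} → Denotes δ κ F →
                   Denotes δ (λ σ → step C g J σ κ) (stepValue C g J F)
    denotes-step C (input (inj₁ i)) J κ κ-F = denotes-leaf (splitAt p i) J κ κ-F
    denotes-step C (input (inj₂ b)) J κ κ-F σ ρ D A = ⟦process⟧ δ (zero , J) [] κ κ-F A
    denotes-step C (plus i j)       J κ κ-F σ ρ D A = ⟦process⟧ δ (zero , J) (options C (plus i j) J) κ κ-F A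
    denotes-step C (times i j)      J κ κ-F σ ρ D A = ⟦process⟧ δ (zero , J) (options C (times i j) J) κ κ-F A

    denotes-steps : ∀ {k} C g Js (κ : Continuation {suc k}) {F} → Denotes δ κ F →
                    Denotes δ (steps C g Js κ) (stepsValue C g Js F)
    denotes-steps C g []       κ κ-F = κ-F
    denotes-steps C g (J ∷ Js) κ κ-F = denotes-step C g J (steps C g Js κ) (denotes-steps C g Js κ κ-F)

    denotes-compile : ∀ {k} (C : Circuit K (p ℕ.+ q) k) → Denotes δ (compile C) (compileValue C)
    denotes-compile []      σ ρ D A = refl
    denotes-compile (C ▷ g) = denotes-steps C g (intervals d) (λ σ → compile C (restrict σ))
      λ σ ρ D A → denotes-compile C (restrict σ) ρ (D ∘ map₁ suc) record
        { agrees-demand  = λ x → agrees-demand A (map₁ suc x)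
        ; agrees-negated = agrees-negated A
        }

    -- The offset `o` only keeps simultaneous demands apart; the value depends on the length of the
    -- interval alone.
    val : ∀ {k} → Circuit K (p ℕ.+ q) k → Key k → Carrier
    val C (v , (o , n)) = ev (part (suc n) (value K C v))

    among-true : ∀ {k} {x : Key k} {xs} → x ∈ xs → among xs x ≡ true
    among-true {x = x} (here ≡.refl) rewrite dec-true (x ≟ x) ≡.refl = ≡.refl
    among-true {x = x} {y ∷ xs} (there x∈xs) rewrite among-true x∈xs = ∨-zeroʳ (does (y ≟ x))

    among-false : ∀ {k} {x : Key k} xs → x ∉ xs → among xs x ≡ false
    among-false []       x∉xs = ≡.refl
    among-false {x = x} (y ∷ xs) x∉xs
      rewrite dec-false (y ≟ x) (λ y≡x → x∉xs (here (≡.sym y≡x))) = among-false xs (x∉xs ∘ there)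

    infix 4 _≗_
    _≗_ : ∀ {k} → (Key k → Bool) → (Key k → Bool) → Set
    D ≗ D′ = ∀ x → D x ≡ D′ x

    Disjoint : ∀ {k} → List (Key k) → Set
    Disjoint = AllPairs (_⟂_ on proj₂)

    Bounded : ∀ {k} → List (Key k) → Set
    Bounded = All λ (_ , J) → end J ≤ d

    Pending : ∀ {k} → List Interval → List (Key (suc k)) → Set
    Pending Js xs = ∀ {J} → (zero , J) ∈ xs → J ∈ Js

    record Admissible {k} (Js : List Interval) (xs : List (Key (suc k))) : Set where
      field
        disjoint : Disjoint xs
        bounded  : Bounded xs
        pending  : Pending Js xs

    open Admissible

    -- A Boolean function cannot be multiplied over directly, so the product runs along any list
    -- that enumerates it. The condition `Q` always includes disjointness and thereby excludes
    -- repeated keys.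
    ProductOn : ∀ {k} → (List (Key k) → Set) → (Key k → Carrier) → ((Key k → Bool) → Carrier) → Set ℓ₁
    ProductOn Q h F = ∀ {D} xs → D ≗ among xs → Q xs → F D ≈ ∏ xs h

    -- What is needed to replace `x` by the keys of the option: they stay inside its interval, hence
    -- clear of all other demands; they are disjoint from each other; and they belong to older
    -- gates, so nothing already processed is demanded again.
    record AdmissibleOption {k} (x : Key (suc k)) (option : Option {suc k}) : Set where
      field
        within    : All (λ y → proj₂ y ⊑ proj₂ x) (proj₂ option)
        separated : Disjoint (proj₂ option)
        earlier   : ∀ {J} → (zero , J) ∉ proj₂ option

    open AdmissibleOption

    -- Disjointness makes the demanded keys distinct, so that discharging x
    -- removes exactly one factor.
    product-step : ∀ {k} {J Js} {h : Key (suc k) → Carrier} {F G} → ProductOn (Admissible Js) h F →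
      (∀ {D} → D (zero , J) ≡ false → G D ≈ F (D ∖ (zero , J))) →
      (∀ {D} xs → D (zero , J) ≡ true → D ∖ (zero , J) ≗ among xs → Disjoint ((zero , J) ∷ xs) →
        Bounded ((zero , J) ∷ xs) → Pending Js xs → G D ≈ h (zero , J) * ∏ xs h) →
      ProductOn (Admissible (J ∷ Js)) h G
    product-step {J = J} {Js} {h} {F} {G} F-h G-off G-on {D} xs D≗ Q with (zero , J) ∈? xs
    ... | no x∉xs = trans (G-off (≡.trans (D≗ x) (among-false xs x∉xs))) (F-h xs D∖x≗ record
      { disjoint = disjoint Q ; bounded = bounded Q ; pending = still-pending })
      where
      x = zero , J

      D∖x≗ : D ∖ x ≗ among xs
      D∖x≗ x′ with x ≟ x′
      ... | yes ≡.refl = ≡.sym (among-false xs x∉xs)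
      ... | no  _      = D≗ x′

      still-pending : Pending Js xs
      still-pending x′∈xs with pending Q x′∈xs
      ... | here ≡.refl = contradiction x′∈xs x∉xs
      ... | there J′∈Js = J′∈Js
    ... | yes x∈xs with ys , zs , ≡.refl ← ∈-∃++ x∈xs
                   with x⟂ , pairs ← AllPairs-extract ⟂-sym ys (disjoint Q)
                   with b-ys , b-x ∷ b-zs ← All.++⁻ ys (bounded Q) = begin
      G D                    ≈⟨ G-on (ys ++ zs) (≡.trans (D≗ x) (among-true x∈xs)) D∖x≗ (x⟂ ∷ pairs)
                                  (b-x ∷ All.++⁺ b-ys b-zs) still-pending ⟩
      h x * ∏ (ys ++ zs) h   ≈⟨ *-congˡ {x = h x} (∏-++ ys zs {h}) ⟩
      h x * (∏ ys h * ∏ zs h) ≈⟨ x∙yz≈y∙xz (h x) (∏ ys h) (∏ zs h) ⟩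
      ∏ ys h * (h x * ∏ zs h) ≈⟨ ∏-++ ys (x ∷ zs) {h} ⟨
      ∏ (ys ++ x ∷ zs) h     ∎
      where
      open import Algebra.Properties.CommutativeSemigroup *-commutativeSemigroup using (x∙yz≈y∙xz)
      x = zero , J

      x∉ : x ∉ ys ++ zs
      x∉ x∈ = ⟂-irrefl (All.lookup x⟂ x∈)

      D∖x≗ : D ∖ x ≗ among (ys ++ zs)
      D∖x≗ x′ with x ≟ x′ in eq
      ... | yes ≡.refl = ≡.sym (among-false (ys ++ zs) x∉)
      ... | no  _      = ≡.trans (D≗ x′) (≡.trans (any-++ _ ys (x ∷ zs))
              (≡.trans (≡.cong (λ b → among ys x′ ∨ (b ∨ among zs x′)) (≡.cong does eq)) (≡.sym (any-++ _ ys zs))))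

      still-pending : Pending Js (ys ++ zs)
      still-pending x′∈ with pending Q (insert ys x′∈)
        where
        insert : ∀ {y} ys → y ∈ ys ++ zs → y ∈ ys ++ x ∷ zs
        insert []       y∈           = there y∈
        insert (_ ∷ ys) (here y≡)    = here y≡
        insert (_ ∷ ys) (there y∈)   = there (insert ys y∈)
      ... | here ≡.refl = contradiction x′∈ x∉
      ... | there J′∈Js = J′∈Js

    -- For each option the hypothesis on `F` gives the product over its keys times the product over
    -- the untouched keys `xs`. The latter is common to all options and factors out, leaving the
    -- expansion of the value at `x`.
    product-process : ∀ {k} {J Js} os {h : Key (suc k) → Carrier} {F} → ProductOn (Admissible Js) h F →
      All (AdmissibleOption (zero , J)) os →
      ∑ os (λ (a , xs) → atom K a * ∏ xs h) ≈ h (zero , J) →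
      ProductOn (Admissible (J ∷ Js)) h (processValue (zero , J) os F)
    product-process {J = J} {Js} os {h} {F} F-h os-ok os≈h = product-step {h = h} F-h
      (λ {D} Dx≡false → reflexive (≡.cong (λ b → if b then choose δ F os (D ∖ x) else F (D ∖ x)) Dx≡false))
      (λ {D} xs Dx≡true D∖x≗ disj bdd pend → begin
        (if D x then choose δ F os (D ∖ x) else F (D ∖ x))
          ≡⟨ ≡.cong (λ b → if b then choose δ F os (D ∖ x) else F (D ∖ x)) Dx≡true ⟩
        ∑ os (λ (a , ys) → atom K a * F ((D ∖ x) ∪ ys))
          ≈⟨ each xs D∖x≗ disj bdd pend os os-ok ⟩
        ∑ os (λ (a , ys) → atom K a * ∏ ys h * ∏ xs h)
          ≈⟨ *-distribʳ-∑ (∏ xs h) os ⟨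
        ∑ os (λ (a , ys) → atom K a * ∏ ys h) * ∏ xs h
          ≈⟨ *-congʳ {x = ∏ xs h} os≈h ⟩
        h x * ∏ xs h ∎)
      where
      x = zero , J
      each : ∀ {D} xs → D ≗ among xs → Disjoint (x ∷ xs) → Bounded (x ∷ xs) → Pending Js xs →
        ∀ os → All (AdmissibleOption x) os →
        ∑ os (λ (a , ys) → atom K a * F (D ∪ ys)) ≈ ∑ os (λ (a , ys) → atom K a * ∏ ys h * ∏ xs h)
      each xs D≗ disj bdd pend [] [] = refl
      each {D} xs D≗ (x⟂ ∷ disj) (x≤d ∷ bdd) pend ((a , ys) ∷ os) (ok ∷ os-ok) = +-cong
        (trans (*-congˡ {x = atom K a} (F-h (ys ++ xs) D∪≗ record
            { disjoint = AllPairs.++⁺ (separated ok) disj (All.map (λ y⊑x → All.map (λ x⟂z → ⟂-⊑ x⟂z y⊑x) x⟂) (within ok))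
            ; bounded  = All.++⁺ (All.map (λ y⊑x → ℕₚ.≤-trans (proj₂ y⊑x) x≤d) (within ok)) bdd
            ; pending  = still-pending
            }))
          (trans (*-congˡ {x = atom K a} (∏-++ ys xs {h})) (sym (*-assoc (atom K a) (∏ ys h) (∏ xs h)))))
        (each xs D≗ (x⟂ ∷ disj) (x≤d ∷ bdd) pend os os-ok)
        where
        D∪≗ : D ∪ ys ≗ among (ys ++ xs)
        D∪≗ z = ≡.trans (≡.cong (among ys z ∨_) (D≗ z)) (≡.sym (any-++ _ ys xs))
        still-pending : Pending Js (ys ++ xs)
        still-pending z∈ with ∈-++⁻ ys z∈
        ... | inj₁ z∈ys = contradiction z∈ys (earlier ok)
        ... | inj₂ z∈xs = pend z∈xs

    -- Discarding the assignments with `ε j = 0` amounts to multiplying by `ε j`, which is the value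
    -- of the leaf.
    product-negated : ∀ {k} {o j Js} {h : Key (suc k) → Carrier} {F} → ProductOn (Admissible Js) h F →
      boolConst K (lookup ε j) ≈ h (zero , o , 0) →
      ProductOn (Admissible ((o , 0) ∷ Js)) h (leafValue (inj₂ j) (o , 0) F)
    product-negated {o = o} {j} {Js} {h} {F} F-h ε≈h = product-step {h = h} F-h
      (λ {D} Dx≡false → reflexive (≡.cong (λ b → if b then 0# else F (D ∖ x))
        (≡.trans (≡.cong (δ j ∧_) Dx≡false) (∧-zeroʳ (δ j)))))
      (λ {D} xs Dx≡true D∖x≗ disj bdd pend → begin
        (if δ j ∧ D x then 0# else F (D ∖ x))
          ≡⟨ ≡.cong (λ b → if b then 0# else F (D ∖ x)) (≡.trans (≡.cong (δ j ∧_) Dx≡true) (∧-identityʳ (δ j))) ⟩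
        (if δ j then 0# else F (D ∖ x))
          ≈⟨ if-cong (δ j) refl (F-h xs D∖x≗ record { disjoint = AllPairs.tail disj ; bounded = All.tail bdd ; pending = pend }) ⟩
        (if δ j then 0# else ∏ xs h)
          ≈⟨ collapse (lookup ε j) (∏ xs h) ⟩
        boolConst K (lookup ε j) * ∏ xs h
          ≈⟨ *-congʳ {x = ∏ xs h} ε≈h ⟩
        h x * ∏ xs h ∎)
      where
      x = zero , o , 0
      collapse : ∀ b y → (if not b then 0# else y) ≈ boolConst K b * y
      collapse true  y = sym (*-identityˡ y)
      collapse false y = sym (trans (*-congʳ {x = y} const-0) (zeroˡ y))

    product-leaf : ∀ {k} (C : Circuit K (p ℕ.+ q) k) i J {Js F} →
      ProductOn (Admissible Js) (val (C ▷ input (inj₁ i))) F →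
      ProductOn (Admissible (J ∷ Js)) (val (C ▷ input (inj₁ i))) (leafValue (splitAt p i) J F)
    product-leaf {k} C i (o , zero) F-h with splitAt p i in eq
    ... | inj₁ x = product-process ((inj₁ x , []) ∷ []) {val (C ▷ input (inj₁ i))} F-h
      (record { within = [] ; separated = [] ; earlier = λ () } ∷ [])
      (begin
        var K x * 1# + 0#      ≈⟨ +-identityʳ _ ⟩
        var K x * 1#           ≈⟨ *-identityʳ (var K x) ⟩
        var K x                ≡⟨ ≡.cong [ var K , boolConst K ∘ lookup ε ]′ eq ⟨
        point i                ≈⟨ substitute-var point i ⟨
        ev (var K i)           ≡⟨ ≡.cong ev (part-1-var i) ⟨
        ev (part 1 (var K i))  ∎)
    ... | inj₂ j = product-negated {h = val (C ▷ input (inj₁ i))} F-h (begin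
        boolConst K (lookup ε j) ≡⟨ ≡.cong [ var K , boolConst K ∘ lookup ε ]′ eq ⟨
        point i                  ≈⟨ substitute-var point i ⟨
        ev (var K i)             ≡⟨ ≡.cong ev (part-1-var i) ⟨
        ev (part 1 (var K i))    ∎)
    product-leaf {k} C i (o , suc n) {Js} {F} F-h with splitAt p i
    ... | inj₁ _ = product-process [] {val (C ▷ input (inj₁ i))} F-h [] (reflexive (≡.cong ev (≡.sym (part-2+-var n i))))
    ... | inj₂ _ = product-process [] {val (C ▷ input (inj₁ i))} F-h [] (reflexive (≡.cong ev (≡.sym (part-2+-var n i))))

    single-admissible : ∀ {k} (v : Fin k) {a J} → AdmissibleOption (zero , J) (a , (suc v , J) ∷ [])
    single-admissible v = record { within = ⊑-refl ∷ [] ; separated = [] ∷ [] ; earlier = λ { (here ()) ; (there ()) } }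

    -- Since `a + b + 1 = n`, the pieces of `a + 1` and `b + 1` slots tile the `n + 1` slots
    -- exactly: the second starts where the first ends.
    split-admissible : ∀ {k} (i j : Fin k) o n {c} → All (AdmissibleOption (zero , o , n))
      (map (λ (a , b) → c , (suc i , (o , a)) ∷ (suc j , (o ℕ.+ suc a , b)) ∷ []) (splits n))
    split-admissible i j o n = All.map⁺ (All.map ok (splits-sum n))
      where
      ok : ∀ {ab c} → suc (proj₁ ab) ℕ.+ proj₂ ab ≡ n → AdmissibleOption (zero , o , n)
        (c , (suc i , (o , proj₁ ab)) ∷ (suc j , (o ℕ.+ suc (proj₁ ab) , proj₂ ab)) ∷ [])
      ok {a , b} ≡.refl = record
        { within    = (ℕₚ.≤-refl , ℕₚ.+-monoʳ-≤ o (s≤s (ℕₚ.≤-trans (ℕₚ.m≤m+n a b) (ℕₚ.n≤1+n _))))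
                    ∷ (ℕₚ.m≤m+n o (suc a) , ℕₚ.≤-reflexive (≡.trans (ℕₚ.+-assoc o (suc a) (suc b))
                        (≡.cong (o ℕ.+_) (ℕₚ.+-suc (suc a) b))))
                    ∷ []
        ; separated = (inj₁ ℕₚ.≤-refl ∷ []) ∷ [] ∷ []
        ; earlier   = λ { (here ()) ; (there (here ())) ; (there (there ())) }
        }

    -- This is `part-*` after substitution. The first two options carry a constant term as weight,
    -- the others correspond to the splits.
    times-sum : ∀ {k} (C : Circuit K (p ℕ.+ q) k) i j o n →
      ∑ (options C (times i j) (o , n)) (λ (a , xs) → atom K a * ∏ xs (val (C ▷ times i j)))
        ≈ val (C ▷ times i j) (zero , o , n)
    times-sum C i j o n = begin
      const K (constantTerm f) * (ev (part (suc n) g) * 1#) +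
        (const K (constantTerm g) * (ev (part (suc n) f) * 1#) + ∑ (map option (splits n)) weightedValue)
        ≈⟨ +-cong (*-cong (ev-part-0 f) (*-identityʳ (ev (part (suc n) g))))
             (+-cong (trans (*-cong (ev-part-0 g) (*-identityʳ (ev (part (suc n) f)))) (*-comm (ev (part 0 g)) (ev (part (suc n) f))))
               (trans (∑-map option (splits n)) (∑-cong (splits n) λ (a , b) → trans (*-identityˡ _)
                 (trans (*-congˡ {x = ev (part (suc a) f)} (*-identityʳ (ev (part (suc b) g))))
                   (sym (substitute-* point (part (suc a) f) (part (suc b) g))))))) ⟩
      ev (part 0 f) * ev (part (suc n) g) + (ev (part (suc n) f) * ev (part 0 g) +
        ∑ (splits n) (λ (a , b) → ev (part (suc a) f P.* part (suc b) g)))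
        ≈⟨ +-cong (substitute-* point (part 0 f) (part (suc n) g)) (trans
             (substitute-+ point (part (suc n) f P.* part 0 g) (P.∑ (splits n) (λ (a , b) → part (suc a) f P.* part (suc b) g)))
             (+-cong (substitute-* point (part (suc n) f) (part 0 g))
               (substitute-∑ point (splits n) (λ (a , b) → part (suc a) f P.* part (suc b) g)))) ⟨
      ev (part 0 f P.* part (suc n) g) + ev (part (suc n) f P.* part 0 g P.+
        P.∑ (splits n) (λ (a , b) → part (suc a) f P.* part (suc b) g))
        ≈⟨ substitute-+ point (part 0 f P.* part (suc n) g) _ ⟨
      ev (part 0 f P.* part (suc n) g P.+ (part (suc n) f P.* part 0 g P.+
        P.∑ (splits n) (λ (a , b) → part (suc a) f P.* part (suc b) g)))
        ≈⟨ substitute-cong point (part-* n f g) ⟨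
      ev (part (suc n) (f P.* g)) ∎
      where
      module P where
        open CommutativeSemiring (polynomials {p ℕ.+ q}) public
        open BigOperators (polynomials {p ℕ.+ q}) public
      f = value K C i
      g = value K C j
      option : ℕ × ℕ → Option
      option (a , b) = inj₂ K.1# , (suc i , (o , a)) ∷ (suc j , (o ℕ.+ suc a , b)) ∷ []
      weightedValue : Option → Carrier
      weightedValue (a , xs) = atom K a * ∏ xs (val (C ▷ times i j))
      ev-part-0 : ∀ r → const K (constantTerm r) ≈ ev (part 0 r)
      ev-part-0 r = trans (sym (substitute-const point (constantTerm r))) (substitute-cong point (P.sym (part-0 r)))

    product-stepValue : ∀ {k} (C : Circuit K (p ℕ.+ q) k) g J {Js F} →
      ProductOn (Admissible Js) (val (C ▷ g)) F → ProductOn (Admissible (J ∷ Js)) (val (C ▷ g)) (stepValue C g J F)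
    product-stepValue C (input (inj₁ i)) J F-h = product-leaf C i J F-h
    product-stepValue C (input (inj₂ b)) (o , n) F-h = product-process [] {val (C ▷ input (inj₂ b))} F-h []
      (reflexive (≡.cong ev (≡.sym (part-suc-const n b))))
    product-stepValue C (plus i j) (o , n) F-h = product-process (options C (plus i j) (o , n)) {val (C ▷ plus i j)} F-h
      (single-admissible i ∷ single-admissible j ∷ [])
      (begin
        1# * (f * 1#) + (1# * (g * 1#) + 0#)
          ≈⟨ +-cong (trans (*-identityˡ _) (*-identityʳ f))
               (trans (+-identityʳ (1# * (g * 1#))) (trans (*-identityˡ _) (*-identityʳ g))) ⟩
        f + g
          ≈⟨ substitute-+ point (part (suc n) (value K C i)) (part (suc n) (value K C j)) ⟨
        ev (part (suc n) (value K C i) ++ part (suc n) (value K C j))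
          ≡⟨ ≡.cong ev (part-+ (suc n) (value K C i) (value K C j)) ⟨
        ev (part (suc n) (value K C i ++ value K C j)) ∎)
      where
      f = val C (i , o , n)
      g = val C (j , o , n)
    product-stepValue C (times i j) (o , n) F-h = product-process (options C (times i j) (o , n)) {val (C ▷ times i j)} F-h
      (single-admissible j ∷ single-admissible i ∷ split-admissible i j o n) (times-sum C i j o n)

    product-stepsValue : ∀ {k} (C : Circuit K (p ℕ.+ q) k) g Js {F} → ProductOn (Admissible []) (val (C ▷ g)) F →
      ProductOn (Admissible Js) (val (C ▷ g)) (stepsValue C g Js F)
    product-stepsValue C g []       F-h = F-h
    product-stepsValue C g (J ∷ Js) F-h = product-stepValue C g J (product-stepsValue C g Js F-h)

    lower : ∀ {k} (xs : List (Key (suc k))) → Pending [] xs → ∃[ ys ] xs ≡ map (map₁ suc) ys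
    lower []                  pend = [] , ≡.refl
    lower ((zero  , J) ∷ xs)  pend with () ← pend (here ≡.refl)
    lower ((suc v , J) ∷ xs)  pend with ys , ≡.refl ← lower xs (pend ∘ there) = (v , J) ∷ ys , ≡.refl

    among-raise : ∀ {k} (xs : List (Key k)) x → among (map (map₁ suc) xs) (map₁ suc x) ≡ among xs x
    among-raise []       x = ≡.refl
    among-raise (y ∷ xs) x = ≡.cong₂ _∨_ (does-⇔ (mk⇔ (λ { ≡.refl → ≡.refl }) (≡.cong (map₁ suc)))
      (map₁ suc y ≟ map₁ suc x) (y ≟ x)) (among-raise xs x)

    -- Induction on the circuit. Interval by interval, the demands on the newest gate are traded for
    -- demands on older gates, until the list lies in the smaller circuit; the empty circuit has no
    -- keys and yields the empty product.
    product-compileValue : ∀ {k} (C : Circuit K (p ℕ.+ q) k) →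
      ProductOn (λ xs → Disjoint xs × Bounded xs) (val C) (compileValue C)
    product-compileValue []      [] D≗ _ = refl
    product-compileValue (C ▷ g) {D} xs D≗ (disj , bdd) =
      product-stepsValue C g (intervals d) {λ D → compileValue C (D ∘ map₁ suc)} base xs D≗
        record { disjoint = disj ; bounded = bdd ; pending = pend }
      where
      base : ProductOn (Admissible []) (val (C ▷ g)) (λ D → compileValue C (D ∘ map₁ suc))
      base xs D≗ Q with ys , ≡.refl ← lower xs (pending Q) = trans
        (product-compileValue C ys (λ x → ≡.trans (D≗ (map₁ suc x)) (among-raise ys x))
          (AllPairs.map⁻ (disjoint Q) , All.map⁻ (bounded Q)))
        (sym (∏-map (map₁ suc) ys {val (C ▷ g)}))

      -- From `o + n + 1 ≤ d` both `o < d` and `n < d` follow, so a demanded interval is always on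
      -- the list.
      pend : Pending (intervals d) xs
      pend {o , n} x∈xs = ∈-cartesianProduct⁺
        (∈-upTo⁺ (ℕₚ.≤-trans (ℕₚ.≤-trans (s≤s (ℕₚ.m≤m+n o n)) (ℕₚ.≤-reflexive (≡.sym (ℕₚ.+-suc o n)))) o+1+n≤d))
        (∈-upTo⁺ (ℕₚ.≤-trans (ℕₚ.m≤n+m (suc n) o) o+1+n≤d))
        where o+1+n≤d = All.lookup bdd x∈xs

  module _ {k : ℕ} (C : Circuit K (p ℕ.+ q) k) (out : Fin k) where

    private
      f = value K C out

    -- One option for each degree up to `d`, as in `∑-parts`: the constant term is paid at once, and
    -- the part of degree `n + 1` is demanded on the first `n + 1` slots.
    rootOptions : List (Option {k})
    rootOptions = (inj₂ (constantTerm f) , []) ∷ map (λ n → inj₂ K.1# , (out , 0 , n) ∷ []) (upTo d)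

    root : ∀ {m} → State {k} m → Program m
    -- The empty `nor` is true and its negation is false, which is the flag that forces `branch` to
    -- take an option.
    root σ = nor [] (nor (suc zero ∷ []) (branch (suc zero) rootOptions (weaken (weaken (weaken (weaken σ)))) (compile C)))

    initial : State {k} (q ℕ.+ 0)
    initial .demand x  = []
    initial .negated j = j ↑ˡ 0

    program : Program 0
    program = bindMany q (root initial)

    ⟦root⟧ : ∀ ε {m} {σ : State {k} m} {ρ} → DegreeAtMost K f d → Agrees (Semantics.δ ε) σ ρ (λ _ → false) →
      ⟦ root σ ⟧ ρ ≈ substitute K f (Semantics.point ε)
    ⟦root⟧ ε {σ = σ} {ρ} deg≤d A = begin
      ⟦ root σ ⟧ ρ
        ≈⟨ ⟦nor⟧ [] (nor (suc zero ∷ []) body) ρ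
             (λ u → if not (u ∨ false) then compileValue C ∅ else choose δ (compileValue C) rootOptions ∅) (λ b u →
           ⟦nor⟧ (suc zero ∷ []) body (b ∷ u ∷ ρ)
             (λ x̄ → if x̄ then compileValue C ∅ else choose δ (compileValue C) rootOptions ∅) λ b′ x̄ →
           ⟦branch⟧ δ (suc zero) rootOptions (compile C) (denotes-compile C)
             (agrees-weaken δ b′ (agrees-weaken δ x̄ (agrees-weaken δ b (agrees-weaken δ u A))))) ⟩
      const K (constantTerm f) * compileValue C (∅ ∪ []) +
        ∑ (map (λ n → inj₂ K.1# , (out , 0 , n) ∷ []) (upTo d)) (λ (a , xs) → atom K a * compileValue C (∅ ∪ xs))
        ≈⟨ +-cong
             (trans (*-congˡ {x = const K (constantTerm f)} (product-compileValue C [] (λ _ → ≡.refl) ([] , [])))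
               (trans (*-identityʳ (const K (constantTerm f)))
                 (trans (sym (substitute-const point (constantTerm f))) (substitute-cong point (P.sym (part-0 f))))))
             (trans (∑-map _ (upTo d)) (∑-cong-∈ (upTo d) λ {n} n∈ → trans (*-identityˡ _) (trans
               (product-compileValue C ((out , 0 , n) ∷ []) (λ x → ∨-identityʳ _) ([] ∷ [] , ∈-upTo⁻ n∈ ∷ []))
               (*-identityʳ (val C (out , 0 , n)))))) ⟩
      ev (part 0 f) + ∑ (upTo d) (λ n → ev (part (suc n) f))
        ≈⟨ trans (substitute-+ point (part 0 f) (P.∑ (upTo d) (λ n → part (suc n) f)))
             (+-congˡ {x = ev (part 0 f)} (substitute-∑ point (upTo d) (λ n → part (suc n) f))) ⟨
      ev (part 0 f P.+ P.∑ (upTo d) (λ n → part (suc n) f))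
        ≈⟨ substitute-cong point (∑-parts d f deg≤d) ⟨
      ev f ∎
      where
      open Semantics ε
      module P where
        open CommutativeSemiring (polynomials {p ℕ.+ q}) public
        open BigOperators (polynomials {p ℕ.+ q}) public
      ev : Poly K (p ℕ.+ q) → Poly K p
      ev g = substitute K g point
      ∅ : Key k → Bool
      ∅ _ = false
      body = branch (suc zero) rootOptions (weaken (weaken (weaken (weaken σ)))) (compile C)

    ⟦program⟧ : DegreeAtMost K f d → ⟦ program ⟧ [] ≈ booleanSum K p f
    ⟦program⟧ deg≤d = begin
      ⟦ program ⟧ []
        ≈⟨ ⟦bindMany⟧ q (root initial) [] ⟩
      ∑ (allBoolVecs q) (λ ε̄ → ⟦ root initial ⟧ (ε̄ Vec.++ []))
        ≈⟨ ∑-cong (allBoolVecs q) (λ ε̄ → ⟦root⟧ (Vec.map not ε̄) deg≤d record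
             { agrees-demand  = λ _ → ≡.refl
             ; agrees-negated = λ j → ≡.trans (lookup-++ˡ ε̄ [] j) (≡.sym (≡.trans
                 (≡.cong not (lookup-map j not ε̄)) (not-involutive (lookup ε̄ j))))
             }) ⟩
      ∑ (allBoolVecs q) (λ ε̄ → substitute K f (Semantics.point (Vec.map not ε̄)))
        ≈⟨ ∑-allBoolVecs-not q (λ ε → substitute K f (Semantics.point ε)) ⟩
      booleanSum K p f ∎

  -- A gate has at most `2 + d` options of five variables each, attained by products; the remaining
  -- 3 are the initial `nor` and the closing clause.
  stepCost : ℕ
  stepCost = (2 ℕ.+ d) ℕ.* 5 ℕ.+ 3

  size-process-step : ∀ {k} (x : Key k) os (κ : Continuation {k}) {b} → length os ≤ 2 ℕ.+ d → SizeAtMost b κ →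
    SizeAtMost (stepCost ℕ.+ b) (λ σ → process x os σ κ)
  size-process-step x os κ {b} os≤ κ≤b σ = ℕₚ.≤-trans (size-process x os κ κ≤b σ) (ℕₚ.≤-trans
    (ℕₚ.+-monoʳ-≤ 2 (ℕₚ.+-monoˡ-≤ (suc b) (ℕₚ.*-monoˡ-≤ 5 os≤)))
    (ℕₚ.≤-reflexive (rearrange ((2 ℕ.+ d) ℕ.* 5) b)))
    where
    rearrange : ∀ x b → 2 ℕ.+ (x ℕ.+ suc b) ≡ x ℕ.+ 3 ℕ.+ b
    rearrange = solve-∀

  size-leaf : ∀ {k} s (J : Interval) (κ : Continuation {suc k}) {b} → SizeAtMost b κ →
    SizeAtMost (stepCost ℕ.+ b) (λ σ → leaf s J σ κ)
  size-leaf (inj₁ x) (o , zero)  κ κ≤b = size-process-step (zero , o , zero) ((inj₁ x , []) ∷ []) κ (s≤s z≤n) κ≤b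
  size-leaf (inj₂ j) (o , zero)  κ κ≤b σ = ℕₚ.≤-trans (size-processNegated (zero , o , zero) j κ κ≤b σ) (ℕₚ.m≤n+m _ stepCost)
  size-leaf (inj₁ x) (o , suc n) κ κ≤b = size-process-step (zero , o , suc n) [] κ z≤n κ≤b
  size-leaf (inj₂ j) (o , suc n) κ κ≤b = size-process-step (zero , o , suc n) [] κ z≤n κ≤b

  size-step : ∀ {k} (C : Circuit K (p ℕ.+ q) k) g J (κ : Continuation {suc k}) {b} → proj₂ J < d → SizeAtMost b κ →
    SizeAtMost (stepCost ℕ.+ b) (λ σ → step C g J σ κ)
  size-step C (input (inj₁ i)) J κ n<d κ≤b = size-leaf (splitAt p i) J κ κ≤b
  size-step C (input (inj₂ b)) J κ n<d κ≤b = size-process-step (zero , J) [] κ z≤n κ≤b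
  size-step C (plus i j)       J κ n<d κ≤b = size-process-step (zero , J) (options C (plus i j) J) κ (s≤s (s≤s z≤n)) κ≤b
  size-step C (times i j) (o , n) κ n<d κ≤b = size-process-step (zero , o , n) (options C (times i j) (o , n)) κ
    (s≤s (s≤s (ℕₚ.≤-trans (ℕₚ.≤-reflexive (≡.trans (length-map _ (splits n)) (length-splits n))) (ℕₚ.<⇒≤ n<d)))) κ≤b

  size-steps : ∀ {k} (C : Circuit K (p ℕ.+ q) k) g Js (κ : Continuation {suc k}) {b} →
    All (λ J → proj₂ J < d) Js → SizeAtMost b κ → SizeAtMost (length Js ℕ.* stepCost ℕ.+ b) (steps C g Js κ)
  size-steps C g []       κ []          κ≤b = κ≤b
  size-steps C g (J ∷ Js) κ {b} (n<d ∷ Js<d) κ≤b σ = ℕₚ.≤-trans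
    (size-step C g J (steps C g Js κ) n<d (size-steps C g Js κ Js<d κ≤b) σ)
    (ℕₚ.≤-reflexive (≡.sym (ℕₚ.+-assoc stepCost (length Js ℕ.* stepCost) b)))

  size-compile : ∀ {k} (C : Circuit K (p ℕ.+ q) k) → SizeAtMost (k ℕ.* (d ℕ.* d ℕ.* stepCost)) (compile C)
  size-compile []      σ = z≤n
  size-compile (_▷_ {k} C g) σ = ℕₚ.≤-trans
    (size-steps C g (intervals d) (λ σ → compile C (restrict σ)) intervals<d (λ σ → size-compile C (restrict σ)) σ)
    (ℕₚ.≤-reflexive (≡.cong (λ l → l ℕ.* stepCost ℕ.+ k ℕ.* (d ℕ.* d ℕ.* stepCost)) (≡.trans
      (length-cartesianProduct (upTo d) (upTo d)) (≡.cong₂ ℕ._*_ (length-upTo d) (length-upTo d)))))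
    where
    intervals<d : All (λ J → proj₂ J < d) (intervals d)
    intervals<d = All.tabulate λ J∈ → ∈-upTo⁻ (proj₂ (∈-cartesianProduct⁻ (upTo d) (upTo d) J∈))

  -- The summands count the summation variables, the two `nor`s at the root, the choice among
  -- `d + 1` degrees with its clause, and `d * d` steps for each gate.
  size-program : ∀ {k} (C : Circuit K (p ℕ.+ q) k) out →
    size (program C out) ≤ q ℕ.+ (4 ℕ.+ (suc d ℕ.* 5 ℕ.+ suc (k ℕ.* (d ℕ.* d ℕ.* stepCost))))
  size-program C out = ℕₚ.≤-trans (ℕₚ.≤-reflexive (size-bindMany q (root C out (initial C out))))
    (ℕₚ.+-monoʳ-≤ q (ℕₚ.≤-trans
      (ℕₚ.≤-reflexive (≡.trans (size-nor [] (nor (suc zero ∷ []) body)) (≡.cong (2 ℕ.+_) (size-nor (suc zero ∷ []) body))))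
      (ℕₚ.+-monoʳ-≤ 4 (ℕₚ.≤-trans (size-branch (suc zero) (rootOptions C out) (compile C) (size-compile C))
        (ℕₚ.+-monoˡ-≤ _ (ℕₚ.*-monoˡ-≤ 5 (ℕₚ.≤-reflexive (≡.cong suc (≡.trans (length-map _ (upTo d)) (length-upTo d))))))))))
    where
    body = branch (suc zero) (rootOptions C out) (weaken (weaken (weaken (weaken (initial C out))))) (compile C)

-- The pair poset and its projections

Bool-ext : ∀ {b b′} → (b ≡ true → b′ ≡ true) → (b′ ≡ true → b ≡ true) → b ≡ b′
Bool-ext {true}  {b′}    f g = ≡.sym (f ≡.refl)
Bool-ext {false} {false} f g = ≡.refl
Bool-ext {false} {true}  f g = g ≡.refl

does⇒ : ∀ {a} {A : Set a} (a? : Dec A) → does a? ≡ true → A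
does⇒ (yes a) _ = a

all⇒ : ∀ {a} {A : Set a} {f : A → Bool} {xs} → all f xs ≡ true → ∀ {x} → x ∈ xs → f x ≡ true
all⇒ {f = f} {y ∷ xs} all≡true x∈ with f y in eq
all⇒ {f = f} {y ∷ xs} all≡true (here ≡.refl) | true = eq
all⇒ {f = f} {y ∷ xs} all≡true (there x∈)    | true = all⇒ all≡true x∈

⇒all : ∀ {a} {A : Set a} {f : A → Bool} xs → (∀ {x} → x ∈ xs → f x ≡ true) → all f xs ≡ true
⇒all []       f≡true = ≡.refl
⇒all (x ∷ xs) f≡true rewrite f≡true (here ≡.refl) = ⇒all xs (f≡true ∘ there)

does-∈? : ∀ {n} x (p : Subset n) → does (x ∈ˢ? p) ≡ lookup p x
does-∈? zero    (true  ∷ p) = ≡.refl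
does-∈? zero    (false ∷ p) = ≡.refl
does-∈? (suc x) (_ ∷ p)     = does-∈? x p

module _ {c ℓ} (R : CommutativeSemiring c ℓ) where

  open CommutativeSemiring R hiding (zero)
  open BigOperators R
  open import Relation.Binary.Reasoning.Setoid setoid

  -- Elements inj₁ i are minimal and inj₂ e lies above a e and b e.
  sum-over-pair-ideals : ∀ {m n} (a b : Fin n → Fin m) (h : Fin (m ℕ.+ n) → Carrier) →
    ∑ (allBoolVecs (m ℕ.+ n)) (λ I →
      if all (λ e → not (lookup I (m ↑ʳ e)) ∨ (lookup I (a e ↑ˡ n) ∧ lookup I (b e ↑ˡ n))) (allFin n)
      then ∏ (allFin (m ℕ.+ n)) (λ x → if lookup I x then h x else 1#) else 0#)
    ≈ ∑ (allBoolVecs m) (λ S → ∏ (allFin m) (λ i → if lookup S i then h (i ↑ˡ n) else 1#) *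
        ∏ (allFin n) (λ e → 1# + (if lookup S (a e) ∧ lookup S (b e) then h (m ↑ʳ e) else 0#)))
  sum-over-pair-ideals {m} {n} a b h = begin
    ∑ (allBoolVecs (m ℕ.+ n)) (λ I → summand I)
      ≈⟨ ∑-allBoolVecs-+ m n summand ⟩
    ∑ (allBoolVecs m) (λ S → ∑ (allBoolVecs n) λ T → summand (S Vec.++ T))
      ≈⟨ ∑-cong (allBoolVecs m) (λ S → ∑-cong (allBoolVecs n) λ T → split S T) ⟩
    ∑ (allBoolVecs m) (λ S → ∑ (allBoolVecs n) λ T → lower S * ∏ (allFin n) (λ e →
      if lookup T e then (if lookup S (a e) ∧ lookup S (b e) then h (m ↑ʳ e) else 0#) else 1#))
      ≈⟨ ∑-cong (allBoolVecs m) (λ S → trans (sym (*-distribˡ-∑ (lower S) (allBoolVecs n)))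
           (*-congˡ (∑-allBoolVecs-∏ n (λ e → if lookup S (a e) ∧ lookup S (b e) then h (m ↑ʳ e) else 0#) (λ _ → 1#)))) ⟩
    ∑ (allBoolVecs m) (λ S → lower S *
        ∏ (allFin n) (λ e → 1# + (if lookup S (a e) ∧ lookup S (b e) then h (m ↑ʳ e) else 0#))) ∎
    where
    closed : Vec Bool (m ℕ.+ n) → Fin n → Bool
    closed I e = not (lookup I (m ↑ʳ e)) ∨ (lookup I (a e ↑ˡ n) ∧ lookup I (b e ↑ˡ n))

    summand : Vec Bool (m ℕ.+ n) → Carrier
    summand I = if all (closed I) (allFin n)
      then ∏ (allFin (m ℕ.+ n)) (λ x → if lookup I x then h x else 1#) else 0#

    lower : Vec Bool m → Carrier
    lower S = ∏ (allFin m) (λ i → if lookup S i then h (i ↑ˡ n) else 1#)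

    pull : ∀ c {x y} → (if c then x * y else 0#) ≈ x * (if c then y else 0#)
    pull true  = refl
    pull false = sym (zeroʳ _)

    pointwise : ∀ t s {x : Carrier} → (if not t ∨ s then (if t then x else 1#) else 0#) ≈ (if t then (if s then x else 0#) else 1#)
    pointwise true  true  = refl
    pointwise true  false = refl
    pointwise false s     = refl

    split : ∀ S T → summand (S Vec.++ T) ≈ lower S * ∏ (allFin n) (λ e →
      if lookup T e then (if lookup S (a e) ∧ lookup S (b e) then h (m ↑ʳ e) else 0#) else 1#)
    split S T = begin
      summand (S Vec.++ T)
        ≈⟨ if-cong (all (closed (S Vec.++ T)) (allFin n)) (trans
             (∏-allFin-+ m n (λ x → if lookup (S Vec.++ T) x then h x else 1#))
             (*-cong (∏-cong (allFin m) λ i → reflexive (≡.cong (λ t → if t then h (i ↑ˡ n) else 1#) (lookup-++ˡ S T i)))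
                     (∏-cong (allFin n) λ e → reflexive (≡.cong (λ t → if t then h (m ↑ʳ e) else 1#) (lookup-++ʳ S T e))))) refl ⟩
      (if all (closed (S Vec.++ T)) (allFin n) then lower S * upper else 0#)
        ≈⟨ pull (all (closed (S Vec.++ T)) (allFin n)) ⟩
      lower S * (if all (closed (S Vec.++ T)) (allFin n) then upper else 0#)
        ≈⟨ *-congˡ (∏-if (allFin n) (closed (S Vec.++ T))) ⟨
      lower S * ∏ (allFin n) (λ e → if closed (S Vec.++ T) e then (if lookup T e then h (m ↑ʳ e) else 1#) else 0#)
        ≈⟨ *-congˡ (∏-cong (allFin n) λ e → trans
             (reflexive (≡.cong (λ c → if c then (if lookup T e then h (m ↑ʳ e) else 1#) else 0#)
               (≡.cong₂ (λ t s → not t ∨ s) (lookup-++ʳ S T e)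
                 (≡.cong₂ _∧_ (lookup-++ˡ S T (a e)) (lookup-++ˡ S T (b e))))))
             (pointwise (lookup T e) (lookup S (a e) ∧ lookup S (b e)))) ⟩
      lower S * ∏ (allFin n) (λ e → if lookup T e then (if lookup S (a e) ∧ lookup S (b e) then h (m ↑ʳ e) else 0#) else 1#) ∎
      where upper = ∏ (allFin n) (λ e → if lookup T e then h (m ↑ʳ e) else 1#)

module PairPoset {c ℓ₁ ℓ₂} (K : HeytingField c ℓ₁ ℓ₂) where

  open Substitution K

  module _ (N : ℕ) where

    -- All ordered pairs are used, the diagonal included. This avoids a choice of representatives,
    -- and a pair that is not an edge is projected to 0 and contributes the factor 1.
    first second : Fin (N ℕ.* N) → Fin N
    first  e = proj₁ (remQuot N e)
    second e = proj₂ (remQuot {N} N e)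

    Below : Rel (Fin N ⊎ Fin (N ℕ.* N)) 0ℓ
    Below (inj₁ i) (inj₂ e) = i ≡ first e ⊎ i ≡ second e
    Below _        _        = ⊥

    below? : ∀ s t → Dec (Below s t)
    below? (inj₁ i) (inj₁ j) = no λ ()
    below? (inj₁ i) (inj₂ e) = (i Fin.≟ first e) ⊎-dec (i Fin.≟ second e)
    below? (inj₂ e) t        = no λ ()

    -- The order has two levels only, so the cases of transitivity and antisymmetry with two strict
    -- relations are vacuous.
    Below-height : ∀ s t u → Below s t → Below t u → ⊥
    Below-height (inj₁ i) (inj₂ e) u _ ()

    infix 4 _≼_
    _≼_ : Rel (Fin (N ℕ.+ N ℕ.* N)) 0ℓ
    x ≼ y = x ≡ y ⊎ Below (splitAt N x) (splitAt N y)

    ≼-isDecPartialOrder : IsDecPartialOrder _≡_ _≼_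
    ≼-isDecPartialOrder = record
      { isPartialOrder = record
        { isPreorder = record
          { isEquivalence = ≡.isEquivalence
          ; reflexive     = inj₁
          ; trans         = λ
            { (inj₁ ≡.refl) y≼z           → y≼z
            ; (inj₂ x<y)    (inj₁ ≡.refl) → inj₂ x<y
            ; {x} {y} {z} (inj₂ x<y) (inj₂ y<z) → contra x y z x<y y<z
            }
          }
        ; antisym = λ
          { (inj₁ x≡y) _            → x≡y
          ; (inj₂ _)   (inj₁ y≡x)   → ≡.sym y≡x
          ; {x} {y} (inj₂ x<y) (inj₂ y<x) → contra x y x x<y y<x
          }
        }
      ; _≟_  = Fin._≟_
      ; _≤?_ = λ x y → (x Fin.≟ y) ⊎-dec below? (splitAt N x) (splitAt N y)
      }
      where
      contra : ∀ {a} {A : Set a} x y z → Below (splitAt N x) (splitAt N y) → Below (splitAt N y) (splitAt N z) → A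
      contra x y z x<y y<z with () ← Below-height (splitAt N x) (splitAt N y) (splitAt N z) x<y y<z

    pairPoset : WeightedPoset K (N ℕ.+ N ℕ.* N)
    pairPoset = record
      { size              = N ℕ.+ N ℕ.* N
      ; _≼_               = _≼_
      ; isDecPartialOrder = ≼-isDecPartialOrder
      ; weight            = inj₁
      }

    open WeightedPoset pairPoset using (IsIdeal; isIdeal?)

    -- A minimal element imposes no condition, an upper one exactly that its two lower neighbours be
    -- present. In this form the condition factors over the upper elements.
    isIdeal?-pairs : ∀ I → does (isIdeal? I) ≡
      all (λ e → not (lookup I (N ↑ʳ e)) ∨ (lookup I (first e ↑ˡ N ℕ.* N) ∧ lookup I (second e ↑ˡ N ℕ.* N))) (allFin (N ℕ.* N))
    isIdeal?-pairs I = Bool-ext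
      (λ ideal → ⇒all (allFin (N ℕ.* N)) λ {e} _ → closed (does⇒ (isIdeal? I) ideal) e)
      (λ closed → dec-true (isIdeal? I) λ where
        x x∈I .x (inj₁ ≡.refl) → x∈I
        x x∈I y  (inj₂ y<x)    → ideal (all⇒ closed) x y (splitAt N x) (splitAt N y) ≡.refl ≡.refl y<x x∈I)
      where
      closed : IsIdeal I → ∀ e → not (lookup I (N ↑ʳ e)) ∨ (lookup I (first e ↑ˡ N ℕ.* N) ∧ lookup I (second e ↑ˡ N ℕ.* N)) ≡ true
      closed ideal e with lookup I (N ↑ʳ e) in e∈I
      ... | false = ≡.refl
      ... | true  = ≡.cong₂ _∧_ (member (first e) (inj₁ ≡.refl)) (member (second e) (inj₂ ≡.refl))
        where
        member : ∀ i → i ≡ first e ⊎ i ≡ second e → lookup I (i ↑ˡ N ℕ.* N) ≡ true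
        member i i<e = []=⇒lookup (ideal (N ↑ʳ e) (lookup⇒[]= (N ↑ʳ e) I e∈I) (i ↑ˡ N ℕ.* N)
          (inj₂ (≡.subst₂ Below (≡.sym (Fin.splitAt-↑ˡ N i (N ℕ.* N))) (≡.sym (Fin.splitAt-↑ʳ N (N ℕ.* N) e)) i<e)))

      ideal : (∀ {e} → e ∈ allFin (N ℕ.* N) →
          not (lookup I (N ↑ʳ e)) ∨ (lookup I (first e ↑ˡ N ℕ.* N) ∧ lookup I (second e ↑ˡ N ℕ.* N)) ≡ true) →
        ∀ x y s t → splitAt N x ≡ s → splitAt N y ≡ t → Below t s → x ∈ˢ I → y ∈ˢ I
      ideal closed x y (inj₂ e) (inj₁ i) x≡ y≡ i<e x∈I
        rewrite ≡.sym (Fin.splitAt⁻¹-↑ʳ {i = x} x≡) | ≡.sym (Fin.splitAt⁻¹-↑ˡ {i = y} y≡)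
        with both ← closed (∈-allFin e) rewrite []=⇒lookup x∈I = lookup⇒[]= (i ↑ˡ N ℕ.* N) I (pick i<e)
        where
        pick : i ≡ first e ⊎ i ≡ second e → lookup I (i ↑ˡ N ℕ.* N) ≡ true
        pick (inj₁ ≡.refl) with lookup I (first e ↑ˡ N ℕ.* N)
        ... | true = ≡.refl
        pick (inj₂ ≡.refl) with lookup I (first e ↑ˡ N ℕ.* N)
        ... | true = both

  module _ {c ℓ} (R : CommutativeSemiring c ℓ) {v : ℕ} (X : WeightedPoset K v) where

    open CommutativeSemiring R using (Carrier; _≈_; 0#; 1#; reflexive; trans; refl)
    open BigOperators R
    open WeightedPoset X

    -- Kept general in the poset and the values, as both the projection and the membership in VNP
    -- start from it.
    sum-over-ideals : ∀ (h : Fin size → Carrier) →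
      ∑ (filter isIdeal? (allBoolVecs size)) (λ I → ∏ (filter (_∈ˢ? I) (allFin size)) h) ≈
      ∑ (allBoolVecs size) (λ I → if does (isIdeal? I) then ∏ (allFin size) (λ x → if lookup I x then h x else 1#) else 0#)
    sum-over-ideals h = trans (∑-filter isIdeal? (allBoolVecs size)) (∑-cong (allBoolVecs size) λ I →
      if-cong (does (isIdeal? I)) (trans (∏-filter (_∈ˢ? I) (allFin size)) (∏-cong (allFin size) λ x →
        reflexive (≡.cong (λ b → if b then h x else 1#) (does-∈? x I)))) refl)

  module Projection {p : ℕ} where

    private module K = CommutativeRing coefficientRing
    open CommutativeSemiring (polynomials {p}) hiding (zero)
    open BigOperators (polynomials {p})
    open Programs (polynomials {p})
    open Weighted (Atom K p) (atom K) (inj₂ K.1#) refl (inj₂ (K.- K.1#)) 1+const-1≈0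
    open PrenexForm (inj₂ K.0#) const-0
    open import Relation.Binary.Reasoning.Setoid setoid

    module _ (N : ℕ) (E : Program 0) (|E|≤N : size E ≤ N) where

      private
        P = prenex E |E|≤N

        unclosed : Variable 0 N → Fin N
        unclosed (inj₂ i) = i

        edges : List (Fin N × Fin N)
        edges = map (λ (x , y) → unclosed x , unclosed y) (pairs P)

      open DecMembership (Product.≡-dec (Fin._≟_ {N}) (Fin._≟_ {N})) using () renaming (_∈?_ to _∈ₑ?_)

      edge : Fin (N ℕ.* N) → Bool
      edge e = does (remQuot {N} N e ∈ₑ? edges)

      projection : Fin (N ℕ.+ N ℕ.* N) → Atom K p
      projection = [ weights P , (λ e → inj₂ (if edge e then K.- K.1# else K.0#)) ]′ ∘ splitAt N

      -- The list of conflicts may repeat a pair, while the poset has one element for each ordered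
      -- pair. Nothing is lost, since either condition says that no listed pair lies inside `S`.
      independent≡compatible : ∀ S →
        all (λ e → not ((lookup S (first N e) ∧ lookup S (second N e)) ∧ edge e)) (allFin (N ℕ.* N))
          ≡ all (compatible [] S) (pairs P)
      independent≡compatible S = Bool-ext
        (λ independent → ⇒all (pairs P) λ {xy} xy∈ → compat xy (forward (all⇒ independent) (∈-map⁺ _ xy∈)))
        (λ compatible → ⇒all (allFin (N ℕ.* N)) λ {e} _ → backward (all⇒ compatible) e)
        where
        conflictFree : Fin N × Fin N → Bool
        conflictFree (i , j) = not (lookup S i ∧ lookup S j)

        compat : ∀ xy → conflictFree (unclosed (proj₁ xy) , unclosed (proj₂ xy)) ≡ true → compatible [] S xy ≡ true
        compat (inj₂ i , inj₂ j) free = free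

        Free : Fin N × Fin N → Set
        Free (i , j) = not ((lookup S i ∧ lookup S j) ∧ does ((i , j) ∈ₑ? edges)) ≡ true

        forward : (∀ {e} → e ∈ allFin (N ℕ.* N) → Free (remQuot {N} N e)) →
          ∀ {ij} → ij ∈ edges → conflictFree ij ≡ true
        forward independent {i , j} ij∈
          with free ← ≡.subst Free (Fin.remQuot-combine {N} {N} i j) (independent (∈-allFin (combine i j)))
          rewrite dec-true ((i , j) ∈ₑ? edges) ij∈ = ≡.trans (≡.cong not (≡.sym (∧-identityʳ _))) free

        free : (∀ {xy} → xy ∈ pairs P → compatible [] S xy ≡ true) → ∀ ij → Free ij
        free compatible ij with ij ∈ₑ? edges
        ... | no  _  = ≡.cong not (∧-zeroʳ _)
        ... | yes ij∈ with ∈-map⁻ _ ij∈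
        ...   | (inj₂ i , inj₂ j) , xy∈ , ≡.refl = ≡.trans (≡.cong not (∧-identityʳ _)) (compatible xy∈)

        backward : (∀ {xy} → xy ∈ pairs P → compatible [] S xy ≡ true) → ∀ e → Free (remQuot {N} N e)
        backward compatible e = free compatible (remQuot {N} N e)

      program-isProjection : ⟦ E ⟧ [] ≈ substitute K (IPP K (pairPoset N)) (atom K ∘ projection)
      program-isProjection = sym (begin
        sub (IPP K X)
          ≈⟨ substitute-∑ (atom K ∘ projection) ideals (λ I → P′.∏ (filter (_∈ˢ? I) (allFin M)) (var K)) ⟩
        ∑ ideals (λ I → sub (P′.∏ (filter (_∈ˢ? I) (allFin M)) (var K)))
          ≈⟨ ∑-cong ideals (λ I → trans (substitute-∏ (atom K ∘ projection) (filter (_∈ˢ? I) (allFin M)) (var K))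
               (∏-cong (filter (_∈ˢ? I) (allFin M)) (substitute-var (atom K ∘ projection)))) ⟩
        ∑ ideals (λ I → ∏ (filter (_∈ˢ? I) (allFin M)) h)
          ≈⟨ sum-over-ideals polynomials X h ⟩
        ∑ (allBoolVecs M) (λ I → if does (isIdeal? I) then ∏ (allFin M) (λ x → if lookup I x then h x else 1#) else 0#)
          ≈⟨ ∑-cong (allBoolVecs M) (λ I → reflexive (≡.cong
               (λ b → if b then ∏ (allFin M) (λ x → if lookup I x then h x else 1#) else 0#) (isIdeal?-pairs N I))) ⟩
        _ ≈⟨ sum-over-pair-ideals polynomials (first N) (second N) h ⟩
        ∑ (allBoolVecs N) (λ S → ∏ (allFin N) (λ i → if lookup S i then h (i ↑ˡ N ℕ.* N) else 1#) *
          ∏ (allFin (N ℕ.* N)) (λ e → 1# + (if lookup S (first N e) ∧ lookup S (second N e) then h (N ↑ʳ e) else 0#)))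
          ≈⟨ ∑-cong (allBoolVecs N) (λ S → *-cong (lower S) (upper S)) ⟩
        ∑ (allBoolVecs N) (λ S → term (weights P) S * (if all (compatible [] S) (pairs P) then 1# else 0#))
          ≈⟨ ∑-cong (allBoolVecs N) (λ S → select (all (compatible [] S) (pairs P)) (term (weights P) S)) ⟩
        ⟦ P ⟧ᵖ []
          ≈⟨ ⟦prenex⟧ E |E|≤N [] ⟩
        ⟦ E ⟧ [] ∎)
        where
        X = pairPoset N
        M = N ℕ.+ N ℕ.* N
        open WeightedPoset X using (isIdeal?)
        module P′ = BigOperators (polynomials {M})
        ideals = filter isIdeal? (allBoolVecs M)
        sub : Poly K M → Poly K p
        sub f = substitute K f (atom K ∘ projection)
        h : Fin M → Poly K p
        h x = atom K (projection x)

        lower : ∀ S → ∏ (allFin N) (λ i → if lookup S i then h (i ↑ˡ N ℕ.* N) else 1#) ≈ term (weights P) S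
        lower S = ∏-cong (allFin N) λ i → if-cong (lookup S i)
          (reflexive (≡.cong (atom K ∘ [ weights P , _ ]′) (Fin.splitAt-↑ˡ N i (N ℕ.* N)))) refl

        factor : ∀ b b′ → 1# + (if b then const K (if b′ then K.- K.1# else K.0#) else 0#) ≈ (if not (b ∧ b′) then 1# else 0#)
        factor true  true  = 1+const-1≈0
        factor true  false = trans (+-congˡ {x = 1#} const-0) (+-identityʳ 1#)
        factor false _     = +-identityʳ 1#

        upper : ∀ S → ∏ (allFin (N ℕ.* N)) (λ e → 1# + (if lookup S (first N e) ∧ lookup S (second N e) then h (N ↑ʳ e) else 0#))
          ≈ (if all (compatible [] S) (pairs P) then 1# else 0#)
        upper S = begin
          ∏ (allFin (N ℕ.* N)) (λ e → 1# + (if lookup S (first N e) ∧ lookup S (second N e) then h (N ↑ʳ e) else 0#))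
            ≈⟨ ∏-cong (allFin (N ℕ.* N)) (λ e → trans
                 (+-congˡ {x = 1#} (if-cong (lookup S (first N e) ∧ lookup S (second N e))
                   (reflexive (≡.cong (atom K ∘ [ weights P , _ ]′) (Fin.splitAt-↑ʳ N (N ℕ.* N) e))) refl))
                 (factor (lookup S (first N e) ∧ lookup S (second N e)) (edge e))) ⟩
          ∏ (allFin (N ℕ.* N)) (λ e → if free e then 1# else 0#)
            ≈⟨ ∏-if (allFin (N ℕ.* N)) free ⟩
          (if all free (allFin (N ℕ.* N)) then ∏ (allFin (N ℕ.* N)) (λ _ → 1#) else 0#)
            ≈⟨ if-cong (all free (allFin (N ℕ.* N))) (∏-one (allFin (N ℕ.* N))) refl ⟩
          (if all free (allFin (N ℕ.* N)) then 1# else 0#)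
            ≡⟨ ≡.cong (λ b → if b then 1# else 0#) (independent≡compatible S) ⟩
          (if all (compatible [] S) (pairs P) then 1# else 0#) ∎
          where
          free : Fin (N ℕ.* N) → Bool
          free e = not ((lookup S (first N e) ∧ lookup S (second N e)) ∧ edge e)

        select : ∀ b x → x * (if b then 1# else 0#) ≈ (if b then x else 0#)
        select true  x = *-identityʳ x
        select false x = zeroʳ x

-- Closure properties of polynomially bounded functions

module _ where

  open import Data.Nat.Base using (_+_; _*_; _^_)
  open ℕₚ.≤-Reasoning

  private
    -- The added 1 is needed at `n = 0`, where the power with exponent 0 is 1 but every higher one
    -- is 0.
    ^-≤ : ∀ n j k → n ^ j ≤ n ^ (j + k) + 1
    ^-≤ zero    zero    k = ℕₚ.m≤n+m 1 (0 ^ k)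
    ^-≤ zero    (suc j) k = z≤n
    ^-≤ (suc n) j       k = ℕₚ.≤-trans (ℕₚ.^-monoʳ-≤ (suc n) (ℕₚ.m≤m+n j k)) (ℕₚ.m≤m+n _ 1)

    raise : ∀ (t : ℕ → ℕ) c j → (∀ n → t n ≤ c * n ^ j + c) → ∀ k n → t n ≤ c * (n ^ (j + k) + 2)
    raise t c j t≤ k n = begin
      t n                         ≤⟨ t≤ n ⟩
      c * n ^ j + c               ≤⟨ ℕₚ.+-monoˡ-≤ c (ℕₚ.*-monoʳ-≤ c (^-≤ n j k)) ⟩
      c * (n ^ (j + k) + 1) + c   ≡⟨ rearrange c (n ^ (j + k)) ⟩
      c * (n ^ (j + k) + 2)       ∎
      where
      rearrange : ∀ c x → c * (x + 1) + c ≡ c * (x + 2)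
      rearrange = solve-∀

  polynomiallyBounded-≤ : ∀ {t u} → PolynomiallyBounded u → (∀ n → t n ≤ u n) → PolynomiallyBounded t
  polynomiallyBounded-≤ (c , k , u≤) t≤u = c , k , λ n → ℕₚ.≤-trans (t≤u n) (u≤ n)

  polynomiallyBounded-const : ∀ b → PolynomiallyBounded (λ _ → b)
  polynomiallyBounded-const b = b , 0 , λ n → ℕₚ.m≤n+m b _

  polynomiallyBounded-id : PolynomiallyBounded (λ n → n)
  polynomiallyBounded-id = 1 , 1 , λ n → begin
    n                  ≡⟨ rearrange n ⟨
    1 * n ^ 1          ≤⟨ ℕₚ.m≤m+n _ 1 ⟩
    1 * n ^ 1 + 1      ∎
    where
    rearrange : ∀ n → 1 * n ^ 1 ≡ n
    rearrange n = ≡.trans (ℕₚ.*-identityˡ (n ^ 1)) (ℕₚ.*-identityʳ n)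

  polynomiallyBounded-+ : ∀ {t u} → PolynomiallyBounded t → PolynomiallyBounded u → PolynomiallyBounded (λ n → t n + u n)
  polynomiallyBounded-+ {t} {u} (c , j , t≤) (d , k , u≤) = (c + d) * 2 , j + k , λ n → begin
    t n + u n
      ≤⟨ ℕₚ.+-mono-≤ (raise t c j t≤ k n) (ℕₚ.≤-trans (raise u d k u≤ j n) (ℕₚ.≤-reflexive (≡.cong (λ l → d * (n ^ l + 2)) (ℕₚ.+-comm k j)))) ⟩
    c * (n ^ (j + k) + 2) + d * (n ^ (j + k) + 2)
      -- This slack equalises the coefficient and the constant term, as the form of
      -- `PolynomiallyBounded` demands.
      ≤⟨ ℕₚ.m≤m+n _ ((c + d) * n ^ (j + k)) ⟩
    c * (n ^ (j + k) + 2) + d * (n ^ (j + k) + 2) + (c + d) * n ^ (j + k)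
      ≡⟨ rearrange c d (n ^ (j + k)) ⟩
    (c + d) * 2 * n ^ (j + k) + (c + d) * 2 ∎
    where
    rearrange : ∀ c d x → c * (x + 2) + d * (x + 2) + (c + d) * x ≡ (c + d) * 2 * x + (c + d) * 2
    rearrange = solve-∀

  polynomiallyBounded-* : ∀ {t u} → PolynomiallyBounded t → PolynomiallyBounded u → PolynomiallyBounded (λ n → t n * u n)
  polynomiallyBounded-* {t} {u} (c , j , t≤) (d , k , u≤) = c * d * 4 , j + k , λ n → begin
    t n * u n
      ≤⟨ ℕₚ.*-mono-≤ (t≤ n) (u≤ n) ⟩
    (c * n ^ j + c) * (d * n ^ k + d)
      ≡⟨ expand c d (n ^ j) (n ^ k) ⟩
    c * d * (n ^ j * n ^ k + n ^ j + n ^ k + 1)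
      ≡⟨ ≡.cong (λ x → c * d * (x + n ^ j + n ^ k + 1)) (ℕₚ.^-distribˡ-+-* n j k) ⟨
    c * d * (n ^ (j + k) + n ^ j + n ^ k + 1)
      ≤⟨ ℕₚ.*-monoʳ-≤ (c * d) (ℕₚ.+-monoˡ-≤ 1 (ℕₚ.+-mono-≤ (ℕₚ.+-monoʳ-≤ (n ^ (j + k)) (^-≤ n j k))
           (ℕₚ.≤-trans (^-≤ n k j) (ℕₚ.≤-reflexive (≡.cong (λ l → n ^ l + 1) (ℕₚ.+-comm k j)))))) ⟩
    c * d * (n ^ (j + k) + (n ^ (j + k) + 1) + (n ^ (j + k) + 1) + 1)
      ≤⟨ ℕₚ.m≤m+n _ (c * d * (n ^ (j + k) + 1)) ⟩
    c * d * (n ^ (j + k) + (n ^ (j + k) + 1) + (n ^ (j + k) + 1) + 1) + c * d * (n ^ (j + k) + 1)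
      ≡⟨ collect (c * d) (n ^ (j + k)) ⟩
    c * d * 4 * n ^ (j + k) + c * d * 4 ∎
    where
    expand : ∀ c d x y → (c * x + c) * (d * y + d) ≡ c * d * (x * y + x + y + 1)
    expand = solve-∀
    collect : ∀ e x → e * (x + (x + 1) + (x + 1) + 1) + e * (x + 1) ≡ e * 4 * x + e * 4
    collect = solve-∀

-- Membership of ideal polynomials in VNP

module Membership {c ℓ₁ ℓ₂} (K : HeytingField c ℓ₁ ℓ₂) where

  open Substitution K
  open PairPoset K using (sum-over-ideals)
  private
    module K = CommutativeRing coefficientRing
    module P {v : ℕ} where
      open CommutativeSemiring (polynomials {v}) public
      open BigOperators (polynomials {v}) public

  -- It bounds every listed term, cancelling ones included. It is stronger than `DegreeAtMost` and
  -- passes through the list operations directly.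
  TermsUpTo : ∀ {v} → ℕ → Poly K v → Set c
  TermsUpTo d = All λ (a , e) → Vec.sum e ≤ d

  module _ {v : ℕ} where

    degreeAtMost : ∀ {d} {f : Poly K v} → TermsUpTo d f → DegreeAtMost K f d
    degreeAtMost []                          m d<m = K.refl
    degreeAtMost {f = (a , e) ∷ f} (e≤d ∷ f≤d) m d<m
      rewrite dec-false (≡-dec ℕₚ._≟_ e m) (λ { ≡.refl → ℕₚ.<⇒≱ d<m e≤d }) =
      K.trans (K.+-identityˡ _) (degreeAtMost f≤d m d<m)

    termsUpTo-≤ : ∀ {d d′} {f : Poly K v} → d ≤ d′ → TermsUpTo d f → TermsUpTo d′ f
    termsUpTo-≤ d≤d′ = All.map λ e≤d → ℕₚ.≤-trans e≤d d≤d′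

    termsUpTo-const : ∀ {d} a → TermsUpTo d (const K {v} a)
    termsUpTo-const a = ℕₚ.≤-trans (ℕₚ.≤-reflexive (sum-replicate-0 v)) z≤n ∷ []

    termsUpTo-atom : ∀ (a : Atom K v) → TermsUpTo 1 (atom K a)
    termsUpTo-atom (inj₁ i) = ℕₚ.≤-reflexive (sum-unit i) ∷ []
    termsUpTo-atom (inj₂ a) = termsUpTo-const a

    termsUpTo-* : ∀ {d d′} {f g : Poly K v} → TermsUpTo d f → TermsUpTo d′ g → TermsUpTo (d ℕ.+ d′) (f P.* g)
    termsUpTo-* []          g≤ = []
    termsUpTo-* {f = (a , e) ∷ f} (e≤d ∷ f≤) g≤ = All.++⁺
      (All.map⁺ (All.map (λ {(b , e′)} e′≤d′ → ℕₚ.≤-trans (ℕₚ.≤-reflexive (sum-⊕ e e′)) (ℕₚ.+-mono-≤ e≤d e′≤d′)) g≤))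
      (termsUpTo-* f≤ g≤)

    termsUpTo-∑ : ∀ {a} {A : Set a} {d} (xs : List A) {f : A → Poly K v} →
      (∀ x → TermsUpTo d (f x)) → TermsUpTo d (P.∑ xs f)
    termsUpTo-∑ []       f≤ = []
    termsUpTo-∑ (x ∷ xs) f≤ = All.++⁺ (f≤ x) (termsUpTo-∑ xs f≤)

    termsUpTo-∏ : ∀ {a} {A : Set a} (xs : List A) {f : A → Poly K v} →
      (∀ x → TermsUpTo 1 (f x)) → TermsUpTo (length xs) (P.∏ xs f)
    termsUpTo-∏ []       f≤ = termsUpTo-const K.1#
    termsUpTo-∏ (x ∷ xs) f≤ = termsUpTo-* (f≤ x) (termsUpTo-∏ xs f≤)

  IPP-degree : ∀ {v} (X : WeightedPoset K v) → DegreeAtMost K (IPP K X) (WeightedPoset.size X)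
  IPP-degree X = degreeAtMost (termsUpTo-∑ (filter isIdeal? (allBoolVecs size)) λ I →
    termsUpTo-≤ (ℕₚ.≤-trans (length-filter (_∈ˢ? I) (allFin size)) (ℕₚ.≤-reflexive (length-tabulate id)))
      (termsUpTo-∏ (filter (_∈ˢ? I) (allFin size)) (λ x → termsUpTo-atom (weight x))))
    where open WeightedPoset X

  infixl 6 _⊞_
  infixl 7 _⊠_
  -- An intermediate between polynomials and circuits: substitution becomes evaluation by recursion,
  -- and the number of nodes is read off the tree.
  data Formula (v : ℕ) : Set c where
    leaf    : Atom K v → Formula v
    _⊞_ _⊠_ : Formula v → Formula v → Formula v

  evaluate : ∀ {u v} → (Fin u → Poly K v) → Formula u → Poly K v
  evaluate a (leaf x) = [ a , const K ]′ x
  evaluate a (φ ⊞ ψ)  = evaluate a φ P.+ evaluate a ψ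
  evaluate a (φ ⊠ ψ)  = evaluate a φ P.* evaluate a ψ

  polynomial : ∀ {v} → Formula v → Poly K v
  polynomial = evaluate (var K)

  nodes : ∀ {v} → Formula v → ℕ
  nodes (leaf _) = 1
  nodes (φ ⊞ ψ)  = suc (nodes φ ℕ.+ nodes ψ)
  nodes (φ ⊠ ψ)  = suc (nodes φ ℕ.+ nodes ψ)

  substitute-polynomial : ∀ {u v} (a : Fin u → Poly K v) φ → substitute K (polynomial φ) a P.≈ evaluate a φ
  substitute-polynomial a (leaf (inj₁ i)) = substitute-var a i
  substitute-polynomial a (leaf (inj₂ b)) = substitute-const a b
  substitute-polynomial a (φ ⊞ ψ) = P.trans (substitute-+ a (polynomial φ) (polynomial ψ))
    (P.+-cong (substitute-polynomial a φ) (substitute-polynomial a ψ))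
  substitute-polynomial a (φ ⊠ ψ) = P.trans (substitute-* a (polynomial φ) (polynomial ψ))
    (P.*-cong (substitute-polynomial a φ) (substitute-polynomial a ψ))

  -- In a tree, degrees add at a product just as node counts do, so one bound controls both degree
  -- and size. Circuits with shared nodes allow repeated squaring and have no such bound.
  termsUpTo-formula : ∀ {v} (φ : Formula v) → TermsUpTo (nodes φ) (polynomial φ)
  termsUpTo-formula (leaf (inj₁ i)) = termsUpTo-atom (inj₁ i)
  termsUpTo-formula (leaf (inj₂ b)) = termsUpTo-atom (inj₂ b)
  termsUpTo-formula (φ ⊞ ψ) = All.++⁺
    (termsUpTo-≤ (ℕₚ.≤-trans (ℕₚ.m≤m+n _ (nodes ψ)) (ℕₚ.n≤1+n _)) (termsUpTo-formula φ))
    (termsUpTo-≤ (ℕₚ.≤-trans (ℕₚ.m≤n+m _ (nodes φ)) (ℕₚ.n≤1+n _)) (termsUpTo-formula ψ))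
  termsUpTo-formula (φ ⊠ ψ) =
    termsUpTo-≤ (ℕₚ.n≤1+n _) (termsUpTo-* (termsUpTo-formula φ) (termsUpTo-formula ψ))

  -- New nodes shift the old ones, and `keep` tells where their values went. The node count is given
  -- by an equation and not by an index, which spares transporting circuits along associativity of
  -- addition.
  record Extension {v k} (C : Circuit K v k) (f : Poly K v) (n : ℕ) : Set c where
    field
      {total}   : ℕ
      circuit   : Circuit K v total
      total≡    : total ≡ n ℕ.+ k
      out       : Fin total
      out-value : value K circuit out ≡ f
      keep      : ∀ i → ∃[ j ] value K circuit j ≡ value K C i

  open Extension

  module _ {v : ℕ} where

    private
      module Both {k} {C : Circuit K v k} {f g m n} (E : Extension C f m) (E′ : Extension (circuit E) g n) where
        left : Fin (total E′)
        left = proj₁ (keep E′ (out E))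
        left-value : value K (circuit E′) left ≡ f
        left-value = ≡.trans (proj₂ (keep E′ (out E))) (out-value E)
        kept : ∀ i → ∃[ j ] value K (circuit E′) j ≡ value K C i
        kept i with j , eq ← keep E i with j′ , eq′ ← keep E′ j = j′ , ≡.trans eq′ eq
        count : suc (total E′) ≡ suc (m ℕ.+ n) ℕ.+ k
        count = ≡.cong suc (≡.trans (total≡ E′) (≡.trans (≡.cong (n ℕ.+_) (total≡ E))
          (≡.trans (≡.sym (ℕₚ.+-assoc n m k)) (≡.cong (ℕ._+ k) (ℕₚ.+-comm n m)))))

    extend : ∀ {k} (C : Circuit K v k) φ → Extension C (polynomial φ) (nodes φ)
    extend C (leaf x) = record
      { circuit   = C ▷ input x
      ; total≡    = ≡.refl
      ; out       = zero
      ; out-value = atom≡ x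
      ; keep      = λ i → suc i , ≡.refl
      }
      where
      atom≡ : ∀ x → atom K x ≡ polynomial (leaf x)
      atom≡ (inj₁ i) = ≡.refl
      atom≡ (inj₂ b) = ≡.refl
    extend C (φ ⊞ ψ) = record
      { circuit   = circuit E′ ▷ plus left (out E′)
      ; total≡    = count
      ; out       = zero
      ; out-value = ≡.cong₂ P._+_ left-value (out-value E′)
      ; keep      = λ i → suc (proj₁ (kept i)) , proj₂ (kept i)
      }
      where
      E  = extend C φ
      E′ = extend (circuit E) ψ
      open Both E E′
    extend C (φ ⊠ ψ) = record
      { circuit   = circuit E′ ▷ times left (out E′)
      ; total≡    = count
      ; out       = zero
      ; out-value = ≡.cong₂ P._*_ left-value (out-value E′)
      ; keep      = λ i → suc (proj₁ (kept i)) , proj₂ (kept i)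
      }
      where
      E  = extend C φ
      E′ = extend (circuit E) ψ
      open Both E E′

    formula-circuit : ∀ (φ : Formula v) → CircuitSizeAtMost K (polynomial φ) (nodes φ)
    formula-circuit φ = total E , ℕₚ.≤-reflexive (≡.trans (total≡ E) (ℕₚ.+-identityʳ _)) , circuit E , out E ,
      coeff-≈ (P.reflexive (≡.sym (out-value E)))
      where E = extend [] φ

    ∏ᶠ : ∀ {a} {A : Set a} → List A → (A → Formula v) → Formula v
    ∏ᶠ xs F = foldr (λ x φ → F x ⊠ φ) (leaf (inj₂ K.1#)) xs

    nodes-∏ᶠ : ∀ {a} {A : Set a} (xs : List A) {F : A → Formula v} {b} → (∀ x → nodes (F x) ≤ b) →
      nodes (∏ᶠ xs F) ≤ length xs ℕ.* suc b ℕ.+ 1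
    nodes-∏ᶠ []       F≤b = ℕₚ.≤-refl
    nodes-∏ᶠ (x ∷ xs) {b = b} F≤b = s≤s (ℕₚ.≤-trans (ℕₚ.+-mono-≤ (F≤b x) (nodes-∏ᶠ xs F≤b))
      (ℕₚ.≤-reflexive (≡.sym (ℕₚ.+-assoc b _ 1))))

  evaluate-∏ᶠ : ∀ {u v} (a : Fin u → Poly K v) {b} {A : Set b} (xs : List A) F →
    evaluate a (∏ᶠ xs F) P.≈ P.∏ xs (λ x → evaluate a (F x))
  evaluate-∏ᶠ a []       F = P.refl
  evaluate-∏ᶠ a (x ∷ xs) F = P.*-congˡ {x = evaluate a (F x)} (evaluate-∏ᶠ a xs F)

  module _ {v : ℕ} (X : WeightedPoset K v) where

    open WeightedPoset X

    private
      ε : Fin size → Formula (v ℕ.+ size)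
      ε x = leaf (inj₁ (v ↑ʳ x))
      one : Formula (v ℕ.+ size)
      one = leaf (inj₂ K.1#)

    -- φ if ε x = 1, and 1 if ε x = 0.
    whenSelected : Fin size → Formula (v ℕ.+ size) → Formula (v ℕ.+ size)
    whenSelected x φ = one ⊞ leaf (inj₂ (K.- K.1#)) ⊠ ε x ⊞ ε x ⊠ φ

    -- At a Boolean point the first product is the weight of the selected subset and the second the
    -- indicator of an ideal, with one factor for each implication from `x` to `y`. Pairs with no
    -- relation get the trivial factor 1, so all factors have the same shape.
    idealFormula : Formula (v ℕ.+ size)
    idealFormula =
      ∏ᶠ (allFin size) (λ x → whenSelected x (leaf (Sum.map₁ (_↑ˡ size) (weight x)))) ⊠
      ∏ᶠ (allFin size) (λ x → ∏ᶠ (allFin size) λ y → whenSelected x (if does (y ≼? x) then ε y else one))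

    -- Applied to a leaf, `whenSelected` has 9 nodes; the multiplication joining it to the product
    -- makes 10, and the empty product adds 1.
    nodes-idealFormula : nodes idealFormula ≤
      suc (size ℕ.* 10 ℕ.+ 1 ℕ.+ (size ℕ.* suc (size ℕ.* 10 ℕ.+ 1) ℕ.+ 1))
    nodes-idealFormula = s≤s (ℕₚ.+-mono-≤ (over (λ _ → ℕₚ.≤-refl)) (over λ x → over λ y → inner (does (y ≼? x)) {x} y))
      where
      over : ∀ {F : Fin size → Formula (v ℕ.+ size)} {b} → (∀ x → nodes (F x) ≤ b) →
        nodes (∏ᶠ (allFin size) F) ≤ size ℕ.* suc b ℕ.+ 1
      over {b = b} F≤b = ℕₚ.≤-trans (nodes-∏ᶠ (allFin size) F≤b)
        (ℕₚ.≤-reflexive (≡.cong (λ l → l ℕ.* suc b ℕ.+ 1) (length-tabulate {n = size} id)))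
      inner : ∀ b {x} y → nodes (whenSelected x (if b then ε y else one)) ≤ 9
      inner true  y = ℕₚ.≤-refl
      inner false y = ℕₚ.≤-refl

    isIdeal?-all : ∀ I → does (isIdeal? I) ≡
      all (λ x → all (λ y → not (lookup I x ∧ does (y ≼? x)) ∨ lookup I y) (allFin size)) (allFin size)
    isIdeal?-all I = Bool-ext
      (λ ideal → ⇒all (allFin size) λ {x} _ → ⇒all (allFin size) λ {y} _ → closed (does⇒ (isIdeal? I) ideal) x y)
      (λ closed → dec-true (isIdeal? I) λ x x∈I y y≼x → lookup⇒[]= y I
        (open′ ([]=⇒lookup x∈I) (dec-true (y ≼? x) y≼x) (all⇒ (all⇒ closed (∈-allFin x)) (∈-allFin y))))
      where
      closed : IsIdeal I → ∀ x y → not (lookup I x ∧ does (y ≼? x)) ∨ lookup I y ≡ true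
      closed ideal x y with lookup I x in x∈I | y ≼? x
      ... | false | _       = ≡.refl
      ... | true  | no  _   = ≡.refl
      ... | true  | yes y≼x = []=⇒lookup (ideal x (lookup⇒[]= x I x∈I) y y≼x)

      open′ : ∀ {a b c} → a ≡ true → b ≡ true → not (a ∧ b) ∨ c ≡ true → c ≡ true
      open′ ≡.refl ≡.refl c≡true = c≡true

    IPP≈booleanSum : IPP K X P.≈ booleanSum K v (polynomial idealFormula)
    IPP≈booleanSum = P.trans (sum-over-ideals polynomials X (λ x → atom K (weight x)))
      (P.∑-cong (allBoolVecs size) λ I → P.sym (summand I))
      where
      open import Relation.Binary.Reasoning.Setoid (P.setoid {v})

      module _ (I : Vec Bool size) where

        point : Fin (v ℕ.+ size) → Poly K v
        point = [ var K , boolConst K ∘ lookup I ]′ ∘ splitAt v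

        point-ε : ∀ x → point (v ↑ʳ x) ≡ boolConst K (lookup I x)
        point-ε x = ≡.cong [ var K , boolConst K ∘ lookup I ]′ (Fin.splitAt-↑ʳ v size x)

        point-weight : ∀ a → evaluate point (leaf (Sum.map₁ (_↑ˡ size) a)) ≡ atom K a
        point-weight (inj₁ i) = ≡.cong [ var K , boolConst K ∘ lookup I ]′ (Fin.splitAt-↑ˡ v i size)
        point-weight (inj₂ b) = ≡.refl

        selected : ∀ x φ {f} → evaluate point φ ≡ f →
          evaluate point (whenSelected x φ) P.≈ (if lookup I x then f else P.1#)
        selected x φ {f} φ≡f rewrite point-ε x | φ≡f = cases (lookup I x)
          where
          cases : ∀ b → P.1# P.+ const K (K.- K.1#) P.* boolConst K b P.+ boolConst K b P.* f P.≈ (if b then f else P.1#)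
          cases true  = P.trans (P.+-cong {u = P.1# P.* f} (P.trans (P.+-congˡ {x = P.1#} (P.*-identityʳ (const K (K.- K.1#)))) 1+const-1≈0)
            (P.*-identityˡ f)) P.refl
          cases false = P.trans
            (P.+-cong {x = P.1# P.+ const K (K.- K.1#) P.* const K K.0#} {u = const K K.0# P.* f}
              (P.trans (P.+-congˡ {x = P.1#} (P.trans (P.*-congˡ {x = const K (K.- K.1#)} const-0) (P.zeroʳ (const K (K.- K.1#)))))
                (P.+-identityʳ P.1#))
              (P.trans (P.*-congʳ {x = f} const-0) (P.zeroˡ f)))
            (P.+-identityʳ P.1#)

        order : ∀ x y → evaluate point (whenSelected x (if does (y ≼? x) then ε y else one)) P.≈
          (if not (lookup I x ∧ does (y ≼? x)) ∨ lookup I y then P.1# else P.0#)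
        order x y with does (y ≼? x)
        ... | true  = P.trans (selected x (ε y) (point-ε y)) (cases (lookup I x) (lookup I y))
          where
          cases : ∀ b b′ → (if b then boolConst K b′ else P.1#) P.≈ (if not (b ∧ true) ∨ b′ then P.1# else P.0#)
          cases true  true  = P.refl
          cases true  false = const-0
          cases false b′    = P.refl
        ... | false = P.trans (selected x one ≡.refl) (cases (lookup I x))
          where
          cases : ∀ b → (if b then P.1# else P.1#) P.≈ (if not (b ∧ false) ∨ lookup I y then P.1# else P.0#)
          cases true  = P.refl
          cases false = P.refl

        only-if : ∀ xs (b : Fin size → Bool) → P.∏ {v} xs (λ x → if b x then P.1# else P.0#) P.≈ (if all b xs then P.1# else P.0#)
        only-if xs b = P.trans (P.∏-if xs b) (P.if-cong (all b xs) (P.∏-one xs) P.refl)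

        summand : substitute K (polynomial idealFormula) point P.≈
          (if does (isIdeal? I) then P.∏ (allFin size) (λ x → if lookup I x then atom K (weight x) else P.1#) else P.0#)
        summand = begin
          substitute K (polynomial idealFormula) point
            ≈⟨ substitute-polynomial point idealFormula ⟩
          evaluate point idealFormula
            ≈⟨ P.*-cong
                 (P.trans (evaluate-∏ᶠ point (allFin size) weighted)
                   (P.∏-cong (allFin size) λ x → selected x (leaf (Sum.map₁ (_↑ˡ size) (weight x))) (point-weight (weight x))))
                 (P.trans (evaluate-∏ᶠ point (allFin size) (λ x → ∏ᶠ (allFin size) (ordered x)))
                   (P.trans (P.∏-cong (allFin size) λ x → P.trans (evaluate-∏ᶠ point (allFin size) (ordered x))
                     (P.trans (P.∏-cong (allFin size) (order x)) (only-if (allFin size) _)))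
                   (P.trans (only-if (allFin size) _) (P.reflexive (≡.cong (λ b → if b then P.1# else P.0#) (≡.sym (isIdeal?-all I))))))) ⟩
          P.∏ (allFin size) (λ x → if lookup I x then atom K (weight x) else P.1#) P.* (if does (isIdeal? I) then P.1# else P.0#)
            ≈⟨ select (does (isIdeal? I)) _ ⟩
          (if does (isIdeal? I) then P.∏ (allFin size) (λ x → if lookup I x then atom K (weight x) else P.1#) else P.0#) ∎
          where
          weighted : Fin size → Formula (v ℕ.+ size)
          weighted x = whenSelected x (leaf (Sum.map₁ (_↑ˡ size) (weight x)))
          ordered : Fin size → Fin size → Formula (v ℕ.+ size)
          ordered x y = whenSelected x (if does (y ≼? x) then ε y else one)
          select : ∀ b f → f P.* (if b then P.1# else P.0#) P.≈ (if b then f else P.0#)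
          select true  f = P.*-identityʳ f
          select false f = P.zeroʳ f

  -- The summation variables select a subset of the poset, and `idealFormula` is the summand. The
  -- same `bound` limits its degree and its circuit size.
  IPP∈VNP : ∀ (v : ℕ → ℕ) (X : ∀ n → WeightedPoset K (v n)) → PolynomiallyBounded v →
    PolynomiallyBounded (λ n → WeightedPoset.size (X n)) → VNP K (family v (λ n → IPP K (X n)))
  IPP∈VNP v X v-bounded size-bounded =
    (v-bounded , size , size-bounded , λ n → IPP-degree (X n)) ,
    size , (λ n → polynomial (idealFormula (X n))) ,
    ( (polynomiallyBounded-+ v-bounded size-bounded , bound , bound-bounded ,
        λ n → degreeAtMost (termsUpTo-≤ (nodes-idealFormula (X n)) (termsUpTo-formula (idealFormula (X n)))))
    , bound , bound-bounded , λ n → enlarge {f = polynomial (idealFormula (X n))} (nodes-idealFormula (X n)) (formula-circuit (idealFormula (X n)))) ,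
    λ n → coeff-≈ (IPP≈booleanSum (X n))
    where
    size : ℕ → ℕ
    size n = WeightedPoset.size (X n)

    bound : ℕ → ℕ
    bound n = 1 ℕ.+ (size n ℕ.* 10 ℕ.+ 1 ℕ.+ (size n ℕ.* (1 ℕ.+ (size n ℕ.* 10 ℕ.+ 1)) ℕ.+ 1))

    bound-bounded : PolynomiallyBounded bound
    bound-bounded = 1+ (10·size+1 +ᵇ (size-bounded ·ᵇ 1+ 10·size+1 +ᵇ ⟨ 1 ⟩))
      where
      infixl 6 _+ᵇ_
      infixl 7 _·ᵇ_
      _+ᵇ_ = polynomiallyBounded-+
      _·ᵇ_ = polynomiallyBounded-*
      ⟨_⟩ = polynomiallyBounded-const
      1+ : ∀ {t} → PolynomiallyBounded t → PolynomiallyBounded (λ n → 1 ℕ.+ t n)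
      1+ = polynomiallyBounded-+ ⟨ 1 ⟩
      10·size+1 : PolynomiallyBounded (λ n → size n ℕ.* 10 ℕ.+ 1)
      10·size+1 = size-bounded ·ᵇ ⟨ 10 ⟩ +ᵇ ⟨ 1 ⟩

    enlarge : ∀ {v b b′} {f : Poly K v} → b ≤ b′ → CircuitSizeAtMost K f b → CircuitSizeAtMost K f b′
    enlarge b≤b′ (s , s≤b , rest) = s , ℕₚ.≤-trans s≤b b≤b′ , rest

-- Completeness of the pair family

module Completeness {c ℓ₁ ℓ₂} (K : HeytingField c ℓ₁ ℓ₂) where

  open Substitution K
  open PairPoset K
  open Membership K
  private
    module K = CommutativeRing coefficientRing
    module P {v : ℕ} where
      open CommutativeSemiring (polynomials {v}) public
      open BigOperators (polynomials {v}) public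

  pairFamily : Family K
  pairFamily = family (λ n → n ℕ.+ n ℕ.* n) (λ n → IPP K (pairPoset n))

  pairFamily∈VNP : VNP K pairFamily
  pairFamily∈VNP = IPP∈VNP (λ n → n ℕ.+ n ℕ.* n) pairPoset n+n² n+n²
    where
    n+n² : PolynomiallyBounded (λ n → n ℕ.+ n ℕ.* n)
    n+n² = polynomiallyBounded-+ polynomiallyBounded-id (polynomiallyBounded-* polynomiallyBounded-id polynomiallyBounded-id)

  programSize : ℕ → ℕ → ℕ → ℕ
  programSize q d s = q ℕ.+ (4 ℕ.+ (suc d ℕ.* 5 ℕ.+ suc (s ℕ.* (d ℕ.* d ℕ.* ((2 ℕ.+ d) ℕ.* 5 ℕ.+ 3)))))

  -- The index of the poset depends only on the bounds, not on the circuit found, so it is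
  -- polynomially bounded along a family; a smaller program is padded by `prenex`.
  circuit-isProjection : ∀ {p} q d s (f : Poly K p) (g : Poly K (p ℕ.+ q)) → DegreeAtMost K g d →
    CircuitSizeAtMost K g s → _≈ᴾ_ K f (booleanSum K p g) → IsProjectionOf K f (IPP K (pairPoset (programSize q d s)))
  circuit-isProjection {p} q d s f g deg≤d (k , k≤s , C , out , g≈C) f≈∑ = projection N E |E|≤N , coeff-≈ (begin
    f                             ≈⟨ coefficientwise f≈∑ ⟩
    booleanSum K p g              ≈⟨ P.∑-cong (allBoolVecs q) (λ ε → substitute-cong _ {g} {value K C out} (coefficientwise g≈C)) ⟩
    booleanSum K p (value K C out) ≈⟨ ⟦program⟧ C out deg′ ⟨
    ⟦ E ⟧ []                      ≈⟨ program-isProjection N E |E|≤N ⟩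
    substitute K (IPP K (pairPoset N)) (λ x → atom K (projection N E |E|≤N x)) ∎)
    where
    open Compilation K p q d
    open Projection {p}
    open import Relation.Binary.Reasoning.Setoid (P.setoid {p})
    N = programSize q d s
    E = program C out

    |E|≤N : size E ≤ N
    |E|≤N = ℕₚ.≤-trans (size-program C out)
      (ℕₚ.+-monoʳ-≤ q (ℕₚ.+-monoʳ-≤ 4 (ℕₚ.+-monoʳ-≤ (suc d ℕ.* 5) (ℕ.s≤s (ℕₚ.*-monoˡ-≤ _ k≤s)))))

    deg′ : DegreeAtMost K (value K C out) d
    deg′ m d<m = K.trans (K.sym (g≈C m)) (deg≤d m d<m)

  pairFamily-hard : ∀ f → VNP K f → IsPProjectionOf K f pairFamily
  pairFamily-hard f (_ , q , g , ((vars-bounded , d , d-bounded , g-degree) , s , s-bounded , g-circuit) , f≈∑) =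
    (λ n → programSize (q n) (d n) (s n)) ,
    (q-bounded +ᵇ (⟨ 4 ⟩ +ᵇ ((⟨ 1 ⟩ +ᵇ d-bounded) ·ᵇ ⟨ 5 ⟩ +ᵇ (⟨ 1 ⟩ +ᵇ
      s-bounded ·ᵇ (d-bounded ·ᵇ d-bounded ·ᵇ ((⟨ 2 ⟩ +ᵇ d-bounded) ·ᵇ ⟨ 5 ⟩ +ᵇ ⟨ 3 ⟩)))))) ,
    0 , λ n _ → circuit-isProjection (q n) (d n) (s n) (Family.poly f n) (g n) (g-degree n) (g-circuit n) (f≈∑ n)
    where
    infixl 6 _+ᵇ_
    infixl 7 _·ᵇ_
    _+ᵇ_ = polynomiallyBounded-+
    _·ᵇ_ = polynomiallyBounded-*
    ⟨_⟩ = polynomiallyBounded-const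
    q-bounded : PolynomiallyBounded q
    -- Membership of `g` in VP bounds all its variables together, the summation variables among
    -- them.
    q-bounded = polynomiallyBounded-≤ vars-bounded λ n → ℕₚ.m≤n+m (q n) (Family.vars f n)

corollary1 : ∀ {c ℓ₁ ℓ₂} (K : HeytingField c ℓ₁ ℓ₂) →
    CharacteristicNotTwo K →
    Σ[ v ∈ (ℕ → ℕ) ] Σ[ X ∈ (∀ n → WeightedPoset K (v n)) ]
    VNPComplete K (family v (λ n → IPP K (X n)))
corollary1 K _ = (λ n → n ℕ.+ n ℕ.* n) , pairPoset , pairFamily∈VNP , pairFamily-hard
  where
  open Completeness K
  open PairPoset K
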